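{- There exists a fixed tree automatic structure $\mathcal{A}$ of bounded degree such that $\mathrm{FOTh}(\mathcal{A})$ is $\mathsf{3EXPTIME}$-hard.
   Context: Finite binary trees over an alphabet $\Gamma$ are maps $t:\mathrm{dom}(t)\to\Gamma$ with $\mathrm{dom}(t)\subseteq\{0,1\}^*$ finite, nonempty, and for all $w$, if $\{w0,w1\}\cap\mathrm{dom}(t)\neq\emptyset$ then $w,w0\in\mathrm{dom}(t)$. The convolution $t_1\otimes\cdots\otimes t_m$ is the tree over $(\Gamma\cup\{\$\})^m$ with domain $\bigcup_i\mathrm{dom}(t_i)$ labelled $(a_1,\dots,a_m)$ at $w$, $a_i=t_i(w)$ if defined and $\$$ otherwise. A relation $R$ on trees is tree-automatic if the set of convolutions of its tuples is accepted by a finite tree automaton. A structure over a finite relational signature is tree automatic if it is isomorphic to $(L,(R_r)_r)/{\equiv}$ with $L$ a regular set of finite binary trees and the relations $R_r\subseteq L^{m_r}$ and the congruence $\equiv\subseteq L^2$ tree-automatic. Bounded degree: some constant bounds the number of neighbours of every node in the Gaifman graph (where $a,b$ are adjacent iff they occur together in a tuple of some relation). $\mathrm{FOTh}(\mathcal{A})$ is the set of closed first-order formulas (with equality) true in $\mathcal{A}$. $\mathsf{3EXPTIME}$: problems decidable in deterministic time $2^{2^{2^{n^{O(1)}}}}$. -}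

module Defs where

open import Data.Nat using (ℕ; zero; suc; _+_; _^_; _≤_; _≡ᵇ_)
open import Data.Bool using (Bool; true; false; if_then_else_)
open import Data.Fin using (Fin; toℕ) renaming (zero to fz; suc to fs)
open import Data.Maybe using (Maybe; just; nothing)
open import Data.List using (List; []; _∷_; _++_; [_]; length; replicate)
open import Data.List.Membership.Propositional using (_∈_)
open import Data.List.Relation.Unary.All using (All)
open import Data.List.Relation.Unary.Unique.Propositional using (Unique)
open import Data.Vec using (Vec) renaming ([] to []ᵛ; _∷_ to _∷ᵛ_; map to mapᵛ)
import Data.Vec.Relation.Unary.All as VAll
import Data.Vec.Membership.Propositional as VMem
open import Data.Vec.Relation.Binary.Pointwise.Inductive using (Pointwise)
open import Data.Product using (Σ; Σ-syntax; _×_; _,_; proj₁)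
open import Data.Sum using (_⊎_)
open import Relation.Nullary using (¬_)
open import Relation.Binary.PropositionalEquality using (_≡_; _≢_)
open import Function.Bundles using (_⇔_)
open import Function.Definitions using (Surjective)

-- Finite binary trees (domain-based, as in the paper)
-- Addresses are words over {0,1} = Bool (false = 0, true = 1); w·b = w ++ [ b ].

Defined : {Γ : Set} → Maybe Γ → Set
Defined {Γ} m = Σ Γ λ a → m ≡ just a

record Tree (Γ : Set) : Set where
  field
    lab      : List Bool → Maybe Γ
    finite   : Σ ℕ λ N → ∀ w → N ≤ length w → lab w ≡ nothing
    nonempty : Σ (List Bool) λ w → Defined (lab w)
    closed   : ∀ w b → Defined (lab (w ++ [ b ])) →
               Defined (lab w) × Defined (lab (w ++ [ false ]))
open Tree public

-- Convolution of m trees, as a labelling of addresses by (Γ ∪ {$})^m,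
-- where $ is represented by nothing.  Undefined (nothing) outside the union
-- of the domains.
allNothing : {A : Set} {m : ℕ} → Vec (Maybe A) m → Bool
allNothing []ᵛ = true
allNothing (nothing ∷ᵛ xs) = allNothing xs
allNothing (just _ ∷ᵛ xs) = false

convLab : {Γ : Set} {m : ℕ} → Vec (Tree Γ) m → List Bool → Maybe (Vec (Maybe Γ) m)
convLab ts w =
  let v = mapᵛ (λ t → lab t w) ts in
  if allNothing v then nothing else just v

-- Nondeterministic (bottom-up) finite tree automata over a finite alphabet S.
-- Nodes may have 0 children, one (left) child, or two children.

record TA (S : Set) : Set where
  field
    nQ  : ℕ
    δ0  : S → Fin nQ → Bool
    δ1  : S → Fin nQ → Fin nQ → Bool           -- (a, q of child 0) ↦ q
    δ2  : S → Fin nQ → Fin nQ → Fin nQ → Bool  -- (a, q0, q1) ↦ q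
    fin : Fin nQ → Bool
open TA public

module _ {S : Set} (M : TA S) where
  Trans : {B C : Set} → Maybe B → Maybe C → S → Fin (nQ M) → Fin (nQ M) → Fin (nQ M) → Set
  Trans nothing  _        a q0 q1 q = δ0 M a q ≡ true
  Trans (just _) nothing  a q0 q1 q = δ1 M a q0 q ≡ true
  Trans (just _) (just _) a q0 q1 q = δ2 M a q0 q1 q ≡ true

  AcceptsLab : (List Bool → Maybe S) → Set
  AcceptsLab ℓ = Σ (List Bool → Fin (nQ M)) λ ρ →
    (∀ w a → ℓ w ≡ just a →
       Trans (ℓ (w ++ [ false ])) (ℓ (w ++ [ true ])) a
             (ρ (w ++ [ false ])) (ρ (w ++ [ true ])) (ρ w))
    × fin M (ρ []) ≡ true

record Structure (r : ℕ) (ar : Fin r → ℕ) : Set₁ where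
  field
    Carrier : Set
    rel     : (i : Fin r) → Vec Carrier (ar i) → Set
open Structure public

record Presentation (r : ℕ) (ar : Fin r → ℕ) : Set₁ where
  field
    g     : ℕ
    autL  : TA (Fin g)
    autR  : (i : Fin r) → TA (Vec (Maybe (Fin g)) (ar i))
    autEq : TA (Vec (Maybe (Fin g)) 2)
  Elem : Set
  Elem = Σ (Tree (Fin g)) λ t → AcceptsLab autL (lab t)
  RelP : (i : Fin r) → Vec Elem (ar i) → Set
  RelP i es = AcceptsLab (autR i) (convLab (mapᵛ proj₁ es))
  EqP : Elem → Elem → Set
  EqP a b = AcceptsLab autEq (convLab (proj₁ a ∷ᵛ proj₁ b ∷ᵛ []ᵛ))
open Presentation public

IsCongruence : {r : ℕ} {ar : Fin r → ℕ} → Presentation r ar → Set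
IsCongruence {r} {ar} P =
  (∀ a → EqP P a a) ×
  (∀ a b → EqP P a b → EqP P b a) ×
  (∀ a b c → EqP P a b → EqP P b c → EqP P a c) ×
  (∀ (i : Fin r) (es es' : Vec (Elem P) (ar i)) →
     Pointwise (EqP P) es es' → RelP P i es → RelP P i es')

-- A is isomorphic to (L, (R_i)_i)/≡ : a surjection h : L → A whose kernel is ≡
-- and which preserves and reflects every relation.
IsoQuot : {r : ℕ} {ar : Fin r → ℕ} → Structure r ar → Presentation r ar → Set
IsoQuot {r} {ar} A P = Σ (Elem P → Carrier A) λ h →
  Surjective _≡_ _≡_ h ×
  (∀ a b → (h a ≡ h b) ⇔ EqP P a b) ×
  (∀ (i : Fin r) (es : Vec (Elem P) (ar i)) → rel A i (mapᵛ h es) ⇔ RelP P i es)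

TreeAutomatic : {r : ℕ} {ar : Fin r → ℕ} → Structure r ar → Set₁
TreeAutomatic {r} {ar} A = Σ (Presentation r ar) λ P → IsCongruence P × IsoQuot A P

Adjacent : {r : ℕ} {ar : Fin r → ℕ} (A : Structure r ar) → Carrier A → Carrier A → Set
Adjacent {r} {ar} A a b = a ≢ b × Σ (Fin r) λ i → Σ (Vec (Carrier A) (ar i)) λ es →
  rel A i es × a VMem.∈ es × b VMem.∈ es

BoundedDegree : {r : ℕ} {ar : Fin r → ℕ} → Structure r ar → Set
BoundedDegree A = Σ ℕ λ d → ∀ a (bs : List (Carrier A)) →
  Unique bs → All (Adjacent A a) bs → length bs ≤ d

data Formula {r : ℕ} (ar : Fin r → ℕ) : Set where
  Rel : (i : Fin r) → Vec ℕ (ar i) → Formula ar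
  Eq  : ℕ → ℕ → Formula ar
  Not : Formula ar → Formula ar
  And : Formula ar → Formula ar → Formula ar
  Or  : Formula ar → Formula ar → Formula ar
  Ex  : ℕ → Formula ar → Formula ar
  Fa  : ℕ → Formula ar → Formula ar

Scoped : {r : ℕ} {ar : Fin r → ℕ} → List ℕ → Formula ar → Set
Scoped Δ (Rel i xs) = VAll.All (_∈ Δ) xs
Scoped Δ (Eq x y)   = x ∈ Δ × y ∈ Δ
Scoped Δ (Not φ)    = Scoped Δ φ
Scoped Δ (And φ ψ)  = Scoped Δ φ × Scoped Δ ψ
Scoped Δ (Or φ ψ)   = Scoped Δ φ × Scoped Δ ψ
Scoped Δ (Ex x φ)   = Scoped (x ∷ Δ) φ
Scoped Δ (Fa x φ)   = Scoped (x ∷ Δ) φ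

Closed : {r : ℕ} {ar : Fin r → ℕ} → Formula ar → Set
Closed φ = Scoped [] φ

_[_↦_] : {C : Set} → (ℕ → C) → ℕ → C → ℕ → C
(ρ [ x ↦ a ]) y = if y ≡ᵇ x then a else ρ y

Sat : {r : ℕ} {ar : Fin r → ℕ} (A : Structure r ar) → (ℕ → Carrier A) → Formula ar → Set
Sat A ρ (Rel i xs) = rel A i (mapᵛ ρ xs)
Sat A ρ (Eq x y)   = ρ x ≡ ρ y
Sat A ρ (Not φ)    = ¬ Sat A ρ φ
Sat A ρ (And φ ψ)  = Sat A ρ φ × Sat A ρ ψ
Sat A ρ (Or φ ψ)   = Sat A ρ φ ⊎ Sat A ρ ψ
Sat A ρ (Ex x φ)   = Σ (Carrier A) λ a → Sat A (ρ [ x ↦ a ]) φ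
Sat A ρ (Fa x φ)   = (a : Carrier A) → Sat A (ρ [ x ↦ a ]) φ

-- Binary encoding of formulas: token k = 1^k 0 (a prefix code); variables in unary.
tok : ℕ → List Bool
tok k = replicate k true ++ [ false ]

encVars : {n : ℕ} → Vec ℕ n → List Bool
encVars []ᵛ = []
encVars (x ∷ᵛ xs) = tok x ++ encVars xs

encode : {r : ℕ} {ar : Fin r → ℕ} → Formula ar → List Bool
encode (Eq x y)   = tok 0 ++ tok x ++ tok y
encode (Not φ)    = tok 1 ++ encode φ
encode (And φ ψ)  = tok 2 ++ encode φ ++ encode ψ
encode (Or φ ψ)   = tok 3 ++ encode φ ++ encode ψ
encode (Ex x φ)   = tok 4 ++ tok x ++ encode φ
encode (Fa x φ)   = tok 5 ++ tok x ++ encode φ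
encode (Rel i xs) = tok (6 + toℕ i) ++ encVars xs

FOTh : {r : ℕ} {ar : Fin r → ℕ} → Structure r ar → List Bool → Set
FOTh {r} {ar} A w = Σ (Formula ar) λ φ →
  Closed φ × encode φ ≡ w × (∀ (ρ : ℕ → Carrier A) → Sat A ρ φ)

-- Deterministic one-tape Turing machines.
-- Tape alphabet Fin (3 + nS): 0 = blank, 1 = bit 0, 2 = bit 1, others auxiliary.
-- Tape is one-way infinite (cells ℕ); moving left at cell 0 stays at 0.

data Ctrl (n : ℕ) : Set where
  halt : Bool → Ctrl n
  run  : Fin n → Ctrl n

data Move : Set where
  left right stay : Move

record TM : Set where
  field
    nQ    : ℕ
    nS    : ℕ
    start : Ctrl nQ
    δ     : Fin nQ → Fin (3 + nS) → Ctrl nQ × Fin (3 + nS) × Move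

record Config (M : TM) : Set where
  constructor config
  field
    ctrl : Ctrl (TM.nQ M)
    tape : ℕ → Fin (3 + TM.nS M)
    head : ℕ
open Config public

bitSym : {s : ℕ} → Bool → Fin (3 + s)
bitSym false = fs fz
bitSym true  = fs (fs fz)

inputTape : {s : ℕ} → List Bool → ℕ → Fin (3 + s)
inputTape []      i       = fz
inputTape (b ∷ w) zero    = bitSym b
inputTape (b ∷ w) (suc i) = inputTape w i

initConfig : (M : TM) → List Bool → Config M
initConfig M w = config (TM.start M) (inputTape w) 0

moveHead : Move → ℕ → ℕ
moveHead left  zero    = zero
moveHead left  (suc h) = h
moveHead right h       = suc h
moveHead stay  h       = h

step : (M : TM) → Config M → Config M
step M (config (halt b) t h) = config (halt b) t h
step M (config (run q) t h) with TM.δ M q (t h)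
... | c , a , mv = config c (λ i → if i ≡ᵇ h then a else t i) (moveHead mv h)

runFor : (M : TM) → ℕ → Config M → Config M
runFor M zero    c = c
runFor M (suc n) c = runFor M n (step M c)

readOut : {s : ℕ} → ℕ → (ℕ → Fin (3 + s)) → ℕ → List Bool
readOut zero       t i = []
readOut (suc fuel) t i with t i
... | fs fz      = false ∷ readOut fuel t (suc i)
... | fs (fs fz) = true ∷ readOut fuel t (suc i)
... | _          = []

DecidesIn : TM → (ℕ → ℕ) → (List Bool → Set) → Set
DecidesIn M T L = ∀ w → Σ ℕ λ n → n ≤ T (length w) × Σ Bool λ b →
  ctrl (runFor M n (initConfig M w)) ≡ halt b × ((b ≡ true) ⇔ L w)

-- M computes f within time T: it halts within T(|w|) steps with f(w) written
-- on the tape from cell 0, followed by a non-bit symbol.  (Cells beyond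
-- |w| + n are blank after n steps, so reading |w| + n + 1 cells suffices.)
ComputesIn : TM → (ℕ → ℕ) → (List Bool → List Bool) → Set
ComputesIn M T f = ∀ w → Σ ℕ λ n → n ≤ T (length w) × Σ Bool λ b →
  ctrl (runFor M n (initConfig M w)) ≡ halt b ×
  readOut (suc (length w + n)) (tape (runFor M n (initConfig M w))) 0 ≡ f w

In3EXPTIME : (List Bool → Set) → Set
In3EXPTIME L = Σ TM λ M → Σ ℕ λ k → DecidesIn M (λ n → 2 ^ (2 ^ (2 ^ ((2 + n) ^ k)))) L

PolyTimeComputable : (List Bool → List Bool) → Set
PolyTimeComputable f = Σ TM λ M → Σ ℕ λ k → ComputesIn M (λ n → (2 + n) ^ k) f

_≤p_ : (List Bool → Set) → (List Bool → Set) → Set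
L ≤p P = Σ (List Bool → List Bool) λ f → PolyTimeComputable f × (∀ w → L w ⇔ P (f w))

3EXPTIME-hard : (List Bool → Set) → Set₁
3EXPTIME-hard P = ∀ (L : List Bool → Set) → In3EXPTIME L → L ≤p P

{-# OPTIONS --safe #-}
module Submission where

-- An element of the structure is a tree that may encode a proof of claims "the tile at position
-- (a , t) is τ" about the space-time diagram of a Turing machine M.  The diagram is arranged so
-- that the tile at (a , t) is determined by those at (a ∸ 1 , t) and (a , t ∸ 1), which are the
-- children of the claim.  Each claim has a data tree of depth 2^m, whose 2^(2^m) leaves hold the
-- binary digits of a, a ∸ 1, t, t ∸ 1; so positions up to 2^(2^(2^m)) can be expressed.
-- Subtraction of one within a data tree is regular.  That a child repeats the numbers of its
-- parent is not; but a mark can be moved from the roots of all data trees in parallel to their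
-- leaves with any common address, and the digits at the marked leaves can be compared by an
-- automaton.  The moves are injective partial maps, so the degree is bounded, and a sentence of
-- size O(m) quantifies over all walks of length 2^m.  The tiles of M and the input are checked
-- with walks along the leftmost branches, since the structure must not depend on M.

-- Subproofs are repeated rather than shared, so a proof tree may be exponentially larger than the
-- part of the diagram it covers. This is free, because one existential quantifier ranges over
-- finite trees of any size. As the machine is deterministic, the local tests force every tile of
-- such a tree, and acceptance can be read off at its root.
--
-- One step of the machine depends on three cells, but a claim has only two children. Each row is
-- therefore shifted one place to the right, and a tile carries the whole window: it shares two
-- contents with its left neighbour and takes the third from below.
--
-- Two marks are needed because the items to be compared lie at different depths: tile `j` beside
-- tile `j′`, or a letter at depth `i` and its copy at depth `i + 1` in the left child.
--
-- Nothing fixes the shape of the data trees in advance. Walks that cannot move all marks rest, and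
-- the final test then forces neighbouring data trees to have equal shape, without which their
-- numbers could not be compared digit by digit.

open import Defs
open import Data.Bool using (Bool; true; false; if_then_else_; _∧_; _∨_; not; T)
open import Data.Empty using (⊥; ⊥-elim)
open import Data.Fin using (Fin; toℕ; combine; remQuot; splitAt; fromℕ<; _↑ˡ_; _↑ʳ_) renaming (zero to fz; suc to fs)
import Data.Fin.Properties as Fin
open import Data.List using (List; []; _∷_; _++_; [_]; length)
import Data.List as List
import Data.List.Properties as List
open import Data.List.Relation.Unary.All using (All)
import Data.List.Relation.Unary.All as All
open import Data.List.Membership.Propositional.Properties using (∈-lookup)
import Data.List.Relation.Unary.AllPairs as AllPairs
open import Data.List.Relation.Unary.Unique.Propositional using (Unique)
open import Data.Maybe using (Maybe; just; nothing; _<∣>_) renaming (map to mapᵐ)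
open import Data.Maybe.Properties using (just-injective)
open import Data.Nat using (ℕ; zero; suc; _+_; _*_; _^_; _≤_; _<_; z≤n; s≤s; _⊔_; _≡ᵇ_; _∸_; pred)
import Data.Nat.Properties as ℕ
open import Data.Product using (Σ; _×_; _,_; proj₁; proj₂; uncurry; ∃)
open import Data.Sum using (_⊎_; inj₁; inj₂)
open import Data.Unit using (⊤; tt)
open import Data.Vec using (Vec) renaming ([] to []ᵛ; _∷_ to _∷ᵛ_; map to mapᵛ; lookup to lookupᵛ)
open import Data.Vec.Relation.Unary.Any using (here; there)
open import Data.Vec.Relation.Binary.Pointwise.Inductive using (Pointwise) renaming ([] to []ᵖ; _∷_ to _∷ᵖ_)
open import Function using (_∘_; id)
open import Function.Bundles using (_⇔_; mk⇔; Equivalence)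
open import Relation.Binary.PropositionalEquality using (_≡_; _≢_; refl; sym; trans; cong; cong₂; subst; subst₂; module ≡-Reasoning)
open import Relation.Binary.Definitions using (DecidableEquality)
open import Relation.Nullary using (¬_; Dec; yes; no; contradiction)
open import Relation.Nullary.Decidable using (⌊_⌋; map′)
open import Data.List.Membership.Propositional using (_∈_)
open import Data.List.Relation.Unary.Any using (Any) renaming (here to hereˡ; there to thereˡ)
import Data.Vec.Relation.Unary.All as VAll
import Data.Vec.Properties as Vec
open import Data.Vec using (_[_]≔_) renaming (replicate to replicateᵛ)

-- Finite types

-- A retraction suffices: injectivity of `enc` yields decidable equality, automaton states and
-- pigeonholes, and surplus codes are allowed.
record Finite (A : Set) : Set where
  field
    size    : ℕ
    enc     : A → Fin size
    dec     : Fin size → A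
    dec-enc : ∀ a → dec (enc a) ≡ a
open Finite ⦃ ... ⦄

retract : {A B : Set} (f : A → B) (f⁻ : B → A) → (∀ a → f⁻ (f a) ≡ a) → Finite B → Finite A
retract f f⁻ inv F = record
  { size = F.size ; enc = F.enc ∘ f ; dec = f⁻ ∘ F.dec
  ; dec-enc = λ a → trans (cong f⁻ (F.dec-enc (f a))) (inv a) }
  where module F = Finite F

instance
  finite-⊤ : Finite ⊤
  finite-⊤ = record { size = 1 ; enc = λ _ → fz ; dec = λ _ → tt ; dec-enc = λ _ → refl }

  finite-Fin : ∀ {n} → Finite (Fin n)
  finite-Fin {n} = record { size = n ; enc = id ; dec = id ; dec-enc = λ _ → refl }

  finite-× : {A B : Set} ⦃ _ : Finite A ⦄ ⦃ _ : Finite B ⦄ → Finite (A × B)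
  finite-× {A} {B} ⦃ FA ⦄ ⦃ FB ⦄ = record
    { size = Finite.size FA * Finite.size FB
    ; enc = λ (a , b) → combine (enc a) (enc b)
    ; dec = λ i → let (x , y) = remQuot {Finite.size FA} (Finite.size FB) i in dec x , dec y
    ; dec-enc = λ (a , b) → trans
        (cong (λ (x , y) → (dec x , dec y)) (Fin.remQuot-combine (enc a) (enc b)))
        (cong₂ _,_ (dec-enc a) (dec-enc b)) }

  finite-⊎ : {A B : Set} ⦃ _ : Finite A ⦄ ⦃ _ : Finite B ⦄ → Finite (A ⊎ B)
  finite-⊎ {A} {B} ⦃ FA ⦄ ⦃ FB ⦄ = record
    { size = Finite.size FA + Finite.size FB
    ; enc = into ; dec = λ i → back (splitAt (Finite.size FA) i) ; dec-enc = inv }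
    where
    into : A ⊎ B → Fin (Finite.size FA + Finite.size FB)
    into (inj₁ a) = enc a ↑ˡ Finite.size FB
    into (inj₂ b) = Finite.size FA ↑ʳ enc b
    back : Fin (Finite.size FA) ⊎ Fin (Finite.size FB) → A ⊎ B
    back (inj₁ i) = inj₁ (dec i)
    back (inj₂ i) = inj₂ (dec i)
    inv : ∀ x → back (splitAt (Finite.size FA) (into x)) ≡ x
    inv (inj₁ a) = trans (cong back (Fin.splitAt-↑ˡ _ (enc a) _)) (cong inj₁ (dec-enc a))
    inv (inj₂ b) = trans (cong back (Fin.splitAt-↑ʳ _ _ (enc b))) (cong inj₂ (dec-enc b))

  finite-Bool : Finite Bool
  finite-Bool = retract {B = ⊤ ⊎ ⊤} (λ { true → inj₁ tt ; false → inj₂ tt })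
    (λ { (inj₁ _) → true ; (inj₂ _) → false }) (λ { true → refl ; false → refl }) finite-⊎

  finite-Maybe : {A : Set} ⦃ _ : Finite A ⦄ → Finite (Maybe A)
  finite-Maybe {A} = retract {B = ⊤ ⊎ A} (λ { nothing → inj₁ tt ; (just a) → inj₂ a })
    (λ { (inj₁ _) → nothing ; (inj₂ a) → just a }) (λ { nothing → refl ; (just _) → refl }) finite-⊎

enc-injective : {A : Set} ⦃ _ : Finite A ⦄ {a b : A} → enc a ≡ enc b → a ≡ b
enc-injective {a = a} {b} e = trans (sym (dec-enc a)) (trans (cong dec e) (dec-enc b))

_≟_ : {A : Set} ⦃ _ : Finite A ⦄ → DecidableEquality A
a ≟ b = map′ enc-injective (cong enc) (enc a Fin.≟ enc b)

opaque
  _==_ : {A : Set} ⦃ _ : Finite A ⦄ → A → A → Bool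
  a == b = ⌊ a ≟ b ⌋

  ==-sound : {A : Set} ⦃ _ : Finite A ⦄ {a b : A} → (a == b) ≡ true → a ≡ b
  ==-sound {a = a} {b} e with a ≟ b
  ... | yes p = p

  ==-refl : {A : Set} ⦃ _ : Finite A ⦄ (a : A) → (a == a) ≡ true
  ==-refl a with a ≟ a
  ... | yes _ = refl
  ... | no ¬p = ⊥-elim (¬p refl)

  ==-complete : {A : Set} ⦃ _ : Finite A ⦄ {a b : A} → a ≡ b → (a == b) ≡ true
  ==-complete refl = ==-refl _

∧-split : ∀ {x y} → (x ∧ y) ≡ true → x ≡ true × y ≡ true
∧-split {true} {true} _ = refl , refl

∧-join : ∀ {x y} → x ≡ true → y ≡ true → (x ∧ y) ≡ true
∧-join refl refl = refl

not-true : ∀ {x} → not x ≡ true → x ≢ true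
not-true {false} _ ()

¬true : ∀ {x} → x ≢ true → x ≡ false
¬true {true} n = ⊥-elim (n refl)
¬true {false} _ = refl

≡ᵇ-true : ∀ n → (n ≡ᵇ n) ≡ true
≡ᵇ-true zero    = refl
≡ᵇ-true (suc n) = ≡ᵇ-true n

≡ᵇ-sound : ∀ m n → (m ≡ᵇ n) ≡ true → m ≡ n
≡ᵇ-sound m n e = ℕ.≡ᵇ⇒≡ m n (subst T (sym e) tt)

≡ᵇ-false : ∀ {m n} → m ≢ n → (m ≡ᵇ n) ≡ false
≡ᵇ-false ne = ¬true λ e → ne (≡ᵇ-sound _ _ e)

-- Trees and their evaluation in algebras

-- The closure condition on domains rules out a lone right child, which leaves these three arities.
data BT (Γ : Set) : Set where
  lf : Γ → BT Γ
  un : Γ → BT Γ → BT Γ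
  bn : Γ → BT Γ → BT Γ → BT Γ

-- A deterministic bottom-up automaton with an arbitrary set of states; `junk` is its value where
-- nothing is labelled.
record Alg (S : Set) (Q : Set) : Set where
  field
    a0 : S → Q
    a1 : S → Q → Q
    a2 : S → Q → Q → Q
    junk : Q
open Alg

Labelling : Set → Set
Labelling S = List Bool → Maybe S

sub : {S : Set} → Labelling S → List Bool → Labelling S
sub ℓ w v = ℓ (w ++ v)

Bound : {S : Set} → ℕ → Labelling S → Set
Bound n ℓ = ∀ w → n ≤ length w → ℓ w ≡ nothing

module _ {S Q : Set} (𝒜 : Alg S Q) where

  combineAt : Maybe S → Maybe S → Maybe S → Q → Q → Q
  combineAt nothing  _        _        _  _  = junk 𝒜
  combineAt (just a) nothing  _        _  _  = a0 𝒜 a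
  combineAt (just a) (just _) nothing  q₀ _  = a1 𝒜 a q₀
  combineAt (just a) (just _) (just _) q₀ q₁ = a2 𝒜 a q₀ q₁

  -- Evaluation of a labelling by fuel; meaningful once the fuel exceeds its depth.
  ev : ℕ → Labelling S → Q
  ev zero    ℓ = junk 𝒜
  ev (suc n) ℓ = combineAt (ℓ []) (ℓ [ false ]) (ℓ [ true ]) (ev n (sub ℓ [ false ])) (ev n (sub ℓ [ true ]))

  ev-ext : ∀ n {ℓ ℓ′} → (∀ w → ℓ w ≡ ℓ′ w) → ev n ℓ ≡ ev n ℓ′
  ev-ext zero e = refl
  ev-ext (suc n) {ℓ} {ℓ′} e
    rewrite e [] | e [ false ] | e [ true ]
    | ev-ext n {sub ℓ [ false ]} {sub ℓ′ [ false ]} (λ w → e (false ∷ w))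
    | ev-ext n {sub ℓ [ true ]} {sub ℓ′ [ true ]} (λ w → e (true ∷ w)) = refl

  ev-suc : ∀ n {ℓ} → Bound n ℓ → ev (suc n) ℓ ≡ ev n ℓ
  ev-suc zero {ℓ} b rewrite b [] z≤n = refl
  ev-suc (suc n) {ℓ} b =
    cong₂ (combineAt (ℓ []) (ℓ [ false ]) (ℓ [ true ]))
      (ev-suc n {sub ℓ [ false ]} (λ w p → b (false ∷ w) (s≤s p)))
      (ev-suc n {sub ℓ [ true ]} (λ w p → b (true ∷ w) (s≤s p)))

  ev-stable : ∀ k n {ℓ} → Bound n ℓ → ev (k + n) ℓ ≡ ev n ℓ
  ev-stable zero n b = refl
  ev-stable (suc k) n b = trans (ev-suc (k + n) (λ w p → b w (ℕ.≤-trans (ℕ.m≤n+m n k) p))) (ev-stable k n b)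

  ev-≥ : ∀ {m n ℓ} → Bound n ℓ → n ≤ m → ev m ℓ ≡ ev n ℓ
  ev-≥ {m} {n} {ℓ} b n≤m = subst (λ k → ev k ℓ ≡ ev n ℓ) (ℕ.m∸n+n≡m n≤m) (ev-stable (m ∸ n) n b)

  module _ ⦃ F : Finite Q ⦄ (acc : Q → Bool) where

    automaton : TA S
    automaton = record
      { nQ = size ⦃ F ⦄
      ; δ0 = λ a q → enc (a0 𝒜 a) == q
      ; δ1 = λ a q₀ q → enc (a1 𝒜 a (dec q₀)) == q
      ; δ2 = λ a q₀ q₁ q → enc (a2 𝒜 a (dec q₀) (dec q₁)) == q
      ; fin = λ q → acc (dec q) }

    module _ {ℓ : Labelling S} where

      child : ∀ n w b → Bound (suc n) (sub ℓ w) → Bound n (sub ℓ (w ++ [ b ]))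
      child n w b bd v p = trans (cong ℓ (List.++-assoc w [ b ] v)) (bd (b ∷ v) (s≤s p))

      ev-child : ∀ n w b → ev n (sub ℓ (w ++ [ b ])) ≡ ev n (sub (sub ℓ w) [ b ])
      ev-child n w b = ev-ext n λ v → cong ℓ (List.++-assoc w [ b ] v)

      -- The transitions are graphs of functions, so a run is forced from the leaves upwards. Runs
      -- are unconstrained at unlabelled addresses, whence the hypothesis on `ℓ w`.
      run-unique : (ρ : List Bool → Fin (size ⦃ F ⦄)) →
        (∀ w a → ℓ w ≡ just a → Trans automaton (ℓ (w ++ [ false ])) (ℓ (w ++ [ true ])) a
                                  (ρ (w ++ [ false ])) (ρ (w ++ [ true ])) (ρ w)) →
        ∀ n w a → Bound n (sub ℓ w) → ℓ w ≡ just a → ρ w ≡ enc (ev n (sub ℓ w))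
      run-unique ρ tr zero w a b e =
        contradiction (trans (sym e) (trans (cong ℓ (sym (List.++-identityʳ w))) (b [] z≤n))) λ ()
      run-unique ρ tr (suc n) w a b e
        with ℓ (w ++ [ false ]) in e₀ | ℓ (w ++ [ true ]) in e₁ | tr w a e
      ... | nothing | _ | t rewrite trans (cong ℓ (List.++-identityʳ w)) e = sym (==-sound t)
      ... | just a₀ | nothing | t
        rewrite trans (cong ℓ (List.++-identityʳ w)) e
              | run-unique ρ tr n (w ++ [ false ]) a₀ (child n w false b) e₀
              | dec-enc (ev n (sub ℓ (w ++ [ false ]))) | ev-child n w false = sym (==-sound t)
      ... | just a₀ | just a₁ | t
        rewrite trans (cong ℓ (List.++-identityʳ w)) e
              | run-unique ρ tr n (w ++ [ false ]) a₀ (child n w false b) e₀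
              | run-unique ρ tr n (w ++ [ true ]) a₁ (child n w true b) e₁
              | dec-enc (ev n (sub ℓ (w ++ [ false ]))) | ev-child n w false
              | dec-enc (ev n (sub ℓ (w ++ [ true ]))) | ev-child n w true = sym (==-sound t)

      automaton-accepts : ∀ n → Bound n ℓ → Defined (ℓ []) →
        AcceptsLab automaton ℓ ⇔ (acc (ev n ℓ) ≡ true)
      automaton-accepts n b (a , e) = mk⇔ to from
        where
        to : AcceptsLab automaton ℓ → acc (ev n ℓ) ≡ true
        to (ρ , tr , f) rewrite run-unique ρ tr n [] a b e | dec-enc (ev n ℓ) = f
        from : acc (ev n ℓ) ≡ true → AcceptsLab automaton ℓ
        from f = ρ , tr , trans (cong acc (dec-enc _)) f
          where
          ρ : List Bool → Fin (size ⦃ F ⦄)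
          ρ w = enc (ev n (sub ℓ w))
          bw : ∀ w → Bound n (sub ℓ w)
          bw w v p = b (w ++ v) (ℕ.≤-trans p (ℕ.≤-trans (ℕ.m≤n+m _ _) (ℕ.≤-reflexive (sym (List.length-++ w)))))
          -- The run evaluates all subtrees with the same fuel `n`, although each level consumes one
          -- unit; `ev-suc` makes up for the difference.
          unfold : ∀ w → ev n (sub ℓ w) ≡ combineAt (ℓ w) (ℓ (w ++ [ false ])) (ℓ (w ++ [ true ]))
                           (ev n (sub ℓ (w ++ [ false ]))) (ev n (sub ℓ (w ++ [ true ])))
          unfold w rewrite ev-child n w false | ev-child n w true =
            trans (sym (ev-suc n (bw w)))
              (cong (λ v → combineAt (ℓ v) (ℓ (w ++ [ false ])) (ℓ (w ++ [ true ]))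
                 (ev n (sub (sub ℓ w) [ false ])) (ev n (sub (sub ℓ w) [ true ]))) (List.++-identityʳ w))
          tr : ∀ w a → ℓ w ≡ just a → Trans automaton (ℓ (w ++ [ false ])) (ℓ (w ++ [ true ])) a
                 (ρ (w ++ [ false ])) (ρ (w ++ [ true ])) (ρ w)
          tr w a e with unfold w
          ... | u rewrite e with ℓ (w ++ [ false ]) | ℓ (w ++ [ true ])
          ... | nothing | _ = ==-complete (cong enc (sym u))
          ... | just _ | nothing rewrite dec-enc (ev n (sub ℓ (w ++ [ false ]))) = ==-complete (cong enc (sym u))
          ... | just _ | just _ rewrite dec-enc (ev n (sub ℓ (w ++ [ false ]))) | dec-enc (ev n (sub ℓ (w ++ [ true ]))) =
            ==-complete (cong enc (sym u))

-- Relations on trees recognised by deterministic automata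

record PairAut (Λ : Set) : Set₁ where
  field
    Q : Set
    finQ : Finite Q
    p0 : Λ → Λ → Q
    p1 : Λ → Λ → Q → Q
    p2 : Λ → Λ → Q → Q → Q
    accept : Q → Bool

module _ {Λ : Set} (P : PairAut Λ) where
  open PairAut P

  -- The last clauses discard trees of different shapes, so padding symbols do not reach the
  -- transition functions.
  evalP : BT Λ → BT Λ → Maybe Q
  evalP (lf x)     (lf y)     = just (p0 x y)
  evalP (un x s)   (un y t)   = mapᵐ (p1 x y) (evalP s t)
  evalP (bn x s s′) (bn y t t′) with evalP s t | evalP s′ t′
  ... | just q | just q′ = just (p2 x y q q′)
  ... | _      | _       = nothing
  evalP _ _ = nothing

  acceptᵐ : Maybe Q → Bool
  acceptᵐ (just q) = accept q
  acceptᵐ nothing  = false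

  record Related (s t : BT Λ) : Set where
    constructor related
    field isRelated : acceptᵐ (evalP s t) ≡ true

module _ {Λ : Set} ⦃ FΛ : Finite Λ ⦄ (default : Λ) where

  termAlg : Alg (Fin (size ⦃ FΛ ⦄)) (BT Λ)
  termAlg = record { a0 = lf ∘ dec ; a1 = un ∘ dec ; a2 = bn ∘ dec ; junk = lf default }

  toBT : Tree (Fin (size ⦃ FΛ ⦄)) → BT Λ
  toBT t = ev termAlg (proj₁ (finite t)) (lab t)

  private
    Γ = Fin (size ⦃ FΛ ⦄)

  ClosedLab : Labelling Γ → Set
  ClosedLab ℓ = ∀ w b → Defined (ℓ (w ++ [ b ])) → Defined (ℓ w) × Defined (ℓ (w ++ [ false ]))

  root-defined : (t : Tree Γ) → Defined (lab t [])
  root-defined t = go (proj₁ (nonempty t)) (List.initLast (proj₁ (nonempty t))) _ ℕ.≤-refl (proj₂ (nonempty t))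
    where
    go : ∀ w → List.InitLast w → ∀ n → length w ≤ n → Defined (lab t w) → Defined (lab t [])
    go .[] List.[] n _ d = d
    go .(w ++ [ b ]) (w List.∷ʳ′ b) zero p d =
      contradiction (subst (_≤ 0) (trans (List.length-++ w) (ℕ.+-comm (length w) 1)) p) λ ()
    go .(w ++ [ b ]) (w List.∷ʳ′ b) (suc n) p d =
      go w (List.initLast w) n (ℕ.≤-pred (subst (_≤ suc n) (trans (List.length-++ w) (ℕ.+-comm (length w) 1)) p))
        (proj₁ (closed t w b d))

  fromBT : BT Λ → Labelling Γ
  fromBT (lf x)     []          = just (enc x)
  fromBT (un x s)   []          = just (enc x)
  fromBT (bn x s t) []          = just (enc x)
  fromBT (lf x)     (_ ∷ _)     = nothing
  fromBT (un x s)   (false ∷ w) = fromBT s w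
  fromBT (un x s)   (true ∷ w)  = nothing
  fromBT (bn x s t) (false ∷ w) = fromBT s w
  fromBT (bn x s t) (true ∷ w)  = fromBT t w

  fromBT-root : ∀ s → Defined (fromBT s [])
  fromBT-root (lf x)     = _ , refl
  fromBT-root (un x _)   = _ , refl
  fromBT-root (bn x _ _) = _ , refl

  depth : BT Λ → ℕ
  depth (lf x)     = 1
  depth (un x s)   = suc (depth s)
  depth (bn x s t) = suc (depth s ⊔ depth t)

  fromBT-bound : ∀ s → Bound (depth s) (fromBT s)
  fromBT-bound (lf x)     (_ ∷ _)     _       = refl
  fromBT-bound (un x s)   (false ∷ w) (s≤s p) = fromBT-bound s w p
  fromBT-bound (un x s)   (true ∷ w)  _       = refl
  fromBT-bound (bn x s t) (false ∷ w) (s≤s p) = fromBT-bound s w (ℕ.≤-trans (ℕ.m≤m⊔n _ _) p)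
  fromBT-bound (bn x s t) (true ∷ w)  (s≤s p) = fromBT-bound t w (ℕ.≤-trans (ℕ.m≤n⊔m _ _) p)

  fromBT-closed : ∀ s → ClosedLab (fromBT s)
  fromBT-closed (lf x)     []          b     (_ , ())
  fromBT-closed (lf x)     (_ ∷ _)     b     (_ , ())
  fromBT-closed (un x s)   []          b     _ = (_ , refl) , fromBT-root s
  fromBT-closed (un x s)   (false ∷ w) b     d = fromBT-closed s w b d
  fromBT-closed (un x s)   (true ∷ w)  b     (_ , ())
  fromBT-closed (bn x s t) []          b     _ = (_ , refl) , fromBT-root s
  fromBT-closed (bn x s t) (false ∷ w) b     d = fromBT-closed s w b d
  fromBT-closed (bn x s t) (true ∷ w)  b     d = fromBT-closed t w b d

  toTree : BT Λ → Tree Γ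
  toTree s = record
    { lab = fromBT s ; finite = depth s , fromBT-bound s
    ; nonempty = [] , fromBT-root s ; closed = fromBT-closed s }

  ev-fromBT : ∀ s n → depth s ≤ n → ev termAlg n (fromBT s) ≡ s
  ev-fromBT (lf x)     (suc n) (s≤s p) = cong lf (dec-enc x)
  ev-fromBT (un x s)   (suc n) (s≤s p) rewrite proj₂ (fromBT-root s) =
    cong₂ un (dec-enc x) (ev-fromBT s n p)
  ev-fromBT (bn x s t) (suc n) (s≤s p) rewrite proj₂ (fromBT-root s) | proj₂ (fromBT-root t)
    | ev-fromBT s n (ℕ.≤-trans (ℕ.m≤m⊔n _ _) p) | ev-fromBT t n (ℕ.≤-trans (ℕ.m≤n⊔m _ _) p) | dec-enc x = refl

  toBT-toTree : ∀ s → toBT (toTree s) ≡ s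
  toBT-toTree s = ev-fromBT s (depth s) ℕ.≤-refl

  module _ (P : PairAut Λ) where
    open PairAut P

    pairAlg : Alg (Vec (Maybe Γ) 2) (Maybe Q)
    pairAlg = record { a0 = c0 ; a1 = c1 ; a2 = c2 ; junk = nothing }
      where
      c0 : Vec (Maybe Γ) 2 → Maybe Q
      c0 (just x ∷ᵛ just y ∷ᵛ []ᵛ) = just (p0 (dec x) (dec y))
      c0 _ = nothing
      c1 : Vec (Maybe Γ) 2 → Maybe Q → Maybe Q
      c1 (just x ∷ᵛ just y ∷ᵛ []ᵛ) q = mapᵐ (p1 (dec x) (dec y)) q
      c1 _ _ = nothing
      c2 : Vec (Maybe Γ) 2 → Maybe Q → Maybe Q → Maybe Q
      c2 (just x ∷ᵛ just y ∷ᵛ []ᵛ) (just q) (just q′) = just (p2 (dec x) (dec y) q q′)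
      c2 _ _ _ = nothing

    pairTA : TA (Vec (Maybe Γ) 2)
    pairTA = automaton pairAlg ⦃ finite-Maybe ⦃ finQ ⦄ ⦄ (acceptᵐ P)

    conv : Labelling Γ → Labelling Γ → Labelling (Vec (Maybe Γ) 2)
    conv ℓ ℓ′ w = if allNothing (ℓ w ∷ᵛ ℓ′ w ∷ᵛ []ᵛ) then nothing else just (ℓ w ∷ᵛ ℓ′ w ∷ᵛ []ᵛ)

    -- A component without a root leaves an empty convolution or a padded root letter, and both
    -- evaluate to `nothing`. This detects the place where two shapes diverge.
    junkˡ : ∀ n {ℓ ℓ′} → ℓ [] ≡ nothing → ev pairAlg n (conv ℓ ℓ′) ≡ nothing
    junkˡ zero e = refl
    junkˡ (suc n) {ℓ} {ℓ′} e rewrite e with ℓ′ []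
    ... | nothing = refl
    ... | just y with conv ℓ ℓ′ [ false ] | conv ℓ ℓ′ [ true ]
    ... | nothing | _       = refl
    ... | just _  | nothing = refl
    ... | just _  | just _  = refl

    junkʳ : ∀ n {ℓ ℓ′} → ℓ′ [] ≡ nothing → ev pairAlg n (conv ℓ ℓ′) ≡ nothing
    junkʳ zero e = refl
    junkʳ (suc n) {ℓ} {ℓ′} e rewrite e with ℓ []
    ... | nothing = refl
    ... | just y with conv ℓ ℓ′ [ false ] | conv ℓ ℓ′ [ true ]
    ... | nothing | _       = refl
    ... | just _  | nothing = refl
    ... | just _  | just _  = refl

    data Shape (ℓ : Labelling Γ) : Set where
      shape0 : ∀ {a} → ℓ [] ≡ just a → ℓ [ false ] ≡ nothing → ℓ [ true ] ≡ nothing → Shape ℓ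
      shape1 : ∀ {a b} → ℓ [] ≡ just a → ℓ [ false ] ≡ just b → ℓ [ true ] ≡ nothing → Shape ℓ
      shape2 : ∀ {a b c} → ℓ [] ≡ just a → ℓ [ false ] ≡ just b → ℓ [ true ] ≡ just c → Shape ℓ

    shape : ∀ {ℓ} → ClosedLab ℓ → Defined (ℓ []) → Shape ℓ
    shape {ℓ} cl (a , e) with ℓ [ false ] in e₀ | ℓ [ true ] in e₁
    ... | nothing | nothing = shape0 e e₀ e₁
    ... | nothing | just c  =
      contradiction (trans (sym e₀) (proj₂ (proj₂ (cl [] true (c , e₁))))) λ ()
    ... | just b  | nothing = shape1 e e₀ e₁
    ... | just b  | just c  = shape2 e e₀ e₁

    sub-closed : ∀ {ℓ} b → ClosedLab ℓ → ClosedLab (sub ℓ [ b ])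
    sub-closed b cl w = cl (b ∷ w)

    -- By the arities of both roots. Where they differ, some child of the convolution has a padded
    -- root, and its `nothing` propagates upwards as in `evalP`.
    ev-conv : ∀ n {ℓ ℓ′} → ClosedLab ℓ → ClosedLab ℓ′ → Defined (ℓ []) → Defined (ℓ′ []) →
      Bound n ℓ → ev pairAlg n (conv ℓ ℓ′) ≡ evalP P (ev termAlg n ℓ) (ev termAlg n ℓ′)
    ev-conv zero cl cl′ (a , e) d′ b = contradiction (trans (sym e) (b [] z≤n)) λ ()
    ev-conv (suc n) {ℓ} {ℓ′} cl cl′ d d′ b with shape cl d | shape cl′ d′
    ... | shape0 e e₀ e₁ | shape0 f f₀ f₁ rewrite e | e₀ | e₁ | f | f₀ = refl
    ... | shape0 e e₀ e₁ | shape1 f f₀ f₁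
      rewrite junkˡ n {sub ℓ [ false ]} {sub ℓ′ [ false ]} e₀ | e | e₀ | e₁ | f | f₀ | f₁ = refl
    ... | shape0 e e₀ e₁ | shape2 f f₀ f₁
      rewrite junkˡ n {sub ℓ [ false ]} {sub ℓ′ [ false ]} e₀ | e | e₀ | e₁ | f | f₀ | f₁ = refl
    ... | shape1 e e₀ e₁ | shape0 f f₀ f₁
      rewrite junkʳ n {sub ℓ [ false ]} {sub ℓ′ [ false ]} f₀ | e | e₀ | e₁ | f | f₀ | f₁ = refl
    ... | shape2 e e₀ e₁ | shape0 f f₀ f₁
      rewrite junkʳ n {sub ℓ [ false ]} {sub ℓ′ [ false ]} f₀ | e | e₀ | e₁ | f | f₀ = refl
    ... | shape1 e e₀ e₁ | shape1 f f₀ f₁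
      rewrite ev-conv n {sub ℓ [ false ]} {sub ℓ′ [ false ]} (sub-closed false cl) (sub-closed false cl′) (_ , e₀) (_ , f₀)
                (λ w p → b (false ∷ w) (s≤s p))
            | e | e₀ | e₁ | f | f₀ | f₁ = refl
    ... | shape1 e e₀ e₁ | shape2 f f₀ f₁
      rewrite junkˡ n {sub ℓ [ true ]} {sub ℓ′ [ true ]} e₁ | e | e₀ | e₁ | f | f₀ | f₁
      with ev pairAlg n (sub (conv ℓ ℓ′) [ false ])
    ... | nothing = refl
    ... | just _  = refl
    ev-conv (suc n) {ℓ} {ℓ′} cl cl′ d d′ b | shape2 e e₀ e₁ | shape1 f f₀ f₁
      rewrite junkʳ n {sub ℓ [ true ]} {sub ℓ′ [ true ]} f₁ | e | e₀ | e₁ | f | f₀ | f₁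
      with ev pairAlg n (sub (conv ℓ ℓ′) [ false ])
    ... | nothing = refl
    ... | just _  = refl
    ev-conv (suc n) {ℓ} {ℓ′} cl cl′ d d′ b | shape2 e e₀ e₁ | shape2 f f₀ f₁
      rewrite ev-conv n {sub ℓ [ false ]} {sub ℓ′ [ false ]} (sub-closed false cl) (sub-closed false cl′) (_ , e₀) (_ , f₀)
                (λ w p → b (false ∷ w) (s≤s p))
            | ev-conv n {sub ℓ [ true ]} {sub ℓ′ [ true ]} (sub-closed true cl) (sub-closed true cl′) (_ , e₁) (_ , f₁)
                (λ w p → b (true ∷ w) (s≤s p))
            | e | e₀ | e₁ | f | f₀ | f₁
      with evalP P (ev termAlg n (sub ℓ [ false ])) (ev termAlg n (sub ℓ′ [ false ]))
         | evalP P (ev termAlg n (sub ℓ [ true ])) (ev termAlg n (sub ℓ′ [ true ]))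
    ... | just _  | just _  = refl
    ... | just _  | nothing = refl
    ... | nothing | just _  = refl
    ... | nothing | nothing = refl

    pairTA-accepts : ∀ s t → AcceptsLab pairTA (convLab (s ∷ᵛ t ∷ᵛ []ᵛ)) ⇔ Related P (toBT s) (toBT t)
    pairTA-accepts s t = mk⇔
      (λ p → related (subst (λ q → acceptᵐ P q ≡ true) value (A.to p)))
      (λ { (related p) → A.from (subst (λ q → acceptᵐ P q ≡ true) (sym value) p) })
      where
      n = proj₁ (finite s) ⊔ proj₁ (finite t)
      boundˡ : Bound n (lab s)
      boundˡ w p = proj₂ (finite s) w (ℕ.≤-trans (ℕ.m≤m⊔n _ _) p)
      boundʳ : Bound n (lab t)
      boundʳ w p = proj₂ (finite t) w (ℕ.≤-trans (ℕ.m≤n⊔m (proj₁ (finite s)) _) p)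
      bound : Bound n (conv (lab s) (lab t))
      bound w p rewrite boundˡ w p | boundʳ w p = refl
      rootd : Defined (conv (lab s) (lab t) [])
      rootd rewrite proj₂ (root-defined s) = _ , refl
      value : ev pairAlg n (conv (lab s) (lab t)) ≡ evalP P (toBT s) (toBT t)
      value = trans (ev-conv n (closed s) (closed t) (root-defined s) (root-defined t) boundˡ)
        (cong₂ (evalP P) (ev-≥ termAlg (proj₂ (finite s)) (ℕ.m≤m⊔n _ _))
                         (ev-≥ termAlg (proj₂ (finite t)) (ℕ.m≤n⊔m (proj₁ (finite s)) _)))
      module A = Equivalence (automaton-accepts pairAlg ⦃ finite-Maybe ⦃ finQ ⦄ ⦄ (acceptᵐ P) n bound rootd)

_≟ᵀ_ : {Λ : Set} ⦃ _ : Finite Λ ⦄ → DecidableEquality (BT Λ)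
lf x     ≟ᵀ lf y     = map′ (cong lf) (λ { refl → refl }) (x ≟ y)
un x s   ≟ᵀ un y t   with x ≟ y | s ≟ᵀ t
... | yes refl | yes refl = yes refl
... | no n     | _        = no λ { refl → n refl }
... | yes _    | no n     = no λ { refl → n refl }
bn x s s′ ≟ᵀ bn y t t′ with x ≟ y | s ≟ᵀ t | s′ ≟ᵀ t′
... | yes refl | yes refl | yes refl = yes refl
... | no n     | _        | _        = no λ { refl → n refl }
... | yes _    | no n     | _        = no λ { refl → n refl }
... | yes _    | yes _    | no n     = no λ { refl → n refl }
lf _     ≟ᵀ un _ _   = no λ ()
lf _     ≟ᵀ bn _ _ _ = no λ ()
un _ _   ≟ᵀ lf _     = no λ ()
un _ _   ≟ᵀ bn _ _ _ = no λ ()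
bn _ _ _ ≟ᵀ lf _     = no λ ()
bn _ _ _ ≟ᵀ un _ _   = no λ ()

-- Predicates as automatic relations

module _ {Λ Q : Set} (𝒜 : Alg Λ Q) where
  fold : BT Λ → Q
  fold (lf x)     = Alg.a0 𝒜 x
  fold (un x s)   = Alg.a1 𝒜 x (fold s)
  fold (bn x s t) = Alg.a2 𝒜 x (fold s) (fold t)

module _ {Λ Q : Set} ⦃ FΛ : Finite Λ ⦄ ⦃ FQ : Finite Q ⦄ (𝒜 : Alg Λ Q) (acc : Q → Bool) where

  -- A predicate becomes a part of the identity relation, so that all symbols are binary and denote
  -- partial injections. The inner `Maybe` records differing labels, the outer one of `evalP`
  -- differing shapes.
  diagonal : PairAut Λ
  diagonal = record
    { Q = Maybe Q
    ; finQ = finite-Maybe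
    ; p0 = λ x y → if x == y then just (Alg.a0 𝒜 x) else nothing
    ; p1 = λ x y q → if x == y then mapᵐ (Alg.a1 𝒜 x) q else nothing
    ; p2 = λ { x y (just q) (just q′) → if x == y then just (Alg.a2 𝒜 x q q′) else nothing
             ; x y _ _ → nothing }
    ; accept = λ { (just q) → acc q ; nothing → false } }

  diagonal-sound : ∀ s t {q} → evalP diagonal s t ≡ just (just q) → s ≡ t × fold 𝒜 s ≡ q
  diagonal-sound (lf x) (lf y) e with x == y in c
  diagonal-sound (lf x) (lf y) refl | true = cong lf (==-sound c) , refl
  diagonal-sound (un x s) (un y t) e with evalP diagonal s t in es
  ... | just q with x == y in c
  diagonal-sound (un x s) (un y t) e | just (just q) | true with ==-sound c | diagonal-sound s t es
  diagonal-sound (un x s) (un y t) refl | just (just q) | true | refl | refl , refl = refl , refl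
  diagonal-sound (bn x s s′) (bn y t t′) e with evalP diagonal s t in es | evalP diagonal s′ t′ in es′
  ... | just (just q) | just (just q′) with x == y in c
  ... | true with ==-sound c | diagonal-sound s t es | diagonal-sound s′ t′ es′
  diagonal-sound (bn x s s′) (bn y t t′) refl | just (just q) | just (just q′) | true | refl | refl , refl | refl , refl =
    refl , refl
  diagonal-sound (bn x s s′) (bn y t t′) () | just (just q) | just nothing
  diagonal-sound (bn x s s′) (bn y t t′) () | just nothing | just q′

  diagonal-eval : ∀ s → evalP diagonal s s ≡ just (just (fold 𝒜 s))
  diagonal-eval (lf x) rewrite ==-refl x = refl
  diagonal-eval (un x s) rewrite diagonal-eval s | ==-refl x = refl
  diagonal-eval (bn x s t) rewrite diagonal-eval s | diagonal-eval t | ==-refl x = refl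

  diagonal-related : ∀ s t → Related diagonal s t ⇔ (s ≡ t × acc (fold 𝒜 s) ≡ true)
  diagonal-related s t = mk⇔ to from
    where
    to : Related diagonal s t → s ≡ t × acc (fold 𝒜 s) ≡ true
    to (related r) with evalP diagonal s t in e
    ... | just (just q) with diagonal-sound s t e
    ... | refl , refl = refl , r
    from : s ≡ t × acc (fold 𝒜 s) ≡ true → Related diagonal s t
    from (refl , a) = related (trans (cong (acceptᵐ diagonal) (diagonal-eval s)) a)

-- The structure of all trees under given relations

module _ {Λ : Set} ⦃ FΛ : Finite Λ ⦄ (default : Λ) {r : ℕ} (𝓡 : Fin r → PairAut Λ) where

  binary : Fin r → ℕ
  binary _ = 2

  treeStructure : Structure r binary
  treeStructure = record
    { Carrier = BT Λ ; rel = λ { i (s ∷ᵛ t ∷ᵛ []ᵛ) → Related (𝓡 i) s t } }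

  trivialAlg : {S : Set} → Alg S ⊤
  trivialAlg = record { a0 = λ _ → tt ; a1 = λ _ _ → tt ; a2 = λ _ _ _ → tt ; junk = tt }

  equality : PairAut Λ
  equality = diagonal trivialAlg (λ _ → true)

  presentation : Presentation r binary
  presentation = record
    { g = size ⦃ FΛ ⦄ ; autL = automaton trivialAlg (λ _ → true)
    ; autR = λ i → pairTA default (𝓡 i) ; autEq = pairTA default equality }

  private
    h : Elem presentation → BT Λ
    h (t , _) = toBT default t

  h-surjective : ∀ s → ∃ λ e → h e ≡ s
  h-surjective s = (toTree default s , Equivalence.from
    (automaton-accepts trivialAlg (λ _ → true) (depth default s) (fromBT-bound default s) (fromBT-root default s)) refl)
    , toBT-toTree default s

  -- Different codes of one label, or different proof components, can make `h` non-injective. The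
  -- automaton `equality` works on decoded labels, and so recognises exactly the kernel.
  h-kernel : ∀ a b → (h a ≡ h b) ⇔ EqP presentation a b
  h-kernel (a , _) (b , _) = mk⇔
    (λ e → P.from (D.from (e , refl))) (λ p → proj₁ (D.to (P.to p)))
    where
    module P = Equivalence (pairTA-accepts default equality a b)
    module D = Equivalence (diagonal-related trivialAlg (λ _ → true) (toBT default a) (toBT default b))

  h-relations : ∀ i es → rel treeStructure i (mapᵛ h es) ⇔ RelP presentation i es
  h-relations i ((a , _) ∷ᵛ (b , _) ∷ᵛ []ᵛ) = mk⇔ P.from P.to
    where module P = Equivalence (pairTA-accepts default (𝓡 i) a b)

  map-cong-EqP : ∀ {n} {es es′ : Vec (Elem presentation) n} →
    Pointwise (EqP presentation) es es′ → mapᵛ h es ≡ mapᵛ h es′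
  map-cong-EqP []ᵖ = refl
  map-cong-EqP {es = e ∷ᵛ _} {e′ ∷ᵛ _} (p ∷ᵖ ps) = cong₂ _∷ᵛ_ (Equivalence.from (h-kernel e e′) p) (map-cong-EqP ps)

  treeAutomatic : TreeAutomatic treeStructure
  treeAutomatic = presentation
    , ( (λ a → to (h-kernel a a) refl)
      , (λ a b p → to (h-kernel b a) (sym (from (h-kernel a b) p)))
      , (λ a b c p q → to (h-kernel a c) (trans (from (h-kernel a b) p) (from (h-kernel b c) q)))
      , (λ i es es′ ps p → to (h-relations i es′)
          (subst (rel treeStructure i) (map-cong-EqP ps) (from (h-relations i es) p))))
    , h , (λ s → proj₁ (h-surjective s) , λ { refl → proj₂ (h-surjective s) }) , h-kernel , h-relations
    where open Equivalence

  Functional : (BT Λ → BT Λ → Set) → Set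
  Functional R = ∀ s t t′ → R s t → R s t′ → t ≡ t′

  module _ (forward : ∀ i → Functional (Related (𝓡 i)))
           (backward : ∀ i → Functional (λ s t → Related (𝓡 i) t s)) where

    link : ∀ {a b} → Adjacent treeStructure a b → Fin r × Bool
    link (_ , i , (x ∷ᵛ y ∷ᵛ []ᵛ) , _ , here _ , _) = i , false
    link (_ , i , (x ∷ᵛ y ∷ᵛ []ᵛ) , _ , there _ , _) = i , true

    Linked : BT Λ → Fin r × Bool → BT Λ → Set
    Linked a (i , false) b = Related (𝓡 i) a b
    Linked a (i , true)  b = Related (𝓡 i) b a

    link-linked : ∀ {a b} (adj : Adjacent treeStructure a b) → Linked a (link adj) b
    link-linked (n , i , (x ∷ᵛ y ∷ᵛ []ᵛ) , p , here refl , here refl) = ⊥-elim (n refl)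
    link-linked (n , i , (x ∷ᵛ y ∷ᵛ []ᵛ) , p , here refl , there (here refl)) = p
    link-linked (n , i , (x ∷ᵛ y ∷ᵛ []ᵛ) , p , there (here refl) , here refl) = p
    link-linked (n , i , (x ∷ᵛ y ∷ᵛ []ᵛ) , p , there (here refl) , there (here refl)) = ⊥-elim (n refl)

    linked-unique : ∀ {a b b′} l → Linked a l b → Linked a l b′ → b ≡ b′
    linked-unique {a} {b} {b′} (i , false) p q = forward i a b b′ p q
    linked-unique {a} {b} {b′} (i , true)  p q = backward i a b b′ p q

    unique-lookup : ∀ {bs : List (BT Λ)} → Unique bs → ∀ i j → i Data.Fin.< j → List.lookup bs i ≢ List.lookup bs j
    unique-lookup (px AllPairs.∷ _)  fz     (fs j) _       e = uncurry (λ n x≡ → n x≡) (All.lookupAny px (anyAt j e))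
      where
      anyAt : ∀ {x} {xs : List (BT Λ)} j → x ≡ List.lookup xs j → Any (x ≡_) xs
      anyAt {xs = _ ∷ _} fz     refl = hereˡ refl
      anyAt {xs = _ ∷ _} (fs j) e    = thereˡ (anyAt j e)
    unique-lookup (_ AllPairs.∷ u) (fs i) (fs j) (s≤s p) e = unique-lookup u i j p e

    -- A neighbour is determined by the symbol that links it and the direction of the link, so more
    -- than `r * 2` distinct neighbours would put two of them into one pigeonhole.
    boundedDegree : BoundedDegree treeStructure
    boundedDegree = r * 2 , bound
      where
      bound : ∀ a bs → Unique bs → All (Adjacent treeStructure a) bs → length bs ≤ r * 2
      bound a bs u adj = ℕ.≮⇒≥ λ lt →
        let adjAt = λ i → All.lookup adj (∈-lookup {xs = bs} i)
            (i , j , i<j , e) = Fin.pigeonhole lt (λ i → enc (link (adjAt i)))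
            l = enc-injective {a = link (adjAt i)} e
        in unique-lookup u i j i<j (linked-unique (link (adjAt i)) (link-linked (adjAt i))
             (subst (λ l → Linked a l (List.lookup bs j)) (sym l) (link-linked (adjAt j))))

-- Proof trees: labels, marks and their parallel movement

-- `now` and `before` give the current bit of the numbers a, t and of a ∸ 1, t ∸ 1 (used at the
-- leaves); on the leftmost branch, `flag` at depth j asserts tile number j, and `letter` at
-- depth j is the letter of the initial row at position a + 1 + j.
record Dat : Set where
  constructor mkDat
  field
    a-now a-before t-now t-before flag : Bool
    letter : Maybe Bool
open Dat

-- Only data nodes carry the two marks.  A claim about position (a , t) is a node k0 (a = 0), k1
-- (t = 0) or k2; besides its data tree it has the claim for (a ∸ 1 , t) as a child, and in the
-- case of k2, behind a fork fk, also the claim for (a , t ∸ 1).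
data Lab : Set where
  dat : Dat → Bool → Bool → Lab
  k0 k1 k2 fk rt : Lab

opaque
  Dat-finite : Finite Dat
  Dat-finite = retract {B = Bool × Bool × Bool × Bool × Bool × Maybe Bool}
    (λ x → a-now x , a-before x , t-now x , t-before x , flag x , letter x)
    (λ (a , b , c , d , e , l) → mkDat a b c d e l) (λ _ → refl) finite-×

  Lab-finite : Finite Lab
  Lab-finite = retract {B = (Dat × Bool × Bool) ⊎ Fin 5}
    (λ { (dat x m n) → inj₁ (x , m , n) ; k0 → inj₂ fz ; k1 → inj₂ (fs fz) ; k2 → inj₂ (fs (fs fz))
       ; fk → inj₂ (fs (fs (fs fz))) ; rt → inj₂ (fs (fs (fs (fs fz)))) })
    (λ { (inj₁ (x , m , n)) → dat x m n ; (inj₂ fz) → k0 ; (inj₂ (fs fz)) → k1 ; (inj₂ (fs (fs fz))) → k2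
       ; (inj₂ (fs (fs (fs fz)))) → fk ; (inj₂ (fs (fs (fs (fs fz))))) → rt })
    (λ { (dat x m n) → refl ; k0 → refl ; k1 → refl ; k2 → refl ; fk → refl ; rt → refl }) (finite-⊎ ⦃ finite-× ⦃ Dat-finite ⦄ ⦄)

instance
  finite-Dat : Finite Dat
  finite-Dat = Dat-finite

  finite-Lab : Finite Lab
  finite-Lab = Lab-finite

mark : Bool → Lab → Bool
mark false (dat _ m _) = m
mark true  (dat _ _ n) = n
mark _     _           = false

setMark : Bool → Bool → Lab → Lab
setMark false m (dat x _ n) = dat x m n
setMark true  n (dat x m _) = dat x m n
setMark false _ l           = l
setMark true  _ l           = l

setMark-mark : ∀ τ m x → setMark τ (mark τ x) (setMark τ m x) ≡ x
setMark-mark false m (dat _ _ _) = refl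
setMark-mark true  m (dat _ _ _) = refl
setMark-mark false m k0 = refl
setMark-mark false m k1 = refl
setMark-mark false m k2 = refl
setMark-mark false m fk = refl
setMark-mark false m rt = refl
setMark-mark true  m k0 = refl
setMark-mark true  m k1 = refl
setMark-mark true  m k2 = refl
setMark-mark true  m fk = refl
setMark-mark true  m rt = refl

module Movement (τ b : Bool) where

  -- The state is the mark of the second tree at the current node; it has to be the mark of the
  -- first tree at the parent, if the current node is its b-child.
  place : Lab → Lab → Bool → Maybe Bool
  place x y m = if (x == setMark τ m y) ∧ (mark τ x == m) then just (mark τ y) else nothing

  move : PairAut Lab
  move = record
    { Q = Maybe Bool ; finQ = finite-Maybe
    -- A leaf has no child to hand its mark to, so it must be unmarked in the first tree.
    ; p0 = λ x y → place x y false
    ; p1 = q1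
    ; p2 = q2
    -- No parent hands a mark to the root, so the second tree has none there.
    ; accept = λ { (just m) → not m ; nothing → false } }
    where
    q1 : Lab → Lab → Maybe Bool → Maybe Bool
    q1 x y (just m) = if b ∧ m then nothing else place x y m
    q1 x y nothing  = nothing
    q2 : Lab → Lab → Maybe Bool → Maybe Bool → Maybe Bool
    q2 x y (just m) (just n) =
      if (if b then m else n) then nothing else place x y (if b then n else m)
    q2 x y _ _ = nothing

  place-sound : ∀ x y m {n} → place x y m ≡ just n → x ≡ setMark τ m y × mark τ x ≡ m × mark τ y ≡ n
  place-sound x y m e with (x == setMark τ m y) ∧ (mark τ x == m) in c
  place-sound x y m refl | true with ∧-split {x == setMark τ m y} c
  ... | p , q = ==-sound p , ==-sound q , refl

  place-complete : ∀ x y m → x ≡ setMark τ m y → mark τ x ≡ m → place x y m ≡ just (mark τ y)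
  place-complete x y m p q rewrite ∧-join (==-complete p) (==-complete q) = refl

  -- The only possible second tree of a move; the Boolean is the mark received from the parent.
  advance : Bool → BT Lab → BT Lab
  advance m (lf x)     = lf (setMark τ m x)
  advance m (un x s)   = un (setMark τ m x) (advance (not b ∧ mark τ x) s)
  advance m (bn x s t) = bn (setMark τ m x) (advance (not b ∧ mark τ x) s) (advance (b ∧ mark τ x) t)

  topMark : BT Lab → Bool
  topMark (lf x)     = mark τ x
  topMark (un x _)   = mark τ x
  topMark (bn x _ _) = mark τ x

  -- The only possible first tree: the former mark of a node is found at its `b`-child. Hence moves
  -- are injective, which the bound on the degree rests on.
  retreat : BT Lab → BT Lab
  retreat (lf x)     = lf (setMark τ false x)
  retreat (un x s)   = un (setMark τ (not b ∧ topMark s) x) (retreat s)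
  retreat (bn x s t) = bn (setMark τ (if b then topMark t else topMark s) x) (retreat s) (retreat t)

  private
    undo : ∀ {m n} x y → x ≡ setMark τ m y → mark τ y ≡ n → y ≡ setMark τ n x
    undo {m} x y refl refl = sym (setMark-mark τ m y)

    if-nothing : ∀ {c} {q : Maybe Bool} {n} → (if c then nothing else q) ≡ just n → c ≡ false × q ≡ just n
    if-nothing {false} e = refl , e

    cong₃ : ∀ {x y : Lab} {s t s′ t′ : BT Lab} → x ≡ y → s ≡ t → s′ ≡ t′ → bn x s s′ ≡ bn y t t′
    cong₃ refl refl refl = refl

  move-advance : ∀ s t {m} → evalP move s t ≡ just (just m) → t ≡ advance m s
  move-advance (lf x) (lf y) e with place-sound x y false (just-injective e)
  ... | p , _ , r = cong lf (undo x y p r)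
  move-advance (un x s) (un y t) e with evalP move s t in es
  ... | just (just m) with if-nothing {b ∧ m} (just-injective e)
  ... | c , e′ with place-sound x y m e′
  ... | p , q , r = cong₂ un (undo x y p r) (trans (move-advance s t es) (cong (λ n → advance n s) (lemma b m c q)))
    where
    lemma : ∀ b m {n} → b ∧ m ≡ false → n ≡ m → m ≡ not b ∧ n
    lemma false m _ refl = refl
    lemma true  m p refl = p
  move-advance (bn x s s′) (bn y t t′) e with evalP move s t in es | evalP move s′ t′ in es′
  move-advance (bn x s s′) (bn y t t′) () | just (just m) | just nothing
  move-advance (bn x s s′) (bn y t t′) () | just nothing  | just m′
  ... | just (just m) | just (just m′) with if-nothing {if b then m else m′} (just-injective e)
  ... | c , e′ with place-sound x y _ e′
  ... | p , q , r = cong₃ (undo x y p r)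
          (trans (move-advance s t es) (cong (λ n → advance n s) (lemma b m m′ c q)))
          (trans (move-advance s′ t′ es′) (cong (λ n → advance n s′) (lemma′ b m m′ c q)))
    where
    lemma : ∀ b m m′ {n} → (if b then m else m′) ≡ false → n ≡ (if b then m′ else m) → m ≡ not b ∧ n
    lemma false m m′ _ refl = refl
    lemma true  m m′ p _    = p
    lemma′ : ∀ b m m′ {n} → (if b then m else m′) ≡ false → n ≡ (if b then m′ else m) → m′ ≡ b ∧ n
    lemma′ true  m m′ _ refl = refl
    lemma′ false m m′ p _    = p

  move-retreat : ∀ s t {m} → evalP move s t ≡ just (just m) → s ≡ retreat t × m ≡ topMark t
  move-retreat (lf x) (lf y) e with place-sound x y false (just-injective e)
  ... | p , _ , r = cong lf p , sym r
  move-retreat (un x s) (un y t) e with evalP move s t in es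
  ... | just (just m) with if-nothing {b ∧ m} (just-injective e) | move-retreat s t es
  ... | c , e′ | refl , refl with place-sound x y m e′
  ... | p , q , r = cong₂ un (trans p (cong (λ n → setMark τ n y) (lemma b (topMark t) c))) refl , sym r
    where
    lemma : ∀ b m → b ∧ m ≡ false → m ≡ not b ∧ m
    lemma false m _ = refl
    lemma true  m p = p
  move-retreat (bn x s s′) (bn y t t′) e with evalP move s t in es | evalP move s′ t′ in es′
  move-retreat (bn x s s′) (bn y t t′) () | just (just m) | just nothing
  move-retreat (bn x s s′) (bn y t t′) () | just nothing  | just m′
  ... | just (just m) | just (just m′)
    with if-nothing {if b then m else m′} (just-injective e) | move-retreat s t es | move-retreat s′ t′ es′
  ... | c , e′ | refl , refl | refl , refl with place-sound x y _ e′
  ... | p , _ , r = cong₃ p refl refl , sym r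

  related-state : ∀ s t → Related move s t → evalP move s t ≡ just (just false)
  related-state s t (related r) with evalP move s t
  ... | just (just false) = refl

  move-functional : ∀ s t t′ → Related move s t → Related move s t′ → t ≡ t′
  move-functional s t t′ p q =
    trans (move-advance s t (related-state s t p)) (sym (move-advance s t′ (related-state s t′ q)))

  move-injective : ∀ t s s′ → Related move s t → Related move s′ t → s ≡ s′
  move-injective t s s′ p q =
    trans (proj₁ (move-retreat s t (related-state s t p))) (sym (proj₁ (move-retreat s′ t (related-state s′ t q))))

open Movement public

-- Data trees, claims and their embeddings

data D : Set where
  tip : Dat → D
  nd  : Dat → D → D → D

data Cl : Set where
  c0 : D → Cl
  c1 : D → Cl → Cl
  c2 : D → Cl → Cl → Cl

-- The address of a mark in a data tree, if there is one.
Pos : Set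
Pos = Maybe (List Bool)

here? : Pos → Bool
here? (just []) = true
here? _         = false

below : Bool → Pos → Pos
below false (just (false ∷ α)) = just α
below true  (just (true ∷ α))  = just α
below _     _                  = nothing

embD : Pos → Pos → D → BT Lab
embD α β (tip x)    = lf (dat x (here? α) (here? β))
embD α β (nd x l r) =
  bn (dat x (here? α) (here? β)) (embD (below false α) (below false β) l) (embD (below true α) (below true β) r)

-- One pair of addresses serves all data trees at once. An address that lies outside some data tree
-- leaves that tree unmarked.
embC : Pos → Pos → Cl → BT Lab
embC α β (c0 d)      = un k0 (embD α β d)
embC α β (c1 d c)    = bn k1 (embD α β d) (embC α β c)
embC α β (c2 d c c′) = bn k2 (embD α β d) (bn fk (embC α β c) (embC α β c′))

embT : Pos → Pos → Cl → BT Lab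
embT α β c = un rt (embC α β c)

snoc : Bool → Pos → Pos
snoc b = mapᵐ (_++ [ b ])

dataOf : Cl → D
dataOf (c0 d)     = d
dataOf (c1 d _)   = d
dataOf (c2 d _ _) = d

-- All tests on proof trees have this local form: they relate the data of a claim to those of its
-- children.
Every : (D → Set) → (D → D → Set) → (D → D → D → Set) → Cl → Set
Every P₀ P₁ P₂ (c0 d)      = P₀ d
Every P₀ P₁ P₂ (c1 d c)    = P₁ d (dataOf c) × Every P₀ P₁ P₂ c
Every P₀ P₁ P₂ (c2 d c c′) = P₂ d (dataOf c) (dataOf c′) × Every P₀ P₁ P₂ c × Every P₀ P₁ P₂ c′

private
  cong-bn : ∀ {x : Lab} {s t s′ t′ : BT Lab} → s ≡ t → s′ ≡ t′ → bn x s s′ ≡ bn x t t′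
  cong-bn refl refl = refl

  ∧-zero : ∀ b → b ∧ false ≡ false
  ∧-zero false = refl
  ∧-zero true  = refl

advance₁-enter : ∀ b β d → advance false b true (embD nothing β d) ≡ embD (just []) β d
advance₁-none : ∀ b β d → advance false b false (embD nothing β d) ≡ embD nothing β d
advance₁-none b β (tip x)    = refl
advance₁-none b β (nd x l r) rewrite ∧-zero b | ∧-zero (not b) =
  cong-bn (advance₁-none b _ l) (advance₁-none b _ r)
advance₁-enter b β (tip x)    = refl
advance₁-enter b β (nd x l r) rewrite ∧-zero b | ∧-zero (not b) =
  cong-bn (advance₁-none b _ l) (advance₁-none b _ r)

-- True even at a leaf: there `advance` drops the mark, just as the longer address leaves the tree.
advance₁-D : ∀ b α β d → advance false b false (embD α β d) ≡ embD (snoc b α) β d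
advance₁-D b nothing β d = advance₁-none b β d
advance₁-D b (just []) β (tip x) = refl
advance₁-D false (just []) β (nd x l r) = cong-bn (advance₁-enter false _ l) (advance₁-none false _ r)
advance₁-D true  (just []) β (nd x l r) = cong-bn (advance₁-none true _ l) (advance₁-enter true _ r)
advance₁-D b (just (_ ∷ α)) β (tip x) = refl
advance₁-D b (just (false ∷ α)) β (nd x l r) rewrite ∧-zero b | ∧-zero (not b) =
  cong-bn (advance₁-D b (just α) _ l) (advance₁-none b _ r)
advance₁-D b (just (true ∷ α)) β (nd x l r) rewrite ∧-zero b | ∧-zero (not b) =
  cong-bn (advance₁-none b _ l) (advance₁-D b (just α) _ r)

advance₂-enter : ∀ b α d → advance true b true (embD α nothing d) ≡ embD α (just []) d
advance₂-none : ∀ b α d → advance true b false (embD α nothing d) ≡ embD α nothing d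
advance₂-none b α (tip x)    = refl
advance₂-none b α (nd x l r) rewrite ∧-zero b | ∧-zero (not b) =
  cong-bn (advance₂-none b _ l) (advance₂-none b _ r)
advance₂-enter b α (tip x)    = refl
advance₂-enter b α (nd x l r) rewrite ∧-zero b | ∧-zero (not b) =
  cong-bn (advance₂-none b _ l) (advance₂-none b _ r)

advance₂-D : ∀ b α β d → advance true b false (embD α β d) ≡ embD α (snoc b β) d
advance₂-D b α nothing d = advance₂-none b α d
advance₂-D b α (just []) (tip x) = refl
advance₂-D false α (just []) (nd x l r) = cong-bn (advance₂-enter false _ l) (advance₂-none false _ r)
advance₂-D true  α (just []) (nd x l r) = cong-bn (advance₂-none true _ l) (advance₂-enter true _ r)
advance₂-D b α (just (_ ∷ β)) (tip x) = refl
advance₂-D b α (just (false ∷ β)) (nd x l r) rewrite ∧-zero b | ∧-zero (not b) =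
  cong-bn (advance₂-D b _ (just β) l) (advance₂-none b _ r)
advance₂-D b α (just (true ∷ β)) (nd x l r) rewrite ∧-zero b | ∧-zero (not b) =
  cong-bn (advance₂-none b _ l) (advance₂-D b _ (just β) r)

moved₁ moved₂ : Bool → Bool → Pos → Pos
moved₁ false b α = snoc b α
moved₁ true  b α = α
moved₂ false b β = β
moved₂ true  b β = snoc b β

advance-D : ∀ τ b α β d → advance τ b false (embD α β d) ≡ embD (moved₁ τ b α) (moved₂ τ b β) d
advance-D false = advance₁-D
advance-D true  = advance₂-D

module _ (τ b : Bool) (α β : Pos) where
  private
    α′ = moved₁ τ b α
    β′ = moved₂ τ b β

  advance-C : ∀ c → advance τ b false (embC α β c) ≡ embC α′ β′ c
  advance-C (c0 d) = trans (lemma τ b) (cong (un k0) (advance-D τ b α β d))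
    where
    lemma : ∀ τ b → advance τ b false (un k0 (embD α β d)) ≡ un k0 (advance τ b false (embD α β d))
    lemma false b rewrite ∧-zero (not b) = refl
    lemma true  b rewrite ∧-zero (not b) = refl
  advance-C (c1 d c) = trans (lemma τ b) (cong-bn (advance-D τ b α β d) (advance-C c))
    where
    lemma : ∀ τ b → advance τ b false (embC α β (c1 d c)) ≡
      bn k1 (advance τ b false (embD α β d)) (advance τ b false (embC α β c))
    lemma false b rewrite ∧-zero (not b) | ∧-zero b = refl
    lemma true  b rewrite ∧-zero (not b) | ∧-zero b = refl
  advance-C (c2 d c c′) = trans (lemma τ b) (cong-bn (advance-D τ b α β d) (cong-bn (advance-C c) (advance-C c′)))
    where
    lemma : ∀ τ b → advance τ b false (embC α β (c2 d c c′)) ≡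
      bn k2 (advance τ b false (embD α β d)) (bn fk (advance τ b false (embC α β c)) (advance τ b false (embC α β c′)))
    lemma false b rewrite ∧-zero (not b) | ∧-zero b = refl
    lemma true  b rewrite ∧-zero (not b) | ∧-zero b = refl

  advance-T : ∀ c → advance τ b false (embT α β c) ≡ embT α′ β′ c
  advance-T c = trans (lemma τ b) (cong (un rt) (advance-C c))
    where
    lemma : ∀ τ b → advance τ b false (embT α β c) ≡ un rt (advance τ b false (embC α β c))
    lemma false b rewrite ∧-zero (not b) = refl
    lemma true  b rewrite ∧-zero (not b) = refl

  -- The sentence quantifies over arbitrary trees. Functionality of the moves ensures that whatever
  -- is reached from an embedded claim is the same claim with shifted addresses.
  moved : ∀ c t → Related (move τ b) (embT α β c) t → t ≡ embT α′ β′ c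
  moved c t r = trans (move-advance τ b _ t (related-state τ b _ t r)) (advance-T c)

-- `info α d` describes the node with address α: its label, whether it is a leaf, and whether
-- there is a flag on the branch leading to it.
Info : Set
Info = Dat × Bool × Bool

addFlag : Dat → Info → Info
addFlag x (y , l , f) = y , l , (flag x ∨ f)

info : Pos → D → Maybe Info
info nothing            d          = nothing
info (just [])          (tip x)    = just (x , true , flag x)
info (just [])          (nd x _ _) = just (x , false , flag x)
info (just (_ ∷ α))     (tip x)    = nothing
info (just (false ∷ α)) (nd x l _) = mapᵐ (addFlag x) (info (just α) l)
info (just (true ∷ α))  (nd x _ r) = mapᵐ (addFlag x) (info (just α) r)

isInner : Maybe Info → Bool
isInner (just (_ , l , _)) = not l
isInner nothing            = false

isInner-add : ∀ x i → isInner (mapᵐ (addFlag x) i) ≡ true → isInner i ≡ true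
isInner-add x (just _) p = p

-- Existence of moves

private
  if-same : ∀ b {A : Set} {x : A} → (if b then x else x) ≡ x
  if-same false = refl
  if-same true  = refl

  record Settled (τ b : Bool) (s t : BT Lab) (m : Bool) : Set where
    constructor settled
    field state : evalP (move τ b) s t ≡ just (just m)

  node-still : ∀ τ b x y {s t s′ t′} → x ≡ setMark τ false y → mark τ x ≡ false →
    Settled τ b s t false → Settled τ b s′ t′ false → Settled τ b (bn x s s′) (bn y t t′) (mark τ y)
  node-still τ b x y p q (settled e) (settled e′) .Settled.state rewrite e | e′ | if-same b {x = false} =
    cong just (place-complete τ b x y false p q)

  node-left : ∀ τ x y {s t s′ t′} → x ≡ setMark τ true y → mark τ x ≡ true →
    Settled τ false s t true → Settled τ false s′ t′ false → Settled τ false (bn x s s′) (bn y t t′) (mark τ y)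
  node-left τ x y p q (settled e) (settled e′) .Settled.state rewrite e | e′ = cong just (place-complete τ false x y true p q)

  node-right : ∀ τ x y {s t s′ t′} → x ≡ setMark τ true y → mark τ x ≡ true →
    Settled τ true s t false → Settled τ true s′ t′ true → Settled τ true (bn x s s′) (bn y t t′) (mark τ y)
  node-right τ x y p q (settled e) (settled e′) .Settled.state rewrite e | e′ = cong just (place-complete τ true x y true p q)

  leaf-still : ∀ τ b x y → x ≡ setMark τ false y → mark τ x ≡ false → Settled τ b (lf x) (lf y) (mark τ y)
  leaf-still τ b x y p q = settled (cong just (place-complete τ b x y false p q))

still₁ : ∀ b β d → Settled false b (embD nothing β d) (embD nothing β d) false
still₁ b β (tip x)    = leaf-still false b _ _ refl refl
still₁ b β (nd x l r) = node-still false b _ _ refl refl (still₁ b _ l) (still₁ b _ r)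

enter₁ : ∀ b β d → Settled false b (embD nothing β d) (embD (just []) β d) true
enter₁ b β (tip x)    = leaf-still false b _ _ refl refl
enter₁ b β (nd x l r) = node-still false b _ _ refl refl (still₁ b _ l) (still₁ b _ r)

-- Unlike its converse `advance₁-D`, this needs an inner node, because the automaton blocks on a
-- marked leaf. Subtrees off the path to the mark are handled by `still₁`.
move₁-D : ∀ b α β d → isInner (info (just α) d) ≡ true →
  Settled false b (embD (just α) β d) (embD (just (α ++ [ b ])) β d) false
move₁-D false [] β (nd x l r) i = node-left false _ _ refl refl (enter₁ false _ l) (still₁ false _ r)
move₁-D true  [] β (nd x l r) i = node-right false _ _ refl refl (still₁ true _ l) (enter₁ true _ r)
move₁-D b (false ∷ α) β (nd x l r) i =
  node-still false b _ _ refl refl (move₁-D b α _ l (isInner-add x (info (just α) l) i)) (still₁ b _ r)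
move₁-D b (true ∷ α) β (nd x l r) i =
  node-still false b _ _ refl refl (still₁ b _ l) (move₁-D b α _ r (isInner-add x (info (just α) r) i))

still₂ : ∀ b α d → Settled true b (embD α nothing d) (embD α nothing d) false
still₂ b α (tip x)    = leaf-still true b _ _ refl refl
still₂ b α (nd x l r) = node-still true b _ _ refl refl (still₂ b _ l) (still₂ b _ r)

enter₂ : ∀ b α d → Settled true b (embD α nothing d) (embD α (just []) d) true
enter₂ b α (tip x)    = leaf-still true b _ _ refl refl
enter₂ b α (nd x l r) = node-still true b _ _ refl refl (still₂ b _ l) (still₂ b _ r)

move₂-D : ∀ b α β d → isInner (info (just β) d) ≡ true →
  Settled true b (embD α (just β) d) (embD α (just (β ++ [ b ])) d) false
move₂-D false α [] (nd x l r) i = node-left true _ _ refl refl (enter₂ false _ l) (still₂ false _ r)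
move₂-D true  α [] (nd x l r) i = node-right true _ _ refl refl (still₂ true _ l) (enter₂ true _ r)
move₂-D b α (false ∷ β) (nd x l r) i =
  node-still true b _ _ refl refl (move₂-D b _ β l (isInner-add x (info (just β) l) i)) (still₂ b _ r)
move₂-D b α (true ∷ β) (nd x l r) i =
  node-still true b _ _ refl refl (still₂ b _ l) (move₂-D b _ β r (isInner-add x (info (just β) r) i))

EveryData : (D → Set) → Cl → Set
EveryData P = Every P (λ d _ → P d) (λ d _ _ → P d)

private
  un-still : ∀ τ b x {s t} → x ≡ setMark τ false x → mark τ x ≡ false →
    Settled τ b s t false → Settled τ b (un x s) (un x t) false
  un-still τ b x p q (settled e) .Settled.state rewrite e | ∧-zero b =
    cong just (trans (place-complete τ b x x false p q) (cong just q))

  bn-still : ∀ τ b x {s t s′ t′} → x ≡ setMark τ false x → mark τ x ≡ false →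
    Settled τ b s t false → Settled τ b s′ t′ false → Settled τ b (bn x s s′) (bn x t t′) false
  bn-still τ b x {s} {t} {s′} {t′} p q e e′ =
    subst (Settled τ b (bn x s s′) (bn x t t′)) q (node-still τ b x x p q e e′)

module _ (τ b : Bool) (α β α′ β′ : Pos) (P : D → Set)
         (dataMove : ∀ d → P d → Settled τ b (embD α β d) (embD α′ β′ d) false) where

  private
    constr : ∀ τ → (k0 ≡ setMark τ false k0 × mark τ k0 ≡ false) × (k1 ≡ setMark τ false k1 × mark τ k1 ≡ false)
      × (k2 ≡ setMark τ false k2 × mark τ k2 ≡ false) × (fk ≡ setMark τ false fk × mark τ fk ≡ false)
      × (rt ≡ setMark τ false rt × mark τ rt ≡ false)
    constr false = (refl , refl) , (refl , refl) , (refl , refl) , (refl , refl) , (refl , refl)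
    constr true  = (refl , refl) , (refl , refl) , (refl , refl) , (refl , refl) , (refl , refl)

  move-C : ∀ c → EveryData P c → Settled τ b (embC α β c) (embC α′ β′ c) false
  move-C (c0 d) i with constr τ
  ... | (p , q) , _ = un-still τ b k0 p q (dataMove d i)
  move-C (c1 d c) (i , is) with constr τ
  ... | _ , (p , q) , _ = bn-still τ b k1 p q (dataMove d i) (move-C c is)
  move-C (c2 d c c′) (i , is , is′) with constr τ
  ... | _ , _ , (p , q) , (p′ , q′) , _ =
    bn-still τ b k2 p q (dataMove d i) (bn-still τ b fk p′ q′ (move-C c is) (move-C c′ is′))

  move-T : ∀ c → EveryData P c → Related (move τ b) (embT α β c) (embT α′ β′ c)
  move-T c is with constr τ
  ... | _ , _ , _ , _ , p , q = related (cong (acceptᵐ (move τ b)) (Settled.state (un-still τ b rt p q (move-C c is))))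

move₁ : ∀ b α β c → EveryData (λ d → isInner (info (just α) d) ≡ true) c →
  Related (move false b) (embT (just α) β c) (embT (just (α ++ [ b ])) β c)
move₁ b α β = move-T false b _ _ _ _ _ (move₁-D b α β)

move₂ : ∀ b α β c → EveryData (λ d → isInner (info (just β) d) ≡ true) c →
  Related (move true b) (embT α (just β) c) (embT α (just (β ++ [ b ])) c)
move₂ b α β = move-T true b _ _ _ _ _ (move₂-D b α β)

-- Local properties of proof trees

-- A claim passes on only the summary of its own data tree, which its parent compares with its own.
-- A fork holds two of them, because a node has at most two children.
data LocalState (Q : Set) : Set where
  dead top : LocalState Q
  dta clm  : Q → LocalState Q
  frk      : Q → Q → LocalState Q

opaque
  LocalState-finite : {Q : Set} → Finite Q → Finite (LocalState Q)
  LocalState-finite {Q} F = retract {B = Bool ⊎ (Bool × Q) ⊎ (Q × Q)}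
    (λ { dead → inj₁ false ; top → inj₁ true ; (dta q) → inj₂ (inj₁ (false , q)) ; (clm q) → inj₂ (inj₁ (true , q))
       ; (frk q q′) → inj₂ (inj₂ (q , q′)) })
    (λ { (inj₁ false) → dead ; (inj₁ true) → top ; (inj₂ (inj₁ (false , q))) → dta q
       ; (inj₂ (inj₁ (true , q))) → clm q ; (inj₂ (inj₂ (q , q′))) → frk q q′ })
    (λ { dead → refl ; top → refl ; (dta _) → refl ; (clm _) → refl ; (frk _ _) → refl })
    (finite-⊎ ⦃ finite-Bool ⦄ ⦃ finite-⊎ ⦃ finite-× ⦃ finite-Bool ⦄ ⦃ F ⦄ ⦄ ⦃ finite-× ⦃ F ⦄ ⦃ F ⦄ ⦄ ⦄)

instance
  finite-LocalState : {Q : Set} ⦃ _ : Finite Q ⦄ → Finite (LocalState Q)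
  finite-LocalState ⦃ F ⦄ = LocalState-finite F

-- A summary of data trees by an algebra, and conditions on the summaries of a claim and its
-- children, in the order left child, lower child.
record Local : Set₁ where
  field
    Sum : Set
    finSum : Finite Sum
    s0 : Dat → Bool → Bool → Sum
    s2 : Dat → Bool → Bool → Sum → Sum → Sum
    θ0 : Sum → Bool
    θ1 : Sum → Sum → Bool
    θ2 : Sum → Sum → Sum → Bool
    θr : Sum → Bool

module _ (P : Local) where
  open Local P

  localAlg : Alg Lab (LocalState Sum)
  localAlg = record { a0 = f0 ; a1 = f1 ; a2 = f2 ; junk = dead }
    where
    f0 : Lab → LocalState Sum
    f0 (dat x m n) = dta (s0 x m n)
    f0 _           = dead
    f1 : Lab → LocalState Sum → LocalState Sum
    f1 k0 (dta q) = if θ0 q then clm q else dead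
    f1 rt (clm q) = if θr q then top else dead
    f1 _  _       = dead
    f2 : Lab → LocalState Sum → LocalState Sum → LocalState Sum
    f2 (dat x m n) (dta q) (dta q′)   = dta (s2 x m n q q′)
    f2 k1          (dta q) (clm q′)   = if θ1 q q′ then clm q else dead
    f2 fk          (clm q) (clm q′)   = frk q q′
    f2 k2          (dta q) (frk p p′) = if θ2 q p p′ then clm q else dead
    f2 _ _ _ = dead

  localAcc : LocalState Sum → Bool
  localAcc top = true
  localAcc _   = false

  summary : Pos → Pos → D → Sum
  summary α β (tip x)    = s0 x (here? α) (here? β)
  summary α β (nd x l r) = s2 x (here? α) (here? β)
    (summary (below false α) (below false β) l) (summary (below true α) (below true β) r)

  satisfies : BT Lab → Bool
  satisfies s = localAcc (fold localAlg s)

  fold-D : ∀ α β d → fold localAlg (embD α β d) ≡ dta (summary α β d)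
  fold-D α β (tip x) = refl
  fold-D α β (nd x l r)
    rewrite fold-D (below false α) (below false β) l | fold-D (below true α) (below true β) r = refl

  module _ (α β : Pos) where
    private
      σ = summary α β

    HoldsC : Cl → Set
    HoldsC = Every (λ d → θ0 (σ d) ≡ true) (λ d d′ → θ1 (σ d) (σ d′) ≡ true)
                   (λ d d′ d″ → θ2 (σ d) (σ d′) (σ d″) ≡ true)

    Holds : Cl → Set
    Holds c = HoldsC c × θr (σ (dataOf c)) ≡ true

    fold-C : ∀ c → HoldsC c → fold localAlg (embC α β c) ≡ clm (σ (dataOf c))
    fold-C (c0 d) p rewrite fold-D α β d | p = refl
    fold-C (c1 d c) (p , ps) rewrite fold-D α β d | fold-C c ps | p = refl
    fold-C (c2 d c c′) (p , ps , ps′) rewrite fold-D α β d | fold-C c ps | fold-C c′ ps′ | p = refl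

    holds-satisfies : ∀ c → Holds c → satisfies (embT α β c) ≡ true
    holds-satisfies c (p , q) rewrite fold-C c p | q = refl

    fold-C⁻ : ∀ c {q} → fold localAlg (embC α β c) ≡ clm q → HoldsC c × q ≡ σ (dataOf c)
    fold-C⁻ (c0 d) e rewrite fold-D α β d with θ0 (σ d)
    fold-C⁻ (c0 d) refl | true = refl , refl
    fold-C⁻ (c1 d c) e rewrite fold-D α β d with fold localAlg (embC α β c) in ec
    ... | clm p with fold-C⁻ c ec
    ... | ps , refl with θ1 (σ d) (σ (dataOf c))
    fold-C⁻ (c1 d c) refl | clm p | ps , refl | true = (refl , ps) , refl
    fold-C⁻ (c2 d c c′) e rewrite fold-D α β d
      with fold localAlg (embC α β c) in ec | fold localAlg (embC α β c′) in ec′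
    ... | clm p | clm p′ with fold-C⁻ c ec | fold-C⁻ c′ ec′
    ... | ps , refl | ps′ , refl with θ2 (σ d) (σ (dataOf c)) (σ (dataOf c′))
    fold-C⁻ (c2 d c c′) refl | clm p | clm p′ | ps , refl | ps′ , refl | true = (refl , ps , ps′) , refl

    satisfies-holds : ∀ c → satisfies (embT α β c) ≡ true → Holds c
    satisfies-holds c e with fold localAlg (embC α β c) in ec
    ... | clm q with fold-C⁻ c ec
    ... | ps , refl with θr (σ (dataOf c))
    satisfies-holds c e | clm q | ps , refl | true = ps , refl

-- Well-formedness: marks at the roots of the data trees and subtraction of one

-- The bits of a number and of a smaller one are compared from the least significant one on:
-- 0/1 passes the borrow on, 1/0 absorbs it, and from then on the bits are equal.
data Diff : Set where
  borrow same done wrong : Diff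

Summary : Set
Summary = (Diff × Diff) × (Bool × Bool) × Maybe Bool

opaque
  Diff-finite : Finite Diff
  Diff-finite = retract {B = Bool × Bool}
    (λ { borrow → false , false ; same → false , true ; done → true , false ; wrong → true , true })
    (λ { (false , false) → borrow ; (false , true) → same ; (true , false) → done ; (true , true) → wrong })
    (λ { borrow → refl ; same → refl ; done → refl ; wrong → refl }) finite-×

instance
  finite-Diff : Finite Diff
  finite-Diff = Diff-finite

bitDiff : Bool → Bool → Diff
bitDiff false true  = borrow
bitDiff true  false = done
bitDiff _     _     = same

-- The left argument is the less significant half. A borrow that it leaves over must be passed on or
-- absorbed by the right half, and after absorption all bits have to agree.
_⊕_ : Diff → Diff → Diff
borrow ⊕ borrow = borrow
borrow ⊕ done   = done
done   ⊕ same   = done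
same   ⊕ same   = same
_      ⊕ _      = wrong

-- just true: both marks at the root; just false: no marks; nothing: marks elsewhere.
rootMarks : Bool → Bool → Maybe Bool
rootMarks false false = just false
rootMarks true  true  = just true
rootMarks _     _     = nothing

nodeMarks : Bool → Bool → Maybe Bool → Maybe Bool → Maybe Bool
nodeMarks m n (just false) (just false) = rootMarks m n
nodeMarks _ _ _            _            = nothing

pattern marked = just true

isMarked : Maybe Bool → Bool
isMarked marked = true
isMarked _      = false

isDone : Diff → Bool
isDone done = true
isDone _    = false

wellFormed : Local
wellFormed = record
  { Sum = Summary
  ; finSum = finite-×
  ; s0 = λ x m n → (bitDiff (a-now x) (a-before x) , bitDiff (t-now x) (t-before x))
                   , (not (a-now x) , not (t-now x)) , rootMarks m n
  ; s2 = λ { x m n ((δ , ε) , (y , z) , μ) ((δ′ , ε′) , (y′ , z′) , μ′) →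
             (δ ⊕ δ′ , ε ⊕ ε′) , (y ∧ y′ , z ∧ z′) , nodeMarks m n μ μ′ }
  -- At the left edge only `a` has to vanish, because the tile there is the same for every `t`.
  ; θ0 = λ { (_ , (y , _) , μ) → isMarked μ ∧ y }
  ; θ1 = λ { ((δ , _) , (_ , z) , μ) _ → isMarked μ ∧ (isDone δ ∧ z) }
  ; θ2 = λ { ((δ , ε) , _ , μ) _ _ → isMarked μ ∧ (isDone δ ∧ isDone ε) }
  ; θr = λ _ → true }

marksOf : Summary → Maybe Bool
marksOf (_ , _ , μ) = μ

rootPos : Bool → Pos
rootPos true  = just []
rootPos false = nothing

private
  alg = localAlg wellFormed

rootMarks-sound : ∀ m n {μ} → rootMarks m n ≡ just μ → here? (rootPos μ) ≡ m × here? (rootPos μ) ≡ n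
rootMarks-sound false false refl = refl , refl
rootMarks-sound true  true  refl = refl , refl

below-root : ∀ b μ → below b (rootPos μ) ≡ nothing
below-root false false = refl
below-root false true  = refl
below-root true  false = refl
below-root true  true  = refl

-- `nodeMarks` tolerates marks at the root only, so both addresses of the embedding are empty or
-- absent, as `μ` tells.
parse-D : ∀ s {q μ} → fold alg s ≡ dta q → marksOf q ≡ just μ → ∃ λ d → s ≡ embD (rootPos μ) (rootPos μ) d
parse-D (lf (dat x m n)) {μ = μ} refl e with rootMarks-sound m n e
... | p , p′ = tip x , cong lf (cong₂ (dat x) (sym p) (sym p′))
parse-D (un k0 s) e _ with fold alg s
parse-D (un k0 s) e _ | dta (_ , (y , _) , μ) with isMarked μ ∧ y
parse-D (un k0 s) () _ | dta (_ , (y , _) , μ) | true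
parse-D (un k0 s) () _ | dta (_ , (y , _) , μ) | false
parse-D (un k0 s) () _ | dead
parse-D (un k0 s) () _ | top
parse-D (un k0 s) () _ | clm _
parse-D (un k0 s) () _ | frk _ _
parse-D (un rt s) e _ with fold alg s
parse-D (un rt s) () _ | dta _
parse-D (un rt s) () _ | dead
parse-D (un rt s) () _ | top
parse-D (un rt s) () _ | clm _
parse-D (un rt s) () _ | frk _ _
parse-D (bn (dat x m n) s t) e em with fold alg s in es | fold alg t in et
parse-D (bn (dat x m n) s t) {μ = μ} refl em | dta (_ , _ , just false) | dta (_ , _ , just false)
  with parse-D s es refl | parse-D t et refl | rootMarks-sound m n em
... | d , refl | d′ , refl | p , p′ = nd x d d′ , lemma
  where
  lemma : bn (dat x m n) (embD nothing nothing d) (embD nothing nothing d′) ≡ embD (rootPos μ) (rootPos μ) (nd x d d′)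
  lemma rewrite below-root false μ | below-root true μ | p = cong (λ n → bn (dat x m n) _ _) (sym p′)
parse-D (bn k1 s t) e _ with fold alg s | fold alg t
parse-D (bn k1 s t) e _ | dta ((δ , _) , (_ , z) , μ) | clm _ with isMarked μ ∧ (isDone δ ∧ z)
parse-D (bn k1 s t) () _ | dta _ | clm _ | true
parse-D (bn k1 s t) () _ | dta _ | clm _ | false
parse-D (bn k2 s t) e _ with fold alg s | fold alg t
parse-D (bn k2 s t) e _ | dta ((δ , ε) , _ , μ) | frk _ _ with isMarked μ ∧ (isDone δ ∧ isDone ε)
parse-D (bn k2 s t) () _ | dta _ | frk _ _ | true
parse-D (bn k2 s t) () _ | dta _ | frk _ _ | false
parse-D (bn fk s t) e _ with fold alg s | fold alg t
parse-D (bn fk s t) () _ | clm _ | clm _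

parse-C : ∀ s {q} → fold alg s ≡ clm q → ∃ λ c → s ≡ embC (just []) (just []) c
parse-F : ∀ s {q q′} → fold alg s ≡ frk q q′ →
  ∃ λ c → ∃ λ c′ → s ≡ bn fk (embC (just []) (just []) c) (embC (just []) (just []) c′)

parse-C (lf (dat _ _ _)) ()
parse-C (un k0 s) e with fold alg s in es
parse-C (un k0 s) e | dta (_ , (true , _) , marked) with parse-D s es refl
... | d , refl = c0 d , refl
parse-C (un rt s) e with fold alg s
parse-C (un rt s) () | dta _
parse-C (un rt s) () | dead
parse-C (un rt s) () | top
parse-C (un rt s) () | clm _
parse-C (un rt s) () | frk _ _
parse-C (bn (dat x m n) s t) e with fold alg s | fold alg t
parse-C (bn (dat x m n) s t) () | dta _ | dta _
parse-C (bn k1 s t) e with fold alg s in es | fold alg t in et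
parse-C (bn k1 s t) e | dta ((done , _) , (_ , true) , marked) | clm _ with parse-D s es refl | parse-C t et
... | d , refl | c , refl = c1 d c , refl
parse-C (bn k2 s t) e with fold alg s in es | fold alg t in et
parse-C (bn k2 s t) e | dta ((done , done) , _ , marked) | frk _ _ with parse-D s es refl | parse-F t et
... | d , refl | c , c′ , refl = c2 d c c′ , refl
parse-C (bn fk s t) e with fold alg s | fold alg t
parse-C (bn fk s t) () | clm _ | clm _

parse-F (lf (dat _ _ _)) ()
parse-F (un k0 s) e with fold alg s
parse-F (un k0 s) e | dta (_ , (y , _) , μ) with isMarked μ ∧ y
parse-F (un k0 s) () | dta _ | true
parse-F (un k0 s) () | dta _ | false
parse-F (un rt s) e with fold alg s
parse-F (un rt s) () | dta _
parse-F (un rt s) () | dead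
parse-F (un rt s) () | top
parse-F (un rt s) () | clm _
parse-F (un rt s) () | frk _ _
parse-F (bn (dat x m n) s t) e with fold alg s | fold alg t
parse-F (bn (dat x m n) s t) () | dta _ | dta _
parse-F (bn k1 s t) e with fold alg s | fold alg t
parse-F (bn k1 s t) e | dta ((δ , _) , (_ , z) , μ) | clm _ with isMarked μ ∧ (isDone δ ∧ z)
parse-F (bn k1 s t) () | dta _ | clm _ | true
parse-F (bn k1 s t) () | dta _ | clm _ | false
parse-F (bn k2 s t) e with fold alg s | fold alg t
parse-F (bn k2 s t) e | dta ((δ , ε) , _ , μ) | frk _ _ with isMarked μ ∧ (isDone δ ∧ isDone ε)
parse-F (bn k2 s t) () | dta _ | frk _ _ | true
parse-F (bn k2 s t) () | dta _ | frk _ _ | false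
parse-F (bn fk s t) e with fold alg s in es | fold alg t in et
parse-F (bn fk s t) e | clm _ | clm _ with parse-C s es | parse-C t et
... | c , refl | c′ , refl = c , c′ , refl

-- This turns an arbitrary element of the structure into a claim: labels in a wrong arity or above
-- subtrees of a wrong sort evaluate to `dead`.
parse-T : ∀ s → satisfies wellFormed s ≡ true → ∃ λ c → s ≡ embT (just []) (just []) c
parse-T (lf (dat _ _ _)) ()
parse-T (un k0 s) e with fold alg s
parse-T (un k0 s) e | dta (_ , (y , _) , μ) with isMarked μ ∧ y
parse-T (un k0 s) () | dta _ | true
parse-T (un k0 s) () | dta _ | false
parse-T (un rt s) e with fold alg s in es
parse-T (un rt s) e | clm _ with parse-C s es
... | c , refl = c , refl
parse-T (bn (dat x m n) s t) e with fold alg s | fold alg t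
parse-T (bn (dat x m n) s t) () | dta _ | dta _
parse-T (bn k1 s t) e with fold alg s | fold alg t
parse-T (bn k1 s t) e | dta ((δ , _) , (_ , z) , μ) | clm _ with isMarked μ ∧ (isDone δ ∧ z)
parse-T (bn k1 s t) () | dta _ | clm _ | true
parse-T (bn k1 s t) () | dta _ | clm _ | false
parse-T (bn k2 s t) e with fold alg s | fold alg t
parse-T (bn k2 s t) e | dta ((δ , ε) , _ , μ) | frk _ _ with isMarked μ ∧ (isDone δ ∧ isDone ε)
parse-T (bn k2 s t) () | dta _ | frk _ _ | true
parse-T (bn k2 s t) () | dta _ | frk _ _ | false
parse-T (bn fk s t) e with fold alg s | fold alg t
parse-T (bn fk s t) () | clm _ | clm _

-- Properties of the marked nodes

labelAt : Pos → D → Maybe Dat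
labelAt nothing            d          = nothing
labelAt (just [])          (tip x)    = just x
labelAt (just [])          (nd x _ _) = just x
labelAt (just (_ ∷ β))     (tip x)    = nothing
labelAt (just (false ∷ β)) (nd _ l _) = labelAt (just β) l
labelAt (just (true ∷ β))  (nd _ _ r) = labelAt (just β) r

rootLabel : D → Dat
rootLabel (tip x)    = x
rootLabel (nd x _ _) = x

-- What an automaton remembers of a data tree: the node at the first mark, the label at the second,
-- and the root label, whose letter a claim in row 0 needs from its left child.
MarkSum : Set
MarkSum = Maybe Info × Maybe Dat × Dat

record Conditions : Set where
  constructor conditions
  field
    cond0 : MarkSum → Bool
    cond1 : MarkSum → MarkSum → Bool
    cond2 : MarkSum → MarkSum → MarkSum → Bool
    condR : MarkSum → Bool
open Conditions

markLocal : Conditions → Local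
markLocal C = record
  { Sum = MarkSum
  ; finSum = finite-×
  ; s0 = λ x m n → (if m then just (x , true , flag x) else nothing) , (if n then just x else nothing) , x
  ; s2 = λ { x m n (i , j , _) (i′ , j′ , _) →
             (if m then just (x , false , flag x) else mapᵐ (addFlag x) (i <∣> i′)) , (if n then just x else (j <∣> j′)) , x }
  ; θ0 = cond0 C ; θ1 = cond1 C ; θ2 = cond2 C ; θr = condR C }

<∣>-nothing : {A : Set} (m : Maybe A) → (m <∣> nothing) ≡ m
<∣>-nothing (just _) = refl
<∣>-nothing nothing  = refl

markSum : Pos → Pos → D → MarkSum
markSum α β d = info α d , labelAt β d , rootLabel d

module _ (C : Conditions) where
  private
    P = markLocal C

  -- An embedded data tree carries at most one mark of each kind, so the choice `_<∣>_` loses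
  -- nothing.
  summary-info : ∀ α β d → proj₁ (summary P α β d) ≡ info α d
  summary-info nothing β (tip x) = refl
  summary-info nothing β (nd x l r)
    rewrite summary-info nothing (below false β) l | summary-info nothing (below true β) r = refl
  summary-info (just []) β (tip x) = refl
  summary-info (just []) β (nd x l r) = refl
  summary-info (just (_ ∷ α)) β (tip x) = refl
  summary-info (just (false ∷ α)) β (nd x l r)
    rewrite summary-info (just α) (below false β) l | summary-info nothing (below true β) r
          | <∣>-nothing (info (just α) l) = refl
  summary-info (just (true ∷ α)) β (nd x l r)
    rewrite summary-info nothing (below false β) l | summary-info (just α) (below true β) r = refl

  summary-label : ∀ α β d → proj₁ (proj₂ (summary P α β d)) ≡ labelAt β d
  summary-label α nothing (tip x) = refl
  summary-label α nothing (nd x l r)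
    rewrite summary-label (below false α) nothing l | summary-label (below true α) nothing r = refl
  summary-label α (just []) (tip x) = refl
  summary-label α (just []) (nd x l r) = refl
  summary-label α (just (_ ∷ β)) (tip x) = refl
  summary-label α (just (false ∷ β)) (nd x l r)
    rewrite summary-label (below false α) (just β) l | summary-label (below true α) nothing r
          | <∣>-nothing (labelAt (just β) l) = refl
  summary-label α (just (true ∷ β)) (nd x l r)
    rewrite summary-label (below false α) nothing l | summary-label (below true α) (just β) r = refl

  summary-root : ∀ α β d → proj₂ (proj₂ (summary P α β d)) ≡ rootLabel d
  summary-root α β (tip x) = refl
  summary-root α β (nd x l r) = refl

  summary-mark : ∀ α β d → summary P α β d ≡ markSum α β d
  summary-mark α β d = cong₂ _,_ (summary-info α β d) (cong₂ _,_ (summary-label α β d) (summary-root α β d))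

  module _ (α β : Pos) where
    MarkHoldsC : Cl → Set
    MarkHoldsC = Every (λ d → cond0 C (markSum α β d) ≡ true)
      (λ d d′ → cond1 C (markSum α β d) (markSum α β d′) ≡ true)
      (λ d d′ d″ → cond2 C (markSum α β d) (markSum α β d′) (markSum α β d″) ≡ true)

    MarkHolds : Cl → Set
    MarkHolds c = MarkHoldsC c × condR C (markSum α β (dataOf c)) ≡ true

    mark-holdsC : ∀ c → HoldsC P α β c ≡ MarkHoldsC c
    mark-holdsC (c0 d) rewrite summary-mark α β d = refl
    mark-holdsC (c1 d c) rewrite summary-mark α β d | summary-mark α β (dataOf c) | mark-holdsC c = refl
    mark-holdsC (c2 d c c′) rewrite summary-mark α β d | summary-mark α β (dataOf c) | summary-mark α β (dataOf c′)
      | mark-holdsC c | mark-holdsC c′ = refl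

    mark-holds : ∀ c → Holds P α β c ≡ MarkHolds c
    mark-holds c rewrite mark-holdsC c | summary-mark α β (dataOf c) = refl

    mark-satisfies : ∀ c → (satisfies P (embT α β c) ≡ true) ⇔ MarkHolds c
    mark-satisfies c = mk⇔ (λ e → subst id (mark-holds c) (satisfies-holds P α β c e))
                           (λ h → holds-satisfies P α β c (subst id (sym (mark-holds c)) h))

leafLabel : MarkSum → Maybe Dat
leafLabel (just (x , true , _) , _) = just x
leafLabel _                         = nothing

flag₁ flag₂ : MarkSum → Bool
flag₁ (just (x , _) , _) = flag x
flag₁ (nothing , _)      = false
flag₂ (_ , just x , _)  = flag x
flag₂ (_ , nothing , _) = false

letter₁ letter₂ : MarkSum → Maybe (Maybe Bool)
letter₁ (i , _)     = mapᵐ (λ (x , _) → letter x) i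
letter₂ (_ , j , _) = mapᵐ letter j

flagged : MarkSum → Bool
flagged (just (_ , _ , f) , _) = f
flagged (nothing , _)          = false

always : {A : Set} → A → Bool
always _ = true

sameBits : (Dat → Bool × Bool) → Maybe Dat → Maybe Dat → Bool
sameBits f (just x) (just y) = f x == (a-now y , t-now y)
sameBits _ _        _        = false

isJust : {A : Set} → Maybe A → Bool
isJust (just _) = true
isJust nothing  = false

leftBits lowerBits : Dat → Bool × Bool
leftBits x  = a-before x , t-now x
lowerBits x = a-now x , t-before x

-- A finite list independent of the machine: tiles are referred to only through the depths of the
-- marks. The clashes forbid flags at the marks, of one claim or of a claim and a child.
data Property : Set where
  inner match shift blank clashH clashV clash0 clashR bounded : Property
  letterIs : Bool → Property
  clash1 : Maybe Bool → Property

propertyConditions : Property → Conditions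
propertyConditions inner = conditions (isInner ∘ proj₁) (λ q _ → isInner (proj₁ q)) (λ q _ _ → isInner (proj₁ q)) always
propertyConditions match = conditions (λ q → isJust (leafLabel q)) (λ q l → sameBits leftBits (leafLabel q) (leafLabel l))
  (λ q l b → sameBits leftBits (leafLabel q) (leafLabel l) ∧ sameBits lowerBits (leafLabel q) (leafLabel b)) always
-- Used with the second mark one level below the first: passing to the left child shifts the branch
-- of letters by one.
propertyConditions shift = conditions always (λ q l → letter₁ q == letter₂ l) (λ q l _ → letter₁ q == letter₂ l) always
propertyConditions (letterIs b) = conditions (λ q → letter₁ q == just (just b)) (λ _ → always) (λ _ _ → always) always
propertyConditions blank = conditions (λ q → letter₁ q == just nothing) (λ q _ → letter₁ q == just nothing)
  (λ q _ _ → letter₁ q == just nothing) always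
propertyConditions clashH = conditions always (λ _ → always) (λ q l _ → not (flag₁ q ∧ flag₂ l)) always
propertyConditions clashV = conditions always (λ _ → always) (λ q _ b → not (flag₁ q ∧ flag₂ b)) always
propertyConditions clash0 = conditions (not ∘ flag₁) (λ _ → always) (λ _ _ → always) always
-- A tile of row 0 stands over the letter at the root of its left child's data.
propertyConditions (clash1 s) = conditions always (λ { q (_ , _ , x) → not (flag₁ q ∧ (letter x == s)) }) (λ _ _ → always) always
propertyConditions clashR = conditions always (λ _ → always) (λ _ _ → always) (not ∘ flag₁)
-- With the first mark at depth `κ`, this says that one of the flags for the `κ + 1` tile numbers is
-- present.
propertyConditions bounded = conditions flagged (λ q _ → flagged q) (λ q _ _ → flagged q) always

property : Property → Local
property p = markLocal (propertyConditions p)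

-- The structure

data Symbol : Set where
  moves  : Bool → Bool → Symbol
  stays  : Symbol
  formed : Symbol
  has    : Property → Symbol

opaque
  Property-finite : Finite Property
  Property-finite = retract {B = Fin 9 ⊎ Bool ⊎ Maybe Bool} f f⁻ f⁻-f finite-⊎
    where
    f : Property → Fin 9 ⊎ Bool ⊎ Maybe Bool
    f inner   = inj₁ fz
    f match   = inj₁ (fs fz)
    f shift   = inj₁ (fs (fs fz))
    f blank   = inj₁ (fs (fs (fs fz)))
    f clashH  = inj₁ (fs (fs (fs (fs fz))))
    f clashV  = inj₁ (fs (fs (fs (fs (fs fz)))))
    f clash0  = inj₁ (fs (fs (fs (fs (fs (fs fz))))))
    f clashR  = inj₁ (fs (fs (fs (fs (fs (fs (fs fz)))))))
    f bounded = inj₁ (fs (fs (fs (fs (fs (fs (fs (fs fz))))))))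
    f (letterIs b) = inj₂ (inj₁ b)
    f (clash1 s)   = inj₂ (inj₂ s)
    f⁻ : Fin 9 ⊎ Bool ⊎ Maybe Bool → Property
    f⁻ (inj₁ fz) = inner
    f⁻ (inj₁ (fs fz)) = match
    f⁻ (inj₁ (fs (fs fz))) = shift
    f⁻ (inj₁ (fs (fs (fs fz)))) = blank
    f⁻ (inj₁ (fs (fs (fs (fs fz))))) = clashH
    f⁻ (inj₁ (fs (fs (fs (fs (fs fz)))))) = clashV
    f⁻ (inj₁ (fs (fs (fs (fs (fs (fs fz))))))) = clash0
    f⁻ (inj₁ (fs (fs (fs (fs (fs (fs (fs fz)))))))) = clashR
    f⁻ (inj₁ (fs (fs (fs (fs (fs (fs (fs (fs fz))))))))) = bounded
    f⁻ (inj₂ (inj₁ b)) = letterIs b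
    f⁻ (inj₂ (inj₂ s)) = clash1 s
    f⁻-f : ∀ p → f⁻ (f p) ≡ p
    f⁻-f inner = refl
    f⁻-f match = refl
    f⁻-f shift = refl
    f⁻-f blank = refl
    f⁻-f clashH = refl
    f⁻-f clashV = refl
    f⁻-f clash0 = refl
    f⁻-f clashR = refl
    f⁻-f bounded = refl
    f⁻-f (letterIs b) = refl
    f⁻-f (clash1 s) = refl

  Symbol-finite : Finite Symbol
  Symbol-finite = retract {B = (Bool × Bool) ⊎ Bool ⊎ Property}
    (λ { (moves τ b) → inj₁ (τ , b) ; stays → inj₂ (inj₁ false) ; formed → inj₂ (inj₁ true) ; (has p) → inj₂ (inj₂ p) })
    (λ { (inj₁ (τ , b)) → moves τ b ; (inj₂ (inj₁ false)) → stays ; (inj₂ (inj₁ true)) → formed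
       ; (inj₂ (inj₂ p)) → has p })
    (λ { (moves τ b) → refl ; stays → refl ; formed → refl ; (has p) → refl })
    (finite-⊎ ⦃ finite-× ⦄ ⦃ finite-⊎ ⦃ finite-Bool ⦄ ⦃ Property-finite ⦄ ⦄)

instance
  finite-Symbol : Finite Symbol
  finite-Symbol = Symbol-finite

test : Local → (Bool → Bool) → PairAut Lab
test P f = diagonal ⦃ FQ = finite-LocalState ⦃ Local.finSum P ⦄ ⦄ (localAlg P) (f ∘ localAcc P)

test-related : ∀ P f s t → Related (test P f) s t ⇔ (s ≡ t × f (satisfies P s) ≡ true)
test-related P f = diagonal-related ⦃ FQ = finite-LocalState ⦃ Local.finSum P ⦄ ⦄ (localAlg P) (f ∘ localAcc P)

interpretation : Symbol → PairAut Lab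
interpretation (moves τ b) = move τ b
-- A loop wherever some mark is not at an inner node: a walk that cannot continue in all data trees
-- may rest, so that walks of a prescribed length exist.
interpretation stays       = test (property inner) not
interpretation formed      = test wellFormed id
interpretation (has p)     = test (property p) id

R : ℕ
R = size {Symbol}

arity : Fin R → ℕ
arity _ = 2

𝔄 : Structure R arity
𝔄 = treeStructure rt (interpretation ∘ dec)

𝔄-treeAutomatic : TreeAutomatic 𝔄
𝔄-treeAutomatic = treeAutomatic rt (interpretation ∘ dec)

interpretation-functional : ∀ σ s t t′ → Related (interpretation σ) s t → Related (interpretation σ) s t′ → t ≡ t′
interpretation-functional (moves τ b) s t t′ p q = move-functional τ b s t t′ p q
interpretation-functional stays s t t′ p q =
  trans (sym (proj₁ (Equivalence.to (test-related (property inner) not s t) p)))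
        (proj₁ (Equivalence.to (test-related (property inner) not s t′) q))
interpretation-functional formed s t t′ p q =
  trans (sym (proj₁ (Equivalence.to (test-related wellFormed id s t) p)))
        (proj₁ (Equivalence.to (test-related wellFormed id s t′) q))
interpretation-functional (has π) s t t′ p q =
  trans (sym (proj₁ (Equivalence.to (test-related (property π) id s t) p)))
        (proj₁ (Equivalence.to (test-related (property π) id s t′) q))

interpretation-injective : ∀ σ t s s′ → Related (interpretation σ) s t → Related (interpretation σ) s′ t → s ≡ s′
interpretation-injective (moves τ b) t s s′ p q = move-injective τ b t s s′ p q
interpretation-injective stays t s s′ p q =
  trans (proj₁ (Equivalence.to (test-related (property inner) not s t) p))
        (sym (proj₁ (Equivalence.to (test-related (property inner) not s′ t) q)))
interpretation-injective formed t s s′ p q =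
  trans (proj₁ (Equivalence.to (test-related wellFormed id s t) p))
        (sym (proj₁ (Equivalence.to (test-related wellFormed id s′ t) q)))
interpretation-injective (has π) t s s′ p q =
  trans (proj₁ (Equivalence.to (test-related (property π) id s t) p))
        (sym (proj₁ (Equivalence.to (test-related (property π) id s′ t) q)))

𝔄-boundedDegree : BoundedDegree 𝔄
𝔄-boundedDegree = boundedDegree rt (interpretation ∘ dec)
  (λ i → interpretation-functional (dec i)) (λ i → interpretation-injective (dec i))

-- The sentence

Sentence : Set
Sentence = Formula arity

Env : Set
Env = ℕ → BT Lab

rl : Symbol → ℕ → ℕ → Sentence
rl σ x y = Rel (enc σ) (x ∷ᵛ y ∷ᵛ []ᵛ)

sat-rl : ∀ ρ σ x y → Sat 𝔄 ρ (rl σ x y) ⇔ Related (interpretation σ) (ρ x) (ρ y)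
sat-rl ρ σ x y = mk⇔ (subst (λ σ → Related (interpretation σ) (ρ x) (ρ y)) (dec-enc σ))
                     (subst (λ σ → Related (interpretation σ) (ρ x) (ρ y)) (sym (dec-enc σ)))

is : Property → ℕ → Sentence
is p x = rl (has p) x x

sat-is : ∀ ρ p x → Sat 𝔄 ρ (is p x) ⇔ (satisfies (property p) (ρ x) ≡ true)
sat-is ρ p x = mk⇔ (λ s → proj₂ (T.to (S.to s))) (λ e → S.from (T.from (refl , e)))
  where
  module S = Equivalence (sat-rl ρ (has p) x x)
  module T = Equivalence (test-related (property p) id (ρ x) (ρ x))

open Equivalence using (to; from)

zeros : ℕ → List Bool
zeros j = List.replicate j false

zeros-snoc : ∀ j → zeros j ++ [ false ] ≡ zeros (suc j)
zeros-snoc zero    = refl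
zeros-snoc (suc j) = cong (false ∷_) (zeros-snoc j)

-- The proof tree with the two marks at depths i and j of the leftmost branches.
at : ℕ → ℕ → Cl → BT Lab
at i j = embT (just (zeros i)) (just (zeros j))

Deep : ℕ → Cl → Set
Deep n c = ∀ i → i < n → EveryData (λ d → isInner (info (just (zeros i)) d) ≡ true) c

at-move₁ : ∀ i j c t → Related (move false false) (at i j c) t → t ≡ at (suc i) j c
at-move₁ i j c t r =
  trans (moved false false (just (zeros i)) (just (zeros j)) c t r)
        (cong (λ α → embT (just α) (just (zeros j)) c) (zeros-snoc i))

at-move₂ : ∀ i j c t → Related (move true false) (at i j c) t → t ≡ at i (suc j) c
at-move₂ i j c t r =
  trans (moved true false (just (zeros i)) (just (zeros j)) c t r)
        (cong (λ α → embT (just (zeros i)) (just α) c) (zeros-snoc j))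

move-at₁ : ∀ {n} i j c → Deep n c → i < n → Related (move false false) (at i j c) (at (suc i) j c)
move-at₁ i j c dp p = subst (λ α → Related (move false false) (at i j c) (embT (just α) (just (zeros j)) c))
  (zeros-snoc i) (move₁ false (zeros i) (just (zeros j)) c (dp i p))

move-at₂ : ∀ {n} i j c → Deep n c → j < n → Related (move true false) (at i j c) (at i (suc j) c)
move-at₂ i j c dp p = subst (λ α → Related (move true false) (at i j c) (embT (just (zeros i)) (just α) c))
  (zeros-snoc j) (move₂ false (just (zeros i)) (zeros j) c (dp j p))

-- After each move the new tree is copied back to variable 0, where `φ` and the next move expect it.
goto : Bool → ℕ → Sentence → Sentence
goto τ zero    φ = φ
goto τ (suc j) φ = Ex 1 (And (rl (moves τ false) 0 1) (Ex 0 (And (Eq 0 1) (goto τ j φ))))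

goto₁-sound : ∀ k {φ} ρ i j c → ρ 0 ≡ at i j c → Sat 𝔄 ρ (goto false k φ) →
  Σ Env λ ρ′ → ρ′ 0 ≡ at (k + i) j c × Sat 𝔄 ρ′ φ
goto₁-sound zero ρ i j c e s = ρ , e , s
goto₁-sound (suc k) ρ i j c e (t , r , t′ , t′≡ , s) with
  goto₁-sound k (ρ [ 1 ↦ t ] [ 0 ↦ t′ ]) (suc i) j c
    (trans t′≡ (at-move₁ i j c t (subst (λ x → Related _ x t) e (to (sat-rl (ρ [ 1 ↦ t ]) (moves false false) 0 1) r)))) s
... | ρ′ , e′ , s′ = ρ′ , trans e′ (cong (λ l → at l j c) (ℕ.+-suc k i)) , s′

goto₂-sound : ∀ k {φ} ρ i j c → ρ 0 ≡ at i j c → Sat 𝔄 ρ (goto true k φ) →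
  Σ Env λ ρ′ → ρ′ 0 ≡ at i (k + j) c × Sat 𝔄 ρ′ φ
goto₂-sound zero ρ i j c e s = ρ , e , s
goto₂-sound (suc k) ρ i j c e (t , r , t′ , t′≡ , s) with
  goto₂-sound k (ρ [ 1 ↦ t ] [ 0 ↦ t′ ]) i (suc j) c
    (trans t′≡ (at-move₂ i j c t (subst (λ x → Related _ x t) e (to (sat-rl (ρ [ 1 ↦ t ]) (moves true false) 0 1) r)))) s
... | ρ′ , e′ , s′ = ρ′ , trans e′ (cong (λ l → at i l c) (ℕ.+-suc k j)) , s′

goto₁-complete : ∀ {n} k {φ} ρ i j c → Deep n c → k + i ≤ n → ρ 0 ≡ at i j c →
  (∀ ρ′ → ρ′ 0 ≡ at (k + i) j c → Sat 𝔄 ρ′ φ) → Sat 𝔄 ρ (goto false k φ)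
goto₁-complete zero ρ i j c dp p e s = s ρ e
goto₁-complete {n} (suc k) ρ i j c dp p e s = at (suc i) j c ,
  from (sat-rl (ρ [ 1 ↦ at (suc i) j c ]) (moves false false) 0 1)
    (subst (λ x → Related _ x (at (suc i) j c)) (sym e) (move-at₁ i j c dp (ℕ.≤-trans (s≤s (ℕ.m≤n+m i k)) p))) ,
  at (suc i) j c , refl ,
  goto₁-complete k _ (suc i) j c dp (subst (_≤ n) (sym (ℕ.+-suc k i)) p) refl
    (λ ρ′ e′ → s ρ′ (trans e′ (cong (λ l → at l j c) (ℕ.+-suc k i))))

goto₂-complete : ∀ {n} k {φ} ρ i j c → Deep n c → k + j ≤ n → ρ 0 ≡ at i j c →
  (∀ ρ′ → ρ′ 0 ≡ at i (k + j) c → Sat 𝔄 ρ′ φ) → Sat 𝔄 ρ (goto true k φ)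
goto₂-complete zero ρ i j c dp p e s = s ρ e
goto₂-complete {n} (suc k) ρ i j c dp p e s = at i (suc j) c ,
  from (sat-rl (ρ [ 1 ↦ at i (suc j) c ]) (moves true false) 0 1)
    (subst (λ x → Related _ x (at i (suc j) c)) (sym e) (move-at₂ i j c dp (ℕ.≤-trans (s≤s (ℕ.m≤n+m j k)) p))) ,
  at i (suc j) c , refl ,
  goto₂-complete k _ i (suc j) c dp (subst (_≤ n) (sym (ℕ.+-suc k j)) p) refl
    (λ ρ′ e′ → s ρ′ (trans e′ (cong (λ l → at i l c) (ℕ.+-suc k j))))

conjunction : ∀ n → (Fin n → Sentence) → Sentence
conjunction zero    f = Eq 0 0
conjunction (suc n) f = And (f fz) (conjunction n (f ∘ fs))

sat-conjunction : ∀ n f ρ → Sat 𝔄 ρ (conjunction n f) ⇔ (∀ i → Sat 𝔄 ρ (f i))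
sat-conjunction zero f ρ = mk⇔ (λ _ ()) (λ _ → refl)
sat-conjunction (suc n) f ρ = mk⇔
  (λ { (s , ss) fz → s ; (s , ss) (fs i) → to (sat-conjunction n (f ∘ fs) ρ) ss i })
  (λ h → h fz , from (sat-conjunction n (f ∘ fs) ρ) (h ∘ fs))

-- Whether tiles fit is decided while the sentence is built; only forbidden combinations leave a
-- condition on the tree.
unless : Bool → Sentence → Sentence
unless b φ = if b then Eq 0 0 else φ

sat-unless : ∀ ρ b φ → Sat 𝔄 ρ (unless b φ) ⇔ (b ≡ false → Sat 𝔄 ρ φ)
sat-unless ρ true  φ = mk⇔ (λ _ ()) (λ _ → refl)
sat-unless ρ false φ = mk⇔ (λ s _ → s) (λ h → h refl)

-- Walks of exponential length

Base : BT Lab → BT Lab → Set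
Base s t = Related (move false false) s t ⊎ Related (move false true) s t ⊎ Related (interpretation stays) s t

Iter : ℕ → BT Lab → BT Lab → Set
Iter zero    s t = s ≡ t
Iter (suc n) s t = Σ (BT Lab) λ u → Base s u × Iter n u t

Iter-++ : ∀ m {n s u t} → Iter m s u → Iter n u t → Iter (m + n) s t
Iter-++ zero    refl       q = q
Iter-++ (suc m) (v , b , p) q = v , b , Iter-++ m p q

Iter-split : ∀ m {n s t} → Iter (m + n) s t → Σ (BT Lab) λ u → Iter m s u × Iter n u t
Iter-split zero    p = _ , refl , p
Iter-split (suc m) (v , b , p) with Iter-split m p
... | u , p₁ , p₂ = u , (v , b , p₁) , p₂

-- walk (suc k) says that variables 0 and 1 are joined by two walks of level k; quantifying over
-- both halves at once keeps the size linear in k.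
walk : ℕ → Sentence
walk zero    = Or (rl (moves false false) 0 1) (Or (rl (moves false true) 0 1) (rl stays 0 1))
walk (suc k) = Ex 2 (Fa 3 (Fa 4 (Or (Not (Or (And (Eq 3 0) (Eq 4 2)) (And (Eq 3 2) (Eq 4 1))))
                 (Ex 0 (And (Eq 0 3) (Ex 1 (And (Eq 1 4) (walk k))))))))

sat-walk : ∀ k ρ → Sat 𝔄 ρ (walk k) ⇔ Iter (2 ^ k) (ρ 0) (ρ 1)
sat-walk zero ρ = mk⇔ there₀ back
  where
  there₀ : Sat 𝔄 ρ (walk 0) → Iter 1 (ρ 0) (ρ 1)
  there₀ (inj₁ r)        = _ , inj₁ (to (sat-rl ρ (moves false false) 0 1) r) , refl
  there₀ (inj₂ (inj₁ r)) = _ , inj₂ (inj₁ (to (sat-rl ρ (moves false true) 0 1) r)) , refl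
  there₀ (inj₂ (inj₂ r)) = _ , inj₂ (inj₂ (to (sat-rl ρ stays 0 1) r)) , refl
  back : Iter 1 (ρ 0) (ρ 1) → Sat 𝔄 ρ (walk 0)
  back (_ , inj₁ r        , refl) = inj₁ (from (sat-rl ρ (moves false false) 0 1) r)
  back (_ , inj₂ (inj₁ r) , refl) = inj₂ (inj₁ (from (sat-rl ρ (moves false true) 0 1) r))
  back (_ , inj₂ (inj₂ r) , refl) = inj₂ (inj₂ (from (sat-rl ρ stays 0 1) r))
sat-walk (suc k) ρ = mk⇔ there₀ back
  where
  there₀ : Sat 𝔄 ρ (walk (suc k)) → Iter (2 ^ suc k) (ρ 0) (ρ 1)
  there₀ (z , h) = Iter-++ (2 ^ k) (half (h (ρ 0) z) (λ n → n (inj₁ (refl , refl))))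
    (subst (λ n → Iter n z (ρ 1)) (sym (ℕ.+-identityʳ (2 ^ k))) (half (h z (ρ 1)) (λ n → n (inj₂ (refl , refl)))))
    where
    -- The implication is a disjunction with a negated premise, so its conclusion is extracted by
    -- refuting that negation.
    half : ∀ {u v} {C : Set} → ¬ C ⊎ (Σ (BT Lab) λ x → x ≡ u × Σ (BT Lab) λ y → y ≡ v ×
      Sat 𝔄 (ρ [ 2 ↦ z ] [ 3 ↦ u ] [ 4 ↦ v ] [ 0 ↦ x ] [ 1 ↦ y ]) (walk k)) → ¬ ¬ C → Iter (2 ^ k) u v
    half (inj₁ n) ¬n = ⊥-elim (¬n n)
    half (inj₂ (_ , refl , _ , refl , s)) _ = to (sat-walk k _) s
  back : Iter (2 ^ suc k) (ρ 0) (ρ 1) → Sat 𝔄 ρ (walk (suc k))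
  back p with Iter-split (2 ^ k) p
  ... | z , p₁ , p₂ = z , halves
    where
    halves : ∀ u v → Sat 𝔄 (ρ [ 2 ↦ z ] [ 3 ↦ u ] [ 4 ↦ v ])
      (Or (Not (Or (And (Eq 3 0) (Eq 4 2)) (And (Eq 3 2) (Eq 4 1))))
          (Ex 0 (And (Eq 0 3) (Ex 1 (And (Eq 1 4) (walk k))))))
    -- Satisfaction is constructive, so the disjunction has to be decided: equality of trees tells
    -- whether `u` and `v` are the ends of one of the two halves.
    halves u v with u ≟ᵀ ρ 0 | v ≟ᵀ z | u ≟ᵀ z | v ≟ᵀ ρ 1
    ... | yes refl | yes refl | _ | _ = inj₂ (_ , refl , _ , refl , from (sat-walk k _) p₁)
    ... | _ | _ | yes refl | yes refl =
      inj₂ (_ , refl , _ , refl , from (sat-walk k _) (subst (λ n → Iter n z (ρ 1)) (ℕ.+-identityʳ (2 ^ k)) p₂))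
    ... | no a | _ | no b | _ = inj₁ λ { (inj₁ (e , _)) → a e ; (inj₂ (e , _)) → b e }
    ... | no a | _ | yes _ | no b = inj₁ λ { (inj₁ (e , _)) → a e ; (inj₂ (_ , e)) → b e }
    ... | yes _ | no a | no b | _ = inj₁ λ { (inj₁ (_ , e)) → a e ; (inj₂ (e , _)) → b e }
    ... | yes _ | no a | yes _ | no b = inj₁ λ { (inj₁ (_ , e)) → a e ; (inj₂ (_ , e)) → b e }

-- The second mark stays one level below the first, as `shift` requires. Two variables are reused,
-- so each letter adds a formula of constant size.
reading : List Bool → Sentence
reading []      = is blank 1
reading (b ∷ w) = And (is shift 1) (And (is (letterIs b) 1)
  (Ex 0 (And (rl (moves false false) 1 0) (Ex 1 (And (rl (moves true false) 0 1) (reading w))))))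

input : List Bool → Sentence
input w = Ex 1 (And (rl (moves true false) 0 1) (reading w))

matching : ℕ → Sentence
matching m = Not (Ex 1 (And (walk m) (Not (is match 1))))

-- Tests at given depths, tiles and the whole sentence

record _⊨_at_,_ (c : Cl) (p : Property) (i j : ℕ) : Set where
  constructor holdsAt
  field satisfied : satisfies (property p) (at i j c) ≡ true

Reads : Cl → ℕ → List Bool → Set
Reads c i []      = c ⊨ blank at i , suc i
Reads c i (b ∷ w) = c ⊨ shift at i , suc i × c ⊨ letterIs b at i , suc i × Reads c (suc i) w

private
  is-at : ∀ {p i j c} (ρ : Env) x → ρ x ≡ at i j c → Sat 𝔄 ρ (is p x) ⇔ (c ⊨ p at i , j)
  is-at {p} {i} {j} {c} ρ x e = mk⇔ forth back
    where
    forth : Sat 𝔄 ρ (is p x) → c ⊨ p at i , j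
    forth s = holdsAt (subst (λ y → satisfies (property p) y ≡ true) e (to (sat-is ρ p x) s))
    back : c ⊨ p at i , j → Sat 𝔄 ρ (is p x)
    back (holdsAt h) = from (sat-is ρ p x) (subst (λ y → satisfies (property p) y ≡ true) (sym e) h)

  unless-at : ∀ b p {i j c} (ρ : Env) → ρ 0 ≡ at i j c → Sat 𝔄 ρ (unless b (is p 0)) ⇔ (b ≡ false → c ⊨ p at i , j)
  unless-at b p ρ e = mk⇔ (λ s b≡ → to (is-at ρ 0 e) (to (sat-unless ρ b (is p 0)) s b≡))
                          (λ h → from (sat-unless ρ b (is p 0)) (λ b≡ → from (is-at ρ 0 e) (h b≡)))

reading-sound : ∀ w ρ i c → ρ 1 ≡ at i (suc i) c → Sat 𝔄 ρ (reading w) → Reads c i w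
reading-sound [] ρ i c e s = to (is-at ρ 1 e) s
reading-sound (b ∷ w) ρ i c e (s , s′ , t , r , t′ , r′ , s″) =
  to (is-at ρ 1 e) s , to (is-at ρ 1 e) s′ , reading-sound w (ρ [ 0 ↦ t ] [ 1 ↦ t′ ]) (suc i) c e″ s″
  where
  e′ : t ≡ at (suc i) (suc i) c
  e′ = at-move₁ i (suc i) c t (subst (λ x → Related _ x t) e (to (sat-rl (ρ [ 0 ↦ t ]) (moves false false) 1 0) r))
  e″ : t′ ≡ at (suc i) (suc (suc i)) c
  e″ = at-move₂ (suc i) (suc i) c t′
    (subst (λ x → Related _ x t′) e′ (to (sat-rl (ρ [ 0 ↦ t ] [ 1 ↦ t′ ]) (moves true false) 0 1) r′))

reading-complete : ∀ {n} w ρ i c → Deep n c → i + length w < n → ρ 1 ≡ at i (suc i) c → Reads c i w →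
  Sat 𝔄 ρ (reading w)
reading-complete [] ρ i c dp p e s = from (is-at ρ 1 e) s
reading-complete {n} (b ∷ w) ρ i c dp p e (s , s′ , ss) = from (is-at ρ 1 e) s , from (is-at ρ 1 e) s′ ,
  t , from (sat-rl (ρ [ 0 ↦ t ]) (moves false false) 1 0)
        (subst (λ x → Related _ x t) (sym e) (move-at₁ i (suc i) c dp i<n)) ,
  t′ , from (sat-rl (ρ [ 0 ↦ t ] [ 1 ↦ t′ ]) (moves true false) 0 1) (move-at₂ (suc i) (suc i) c dp si<n) ,
  reading-complete w (ρ [ 0 ↦ t ] [ 1 ↦ t′ ]) (suc i) c dp (subst (_< n) (ℕ.+-suc i (length w)) p) refl ss
  where
  t = at (suc i) (suc i) c
  t′ = at (suc i) (suc (suc i)) c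
  i<n : i < n
  i<n = ℕ.≤-<-trans (ℕ.m≤m+n i (suc (length w))) p
  si<n : suc i < n
  si<n = ℕ.≤-<-trans (ℕ.≤-trans (ℕ.m≤m+n (suc i) (length w)) (ℕ.≤-reflexive (sym (ℕ.+-suc i (length w))))) p

-- ok0, ok1 s and okR admit tiles at a = 0, at t = 0 over the letter s, and at the root of a proof.
record Tiles : Set where
  field
    κ : ℕ
    okH okV : Fin (suc κ) → Fin (suc κ) → Bool
    ok0 okR : Fin (suc κ) → Bool
    ok1 : Maybe Bool → Fin (suc κ) → Bool

module _ (𝒯 : Tiles) where
  open Tiles 𝒯

  singleAt : Fin (suc κ) → Sentence
  singleAt j = And (unless (ok0 j) (is clash0 0)) (And (unless (okR j) (is clashR 0))
    (And (unless (ok1 nothing j) (is (clash1 nothing) 0))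
    (And (unless (ok1 (just false) j) (is (clash1 (just false)) 0))
         (unless (ok1 (just true) j) (is (clash1 (just true)) 0)))))

  single : Fin (suc κ) → Sentence
  single j = goto false (toℕ j) (singleAt j)

  pairAt : Fin (suc κ) → Fin (suc κ) → Sentence
  pairAt j j′ = And (unless (okH j j′) (is clashH 0)) (unless (okV j j′) (is clashV 0))

  pair : Fin (suc κ) → Fin (suc κ) → Sentence
  pair j j′ = goto false (toℕ j) (goto true (toℕ j′) (pairAt j j′))

  tiling : Sentence
  tiling = And (conjunction (suc κ) single)
    (And (conjunction (suc κ) λ j → conjunction (suc κ) (pair j)) (goto false κ (is bounded 0)))

  -- The one outer quantifier guesses the proof tree. Only `input w` and `matching m` grow with the
  -- input; `tiling` depends on the machine alone.
  sentence : List Bool → ℕ → Sentence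
  sentence w m = Ex 0 (And (rl formed 0 0) (And tiling (And (input w) (matching m))))

  record Good (w : List Bool) (m : ℕ) (c : Cl) : Set where
    field
      wf     : Holds wellFormed (just []) (just []) c
      good-H : ∀ j j′ → okH j j′ ≡ false → c ⊨ clashH at toℕ j , toℕ j′
      good-V : ∀ j j′ → okV j j′ ≡ false → c ⊨ clashV at toℕ j , toℕ j′
      good-0 : ∀ j → ok0 j ≡ false → c ⊨ clash0 at toℕ j , 0
      good-R : ∀ j → okR j ≡ false → c ⊨ clashR at toℕ j , 0
      good-1 : ∀ s j → ok1 s j ≡ false → c ⊨ clash1 s at toℕ j , 0
      bnd    : c ⊨ bounded at κ , 0
      reads  : Reads c 0 w
      matches : ∀ t → Iter (2 ^ m) (at 0 0 c) t → satisfies (property match) t ≡ true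

  sentence-sound : ∀ w m ρ → Sat 𝔄 ρ (sentence w m) → ∃ (Good w m)
  sentence-sound w m ρ₀ (x , f , ti , inp , mat)
    with to (test-related wellFormed id x x) (to (sat-rl (ρ₀ [ 0 ↦ x ]) formed 0 0) f)
  ... | _ , f′ with parse-T x f′
  ... | c , refl = c , record
    { wf = satisfies-holds wellFormed (just []) (just []) c f′
    ; good-H = λ j j′ → let ρ′ , e , s = pairs j j′ in to (unless-at (okH j j′) clashH ρ′ e) (proj₁ s)
    ; good-V = λ j j′ → let ρ′ , e , s = pairs j j′ in to (unless-at (okV j j′) clashV ρ′ e) (proj₂ s)
    ; good-0 = λ j → let ρ′ , e , s = singles j in to (unless-at (ok0 j) clash0 ρ′ e) (proj₁ s)
    ; good-R = λ j → let ρ′ , e , s = singles j in to (unless-at (okR j) clashR ρ′ e) (proj₁ (proj₂ s))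
    ; good-1 = λ { nothing j → let ρ′ , e , s = singles j in to (unless-at (ok1 nothing j) (clash1 nothing) ρ′ e) (proj₁ (proj₂ (proj₂ s)))
                 ; (just false) j → let ρ′ , e , s = singles j in to (unless-at (ok1 (just false) j) (clash1 (just false)) ρ′ e) (proj₁ (proj₂ (proj₂ (proj₂ s))))
                 ; (just true) j → let ρ′ , e , s = singles j in to (unless-at (ok1 (just true) j) (clash1 (just true)) ρ′ e) (proj₂ (proj₂ (proj₂ (proj₂ s)))) }
    ; bnd = let ρ′ , e , s = goto₁-sound κ ρ 0 0 c refl (proj₂ (proj₂ ti))
            in to (is-at ρ′ 0 (trans e (cong (λ l → at l 0 c) (ℕ.+-identityʳ κ)))) s
    ; reads = reads inp
    ; matches = matches }
    where
    ρ = ρ₀ [ 0 ↦ x ]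
    singles : ∀ j → Σ Env λ ρ′ → ρ′ 0 ≡ at (toℕ j) 0 c × Sat 𝔄 ρ′ (singleAt j)
    singles j = let ρ′ , e , s = goto₁-sound (toℕ j) ρ 0 0 c refl (to (sat-conjunction (suc κ) single ρ) (proj₁ ti) j)
                in ρ′ , trans e (cong (λ l → at l 0 c) (ℕ.+-identityʳ (toℕ j))) , s
    pairs : ∀ j j′ → Σ Env λ ρ′ → ρ′ 0 ≡ at (toℕ j) (toℕ j′) c × Sat 𝔄 ρ′ (pairAt j j′)
    pairs j j′ =
      let ρ′ , e , s = goto₁-sound (toℕ j) ρ 0 0 c refl
            (to (sat-conjunction (suc κ) (pair j) ρ)
              (to (sat-conjunction (suc κ) (λ j → conjunction (suc κ) (pair j)) ρ) (proj₁ (proj₂ ti)) j) j′)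
          ρ″ , e′ , s′ = goto₂-sound (toℕ j′) ρ′ (toℕ j) 0 c (trans e (cong (λ l → at l 0 c) (ℕ.+-identityʳ (toℕ j)))) s
      in ρ″ , trans e′ (cong (λ l → at (toℕ j) l c) (ℕ.+-identityʳ (toℕ j′))) , s′
    reads : Sat 𝔄 ρ (input w) → Reads c 0 w
    reads (t , r , s) = reading-sound w (ρ [ 1 ↦ t ]) 0 c
      (at-move₂ 0 0 c t (to (sat-rl (ρ [ 1 ↦ t ]) (moves true false) 0 1) r)) s
    matches : ∀ t → Iter (2 ^ m) (at 0 0 c) t → satisfies (property match) t ≡ true
    -- The sentence merely excludes a counterexample; this suffices, because the test is Boolean.
    matches t p with satisfies (property match) t in e
    ... | true  = refl
    ... | false = ⊥-elim (mat (t , from (sat-walk m (ρ [ 1 ↦ t ])) p , λ s →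
      contradiction (trans (sym e) (to (sat-is (ρ [ 1 ↦ t ]) match 1) s)) λ ()))

  -- The marks can descend to depth `n` along the leftmost branches. This leaves room for all tile
  -- numbers and for the second mark one level below the end of the input.
  sentence-complete : ∀ {n} w m ρ c → Deep n c → κ ≤ n → length w < n → Good w m c → Sat 𝔄 ρ (sentence w m)
  sentence-complete {n} w m ρ₀ c dp κ≤n w<n G = at 0 0 c ,
    from (sat-rl ρ formed 0 0)
      (from (test-related wellFormed id (at 0 0 c) (at 0 0 c)) (refl , holds-satisfies wellFormed (just []) (just []) c wf)) ,
    ( from (sat-conjunction (suc κ) single ρ) (λ j →
        goto₁-complete (toℕ j) ρ 0 0 c dp (small j) refl λ ρ′ e →
          let e′ = trans e (cong (λ l → at l 0 c) (ℕ.+-identityʳ (toℕ j))) in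
          from (unless-at (ok0 j) clash0 ρ′ e′) (good-0 j) , from (unless-at (okR j) clashR ρ′ e′) (good-R j) ,
          from (unless-at (ok1 nothing j) (clash1 nothing) ρ′ e′) (good-1 nothing j) , from (unless-at (ok1 (just false) j) (clash1 (just false)) ρ′ e′) (good-1 (just false) j) ,
          from (unless-at (ok1 (just true) j) (clash1 (just true)) ρ′ e′) (good-1 (just true) j))
    , from (sat-conjunction (suc κ) (λ j → conjunction (suc κ) (pair j)) ρ) (λ j →
        from (sat-conjunction (suc κ) (pair j) ρ) λ j′ →
          goto₁-complete (toℕ j) ρ 0 0 c dp (small j) refl λ ρ′ e →
            goto₂-complete (toℕ j′) ρ′ (toℕ j) 0 c dp (small j′)
              (trans e (cong (λ l → at l 0 c) (ℕ.+-identityʳ (toℕ j)))) λ ρ″ e′ →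
              let e″ = trans e′ (cong (λ l → at (toℕ j) l c) (ℕ.+-identityʳ (toℕ j′))) in
              from (unless-at (okH j j′) clashH ρ″ e″) (good-H j j′) , from (unless-at (okV j j′) clashV ρ″ e″) (good-V j j′))
    , goto₁-complete κ ρ 0 0 c dp (subst (_≤ n) (sym (ℕ.+-identityʳ κ)) κ≤n) refl (λ ρ′ e →
        from (is-at ρ′ 0 (trans e (cong (λ l → at l 0 c) (ℕ.+-identityʳ κ)))) bnd) ) ,
    ( at 0 1 c , from (sat-rl (ρ [ 1 ↦ at 0 1 c ]) (moves true false) 0 1) (move-at₂ 0 0 c dp (ℕ.≤-<-trans z≤n w<n)) ,
      reading-complete w (ρ [ 1 ↦ at 0 1 c ]) 0 c dp w<n refl reads ) ,
    λ { (t , s , ns) → ns (from (sat-is (ρ [ 1 ↦ t ]) match 1) (matches t (to (sat-walk m (ρ [ 1 ↦ t ])) s))) }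
    where
    open Good G
    ρ = ρ₀ [ 0 ↦ at 0 0 c ]
    small : ∀ (j : Fin (suc κ)) → toℕ j + 0 ≤ n
    small j = ℕ.≤-trans (ℕ.≤-reflexive (ℕ.+-identityʳ (toℕ j))) (ℕ.≤-trans (Fin.toℕ≤pred[n] j) κ≤n)

-- Numbers in data trees

bit : Bool → ℕ
bit false = 0
bit true  = 1

-- Two to the number of leaves. In `value` it is the weight of the right subtree, so the less
-- significant digits are on the left.
capacity : D → ℕ
capacity (tip x)    = 2
capacity (nd x l r) = capacity l * capacity r

value : (Dat → Bool) → D → ℕ
value f (tip x)    = bit (f x)
value f (nd x l r) = value f l + capacity l * value f r

difference : (Dat → Bool) → (Dat → Bool) → D → Diff
difference f h (tip x)    = bitDiff (f x) (h x)
difference f h (nd x l r) = difference f h l ⊕ difference f h r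

allZero : (Dat → Bool) → D → Bool
allZero f (tip x)    = not (f x)
allZero f (nd x l r) = allZero f l ∧ allZero f r

-- Subtraction of one modulo `c`: `borrow` is the case of 0 against `c - 1`, where a borrow is left
-- over. Nothing is asserted for `wrong`.
DiffMeans : Diff → ℕ → ℕ → ℕ → Set
DiffMeans borrow m n c = m ≡ 0 × suc n ≡ c
DiffMeans same   m n c = m ≡ n
DiffMeans done   m n c = m ≡ suc n
DiffMeans wrong  m n c = ⊤

⊕-means : ∀ δ δ′ {m n c m′ n′ c′} → DiffMeans δ m n c → DiffMeans δ′ m′ n′ c′ →
  DiffMeans (δ ⊕ δ′) (m + c * m′) (n + c * n′) (c * c′)
⊕-means borrow borrow {n = n} {n′ = n′} (refl , refl) (refl , refl) = ℕ.*-zeroʳ n , sym (ℕ.*-suc (suc n) n′)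
⊕-means borrow done {n = n} {n′ = n′} (refl , refl) refl = ℕ.*-suc (suc n) n′
⊕-means done same refl refl = refl
⊕-means same same refl refl = refl
⊕-means borrow same _ _ = tt
⊕-means borrow wrong _ _ = tt
⊕-means done borrow _ _ = tt
⊕-means done done _ _ = tt
⊕-means done wrong _ _ = tt
⊕-means same borrow _ _ = tt
⊕-means same done _ _ = tt
⊕-means same wrong _ _ = tt
⊕-means wrong _ _ _ = tt

difference-means : ∀ f h d → DiffMeans (difference f h d) (value f d) (value h d) (capacity d)
difference-means f h (tip x) with f x | h x
... | false | false = refl
... | false | true  = refl , refl
... | true  | false = refl
... | true  | true  = refl
difference-means f h (nd x l r) =
  ⊕-means (difference f h l) (difference f h r) (difference-means f h l) (difference-means f h r)

difference-done : ∀ f h d → difference f h d ≡ done → value f d ≡ suc (value h d)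
difference-done f h d e = subst (λ δ → DiffMeans δ (value f d) (value h d) (capacity d)) e (difference-means f h d)

allZero-value : ∀ f d → allZero f d ≡ true → value f d ≡ 0
allZero-value f (tip x) e with f x
... | false = refl
allZero-value f (nd x l r) e with ∧-split {allZero f l} e
... | p , q rewrite allZero-value f l p | allZero-value f r q = ℕ.*-zeroʳ (capacity l)

summary-numbers : ∀ α β d → Σ (Maybe Bool) λ μ → summary wellFormed α β d ≡
  ((difference a-now a-before d , difference t-now t-before d) , (allZero a-now d , allZero t-now d) , μ)
summary-numbers α β (tip x) = _ , refl
summary-numbers α β (nd x l r)
  with summary-numbers (below false α) (below false β) l | summary-numbers (below true α) (below true β) r
... | _ , e | _ , e′ rewrite e | e′ = _ , refl

Arithmetic : Cl → Set
Arithmetic = Every (λ d → value a-now d ≡ 0)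
  (λ d _ → value a-now d ≡ suc (value a-before d) × value t-now d ≡ 0)
  (λ d _ _ → value a-now d ≡ suc (value a-before d) × value t-now d ≡ suc (value t-before d))

isDone-sound : ∀ δ → isDone δ ≡ true → δ ≡ done
isDone-sound done _ = refl

wellFormed-arithmetic : ∀ c → HoldsC wellFormed (just []) (just []) c → Arithmetic c
wellFormed-arithmetic (c0 d) h with summary-numbers (just []) (just []) d
... | μ , e rewrite e = allZero-value a-now d (proj₂ (∧-split {isMarked μ} h))
wellFormed-arithmetic (c1 d c) (h , hs) with summary-numbers (just []) (just []) d
... | μ , e rewrite e with ∧-split {isDone (difference a-now a-before d)} (proj₂ (∧-split {isMarked μ} h))
... | p , q = (difference-done _ _ d (isDone-sound _ p) , allZero-value _ d q) , wellFormed-arithmetic c hs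
wellFormed-arithmetic (c2 d c c′) (h , hs , hs′) with summary-numbers (just []) (just []) d
... | μ , e rewrite e with ∧-split {isDone (difference a-now a-before d)} (proj₂ (∧-split {isMarked μ} h))
... | p , q = (difference-done _ _ d (isDone-sound _ p) , difference-done _ _ d (isDone-sound _ q)) ,
  wellFormed-arithmetic c hs , wellFormed-arithmetic c′ hs′

-- Agreement of the numbers of neighbouring claims

-- Agreement of the shapes is part of it: it makes the digits at corresponding leaves have the same
-- weight.
data Matched (f : Dat → Bool × Bool) : D → D → Set where
  tips : ∀ {x y} → f x ≡ (a-now y , t-now y) → Matched f (tip x) (tip y)
  nds  : ∀ {x y l l′ r r′} → Matched f l l′ → Matched f r r′ → Matched f (nd x l r) (nd y l′ r′)

matched-capacity : ∀ {f d d′} → Matched f d d′ → capacity d ≡ capacity d′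
matched-capacity (tips _)  = refl
matched-capacity (nds p q) = cong₂ _*_ (matched-capacity p) (matched-capacity q)

matched-a : ∀ {f d d′} → Matched f d d′ → value (proj₁ ∘ f) d ≡ value a-now d′
matched-a (tips e)  = cong (bit ∘ proj₁) e
matched-a (nds p q) = cong₂ _+_ (matched-a p) (cong₂ _*_ (matched-capacity p) (matched-a q))

matched-t : ∀ {f d d′} → Matched f d d′ → value (proj₂ ∘ f) d ≡ value t-now d′
matched-t (tips e)  = cong (bit ∘ proj₂) e
matched-t (nds p q) = cong₂ _+_ (matched-t p) (cong₂ _*_ (matched-capacity p) (matched-t q))

data Sub : List Bool → D → D → Set where
  root  : ∀ {d} → Sub [] d d
  leftS : ∀ {α x l r e} → Sub α l e → Sub (false ∷ α) (nd x l r) e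
  rightS : ∀ {α x l r e} → Sub α r e → Sub (true ∷ α) (nd x l r) e

sub-join : ∀ α {d e e′} → Sub (α ++ [ false ]) d e → Sub (α ++ [ true ]) d e′ → Σ Dat λ x → Sub α d (nd x e e′)
sub-join [] (leftS root) (rightS root) = _ , root
sub-join (false ∷ α) (leftS s) (leftS s′) with sub-join α s s′
... | x , s″ = x , leftS s″
sub-join (true ∷ α) (rightS s) (rightS s′) with sub-join α s s′
... | x , s″ = x , rightS s″

info-leaf : ∀ α d {x f} → info (just α) d ≡ just (x , true , f) → Sub α d (tip x)
info-leaf [] (tip x) refl = root
info-leaf (false ∷ α) (nd y l r) e with info (just α) l in eq
info-leaf (false ∷ α) (nd y l r) refl | just (x , true , _) = leftS (info-leaf α l eq)
info-leaf (true ∷ α) (nd y l r) e with info (just α) r in eq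
info-leaf (true ∷ α) (nd y l r) refl | just (x , true , _) = rightS (info-leaf α r eq)

MatchedAt : (Dat → Bool × Bool) → List Bool → D → D → Set
MatchedAt f α d d′ = Σ D λ e → Σ D λ e′ → Sub α d e × Sub α d′ e′ × Matched f e e′

-- Agreement below both children yields agreement at the node; this undoes one step of the walk.
matchedAt-join : ∀ f α d d′ → MatchedAt f (α ++ [ false ]) d d′ → MatchedAt f (α ++ [ true ]) d d′ → MatchedAt f α d d′
matchedAt-join f α d d′ (e , e′ , s , s′ , m) (g , g′ , u , u′ , n) with sub-join α s u | sub-join α s′ u′
... | x , v | y , v′ = nd x e g , nd y e′ g′ , v , v′ , nds m n

sameBits-matched : ∀ f α d d′ {j j′ r r′} →
  sameBits f (leafLabel (info (just α) d , j , r)) (leafLabel (info (just α) d′ , j′ , r′)) ≡ true → MatchedAt f α d d′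
sameBits-matched f α d d′ e with info (just α) d in eq | info (just α) d′ in eq′
... | just (x , true , _) | just (y , true , _) =
  tip x , tip y , info-leaf α d eq , info-leaf α d′ eq′ , tips (==-sound e)
sameBits-matched f α d d′ () | just (x , true , _) | just (y , false , _)
sameBits-matched f α d d′ () | just (x , true , _) | nothing

Neighbours : (D → D → Set) → (D → D → Set) → Cl → Set
Neighbours L B = Every (λ _ → ⊤) L (λ d l b → L d l × B d b)

neighbours-map : ∀ {L B L′ B′} → (∀ d l → L d l → L′ d l) → (∀ d b → B d b → B′ d b) → ∀ c →
  Neighbours L B c → Neighbours L′ B′ c
neighbours-map f h (c0 d) _ = tt
neighbours-map f h (c1 d c) (p , ps) = f _ _ p , neighbours-map f h c ps
neighbours-map f h (c2 d c c′) ((p , q) , ps , ps′) =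
  (f _ _ p , h _ _ q) , neighbours-map f h c ps , neighbours-map f h c′ ps′

neighbours-zip : ∀ {L B L′ B′ L″ B″} → (∀ d l → L d l → L′ d l → L″ d l) → (∀ d b → B d b → B′ d b → B″ d b) → ∀ c →
  Neighbours L B c → Neighbours L′ B′ c → Neighbours L″ B″ c
neighbours-zip f h (c0 d) _ _ = tt
neighbours-zip f h (c1 d c) (p , ps) (q , qs) = f _ _ p q , neighbours-zip f h c ps qs
neighbours-zip f h (c2 d c c′) ((p , p′) , ps , ps′) ((q , q′) , qs , qs′) =
  (f _ _ p q , h _ _ p′ q′) , neighbours-zip f h c ps qs , neighbours-zip f h c′ ps′ qs′

module _ (c : Cl) where

  tree : List Bool → BT Lab
  tree α = embT (just α) (just []) c

  leaf-match : ∀ α → satisfies (property match) (tree α) ≡ true →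
    Neighbours (MatchedAt leftBits α) (MatchedAt lowerBits α) c
  leaf-match α e = go c (proj₁ (to (mark-satisfies (propertyConditions match) (just α) (just []) c) e))
    where
    go : ∀ c → MarkHoldsC (propertyConditions match) (just α) (just []) c → Neighbours (MatchedAt leftBits α) (MatchedAt lowerBits α) c
    go (c0 d) _ = tt
    go (c1 d c) (p , ps) = sameBits-matched leftBits α d (dataOf c) p , go c ps
    go (c2 d c c′) (p , ps , ps′) with ∧-split p
    ... | q , q′ = (sameBits-matched leftBits α d (dataOf c) q , sameBits-matched lowerBits α d (dataOf c′) q′) , go c ps , go c′ ps′

  inner-everywhere : ∀ α → satisfies (property inner) (tree α) ≡ true →
    EveryData (λ d → isInner (info (just α) d) ≡ true) c
  inner-everywhere α e = proj₁ (to (mark-satisfies (propertyConditions inner) (just α) (just []) c) e)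

  -- Every branching of the walk can be taken, unless some mark is at a leaf; then the walk rests
  -- and the final test shows that all marks are.
  walk-match : ∀ n α → (∀ t → Iter n (tree α) t → satisfies (property match) t ≡ true) →
    Neighbours (MatchedAt leftBits α) (MatchedAt lowerBits α) c
  walk-match zero α h = leaf-match α (h _ refl)
  walk-match (suc n) α h with satisfies (property inner) (tree α) in e
  ... | true = neighbours-zip (matchedAt-join leftBits α) (matchedAt-join lowerBits α) c
    (walk-match n (α ++ [ false ]) λ t p → h t (_ , inj₁ (move₁ false α (just []) c (inner-everywhere α e)) , p))
    (walk-match n (α ++ [ true ]) λ t p → h t (_ , inj₂ (inj₁ (move₁ true α (just []) c (inner-everywhere α e))) , p))
  ... | false = walk-match n α λ t p →
    h t (_ , inj₂ (inj₂ (from (test-related (property inner) not (tree α) (tree α)) (refl , cong not e))) , p)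

  walk-matched : ∀ n → (∀ t → Iter n (tree []) t → satisfies (property match) t ≡ true) →
    Neighbours (Matched leftBits) (Matched lowerBits) c
  walk-matched n h = neighbours-map (λ d l → atRoot) (λ d b → atRoot) c (walk-match n [] h)
    where
    atRoot : ∀ {f d d′} → MatchedAt f [] d d′ → Matched f d d′
    atRoot (_ , _ , root , root , m) = m

-- Soundness of proof trees

row : List Bool → ℕ → Maybe Bool
row []      _       = nothing
row (b ∷ w) zero    = just b
row (b ∷ w) (suc i) = row w i

row-beyond : ∀ w i → length w ≤ i → row w i ≡ nothing
row-beyond []      i       _       = refl
row-beyond (b ∷ w) (suc i) (s≤s p) = row-beyond w i p

flag? : Maybe Dat → Bool
flag? (just x) = flag x
flag? nothing  = false

flagAt : ℕ → D → Bool
flagAt j d = flag? (labelAt (just (zeros j)) d)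

letterAt : ℕ → D → Maybe (Maybe Bool)
letterAt j d = mapᵐ letter (labelAt (just (zeros j)) d)

info-label : ∀ α d → mapᵐ proj₁ (info α d) ≡ labelAt α d
info-label nothing d = refl
info-label (just []) (tip x) = refl
info-label (just []) (nd x l r) = refl
info-label (just (_ ∷ α)) (tip x) = refl
info-label (just (false ∷ α)) (nd x l r) with info (just α) l | info-label (just α) l
... | just _  | e = e
... | nothing | e = e
info-label (just (true ∷ α)) (nd x l r) with info (just α) r | info-label (just α) r
... | just _  | e = e
... | nothing | e = e

flag₁-at : ∀ j d {q} → flag₁ (info (just (zeros j)) d , q) ≡ flagAt j d
flag₁-at j d rewrite sym (info-label (just (zeros j)) d) with info (just (zeros j)) d
... | just _  = refl
... | nothing = refl

flag₂-at : ∀ j d {i r} → flag₂ (i , labelAt (just (zeros j)) d , r) ≡ flagAt j d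
flag₂-at j d with labelAt (just (zeros j)) d
... | just _  = refl
... | nothing = refl

letter₁-at : ∀ j d → letter₁ (info (just (zeros j)) d , nothing , rootLabel d) ≡ letterAt j d
letter₁-at j d rewrite sym (info-label (just (zeros j)) d) with info (just (zeros j)) d
... | just _  = refl
... | nothing = refl

rootLabel-at : ∀ d → just (letter (rootLabel d)) ≡ letterAt 0 d
rootLabel-at (tip x) = refl
rootLabel-at (nd x l r) = refl

info-flagged : ∀ n d {x l} → info (just (zeros n)) d ≡ just (x , l , true) → ∃ λ j → j ≤ n × flagAt j d ≡ true
info-flagged zero (tip x) e = 0 , z≤n , cong (λ { (just (_ , _ , f)) → f ; nothing → false }) e
info-flagged zero (nd x l r) e = 0 , z≤n , cong (λ { (just (_ , _ , f)) → f ; nothing → false }) e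
info-flagged (suc n) (nd x l r) e with info (just (zeros n)) l in eq
... | just (y , b , f) with flag x in ef
... | true = 0 , z≤n , ef
info-flagged (suc n) (nd x l r) refl | just (y , b , true) | false with info-flagged n l eq
... | j , p , q = suc j , s≤s p , q

flagged-at : ∀ n d {q} → flagged (info (just (zeros n)) d , q) ≡ true → ∃ λ (j : Fin (suc n)) → flagAt (toℕ j) d ≡ true
flagged-at n d e with info (just (zeros n)) d in eq
flagged-at n d refl | just (x , l , true) with info-flagged n d eq
... | j , p , q = fromℕ< (s≤s p) , subst (λ j → flagAt j d ≡ true) (sym (Fin.toℕ-fromℕ< (s≤s p))) q

every-map : ∀ {P Q : D → Set} {P₁ Q₁ : D → D → Set} {P₂ Q₂ : D → D → D → Set} →
  (∀ d → P d → Q d) → (∀ d l → P₁ d l → Q₁ d l) → (∀ d l b → P₂ d l b → Q₂ d l b) → ∀ c → Every P P₁ P₂ c → Every Q Q₁ Q₂ c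
every-map f g h (c0 d) p = f d p
every-map f g h (c1 d c) (p , ps) = g _ _ p , every-map f g h c ps
every-map f g h (c2 d c c′) (p , ps , ps′) = h _ _ _ p , every-map f g h c ps , every-map f g h c′ ps′

Lefts : (D → D → Set) → Cl → Set
Lefts L = Every (λ _ → ⊤) L (λ d l _ → L d l)

Exclusive : Bool → Bool → Set
Exclusive x y = x ≡ true → y ≢ true

exclusive : ∀ {x y x′ y′} → x ≡ x′ → y ≡ y′ → not (x ∧ y) ≡ true → Exclusive x′ y′
exclusive {true} {true} refl refl () _ _
exclusive {true} {false} refl refl _ _ ()
exclusive {false} refl refl _ ()

module _ (𝒯 : Tiles) (w : List Bool) where
  open Tiles 𝒯

  -- What the sentence says about a proof tree, in a form inherited by subtrees.
  record Facts (c : Cl) : Set where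
    field
      numbers : Arithmetic c
      agree   : Neighbours (Matched leftBits) (Matched lowerBits) c
      hor     : ∀ j j′ → okH j j′ ≡ false →
                Every (λ _ → ⊤) (λ _ _ → ⊤) (λ d l _ → Exclusive (flagAt (toℕ j) d) (flagAt (toℕ j′) l)) c
      ver     : ∀ j j′ → okV j j′ ≡ false →
                Every (λ _ → ⊤) (λ _ _ → ⊤) (λ d _ b → Exclusive (flagAt (toℕ j) d) (flagAt (toℕ j′) b)) c
      edge    : ∀ j → ok0 j ≡ false → Every (λ d → flagAt (toℕ j) d ≢ true) (λ _ _ → ⊤) (λ _ _ _ → ⊤) c
      bottom  : ∀ s j → ok1 s j ≡ false →
                Every (λ _ → ⊤) (λ d l → flagAt (toℕ j) d ≡ true → letterAt 0 l ≢ just s) (λ _ _ _ → ⊤) c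
      tiled   : EveryData (λ d → ∃ λ (j : Fin (suc κ)) → flagAt (toℕ j) d ≡ true) c
      start   : ∀ i → i < length w → Every (λ d → letterAt i d ≡ just (row w i)) (λ _ _ → ⊤) (λ _ _ _ → ⊤) c
      shifts  : ∀ i → i < length w → Lefts (λ d l → letterAt i d ≡ letterAt (suc i) l) c
      end     : EveryData (λ d → letterAt (length w) d ≡ just nothing) c

  open Facts

  facts-1 : ∀ {d c} → Facts (c1 d c) → Facts c
  facts-1 F = record
    { numbers = proj₂ (numbers F) ; agree = proj₂ (agree F) ; hor = λ j j′ e → proj₂ (hor F j j′ e)
    ; ver = λ j j′ e → proj₂ (ver F j j′ e) ; edge = λ j e → proj₂ (edge F j e)
    ; bottom = λ s j e → proj₂ (bottom F s j e) ; tiled = proj₂ (tiled F)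
    ; start = λ i p → proj₂ (start F i p) ; shifts = λ i p → proj₂ (shifts F i p) ; end = proj₂ (end F) }

  facts-2 : ∀ {d c c′} → Facts (c2 d c c′) → Facts c × Facts c′
  facts-2 F =
    record
    { numbers = proj₁ (proj₂ (numbers F)) ; agree = proj₁ (proj₂ (agree F)) ; hor = λ j j′ e → proj₁ (proj₂ (hor F j j′ e))
    ; ver = λ j j′ e → proj₁ (proj₂ (ver F j j′ e)) ; edge = λ j e → proj₁ (proj₂ (edge F j e))
    ; bottom = λ s j e → proj₁ (proj₂ (bottom F s j e)) ; tiled = proj₁ (proj₂ (tiled F))
    ; start = λ i p → proj₁ (proj₂ (start F i p)) ; shifts = λ i p → proj₁ (proj₂ (shifts F i p))
    ; end = proj₁ (proj₂ (end F)) } ,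
    record
    { numbers = proj₂ (proj₂ (numbers F)) ; agree = proj₂ (proj₂ (agree F)) ; hor = λ j j′ e → proj₂ (proj₂ (hor F j j′ e))
    ; ver = λ j j′ e → proj₂ (proj₂ (ver F j j′ e)) ; edge = λ j e → proj₂ (proj₂ (edge F j e))
    ; bottom = λ s j e → proj₂ (proj₂ (bottom F s j e)) ; tiled = proj₂ (proj₂ (tiled F))
    ; start = λ i p → proj₂ (proj₂ (start F i p)) ; shifts = λ i p → proj₂ (proj₂ (shifts F i p))
    ; end = proj₂ (proj₂ (end F)) }

  posA posT : Cl → ℕ
  posA c = value a-now (dataOf c)
  posT c = value t-now (dataOf c)

  private
    letters-step : ∀ {d d′ a′} → (∀ i → i < length w → letterAt i d ≡ letterAt (suc i) d′) →
      letterAt (length w) d ≡ just nothing → (∀ i → i ≤ length w → letterAt i d′ ≡ just (row w (a′ + i))) →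
      ∀ i → i ≤ length w → letterAt i d ≡ just (row w (suc a′ + i))
    letters-step {d} {d′} {a′} sh en ih i p with ℕ.m≤n⇒m<n∨m≡n p
    ... | inj₁ lt = trans (sh i lt) (trans (ih (suc i) lt) (cong (just ∘ row w) (ℕ.+-suc a′ i)))
    ... | inj₂ refl = trans en (cong just (sym (row-beyond w (suc a′ + length w) (ℕ.m≤n+m (length w) (suc a′)))))

  -- By induction along the left children down to `a = 0`, where the sentence fixes the letters. At
  -- depth `length w` the letter is blank in every claim, so the shift never has to look deeper than
  -- that.
  letters : ∀ c → Facts c → ∀ i → i ≤ length w → letterAt i (dataOf c) ≡ just (row w (posA c + i))
  letters (c0 d) F i p rewrite numbers F with ℕ.m≤n⇒m<n∨m≡n p
  ... | inj₁ lt = start F i lt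
  ... | inj₂ refl = trans (end F) (cong just (sym (row-beyond w (length w) ℕ.≤-refl)))
  letters (c1 d c) F i p
    rewrite proj₁ (proj₁ (numbers F)) | matched-a (proj₁ (agree F)) =
    letters-step (λ i p → proj₁ (shifts F i p)) (proj₁ (end F)) (letters c (facts-1 F)) i p
  letters (c2 d c c′) F i p
    rewrite proj₁ (proj₁ (numbers F)) | matched-a (proj₁ (proj₁ (agree F))) =
    letters-step (λ i p → proj₁ (shifts F i p)) (proj₁ (end F)) (letters c (proj₁ (facts-2 F))) i p

  -- Soundness rests on uniqueness of the tile at each position; existence is the matter of
  -- `Consistent`.
  record Determined (tl : ℕ → ℕ → Fin (suc κ)) : Set where
    field
      at-edge   : ∀ j t → ok0 j ≡ true → j ≡ tl 0 t
      at-bottom : ∀ j a → ok1 (row w a) j ≡ true → j ≡ tl (suc a) 0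
      inside    : ∀ j a t → okH j (tl a (suc t)) ≡ true → okV j (tl (suc a) t) ≡ true → j ≡ tl (suc a) (suc t)

  module _ {tl : ℕ → ℕ → Fin (suc κ)} (det : Determined tl) where
    open Determined det

    private
      bool-cases : ∀ {x} → (x ≡ false → ⊥) → x ≡ true
      bool-cases {true}  _ = refl
      bool-cases {false} n = ⊥-elim (n refl)

    -- A mutual induction. The tests only exclude pairs of flags, so a claim is constrained once its
    -- children are known to carry the flags of the true tiles. They do, since each has some flag
    -- and, by induction, no wrong one.
    tiles-sound : ∀ c → Facts c → ∀ j → flagAt (toℕ j) (dataOf c) ≡ true → j ≡ tl (posA c) (posT c)
    some-tile : ∀ c → Facts c → flagAt (toℕ (tl (posA c) (posT c))) (dataOf c) ≡ true

    tiles-sound (c0 d) F j fl rewrite numbers F = at-edge j _ (bool-cases λ e → edge F j e fl)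
    tiles-sound (c1 d c) F j fl
      rewrite proj₁ (proj₁ (numbers F)) | proj₂ (proj₁ (numbers F)) | matched-a (proj₁ (agree F)) =
      at-bottom j (posA c) (bool-cases λ e → proj₁ (bottom F _ j e) fl
        (trans (letters c (facts-1 F) 0 z≤n) (cong (just ∘ row w) (ℕ.+-identityʳ (posA c)))))
    tiles-sound (c2 d c c′) F j fl with facts-2 F
    ... | F₁ , F₂ =
      trans (inside j (posA c) (posT c′)
        (bool-cases λ e → proj₁ (hor F j _ e) fl (subst (λ t → flagAt (toℕ (tl (posA c) t)) (dataOf c) ≡ true) t≡ (some-tile c F₁)))
        (bool-cases λ e → proj₁ (ver F j _ e) fl (subst (λ a → flagAt (toℕ (tl a (posT c′))) (dataOf c′) ≡ true) a≡ (some-tile c′ F₂))))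
        (cong₂ tl (sym (trans (proj₁ (proj₁ (numbers F))) (cong suc (matched-a (proj₁ (proj₁ (agree F)))))))
                  (sym (trans (proj₂ (proj₁ (numbers F))) (cong suc (matched-t (proj₂ (proj₁ (agree F))))))))
      where
      t≡ : posT c ≡ suc (posT c′)
      t≡ = trans (sym (matched-t (proj₁ (proj₁ (agree F)))))
             (trans (proj₂ (proj₁ (numbers F))) (cong suc (matched-t (proj₂ (proj₁ (agree F))))))
      a≡ : posA c′ ≡ suc (posA c)
      a≡ = trans (sym (matched-a (proj₂ (proj₁ (agree F)))))
             (trans (proj₁ (proj₁ (numbers F))) (cong suc (matched-a (proj₁ (proj₁ (agree F))))))

    some-tile c F with someFlag c (tiled F)
      where
      someFlag : ∀ c → EveryData (λ d → ∃ λ (j : Fin (suc κ)) → flagAt (toℕ j) d ≡ true) c →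
        ∃ λ (j : Fin (suc κ)) → flagAt (toℕ j) (dataOf c) ≡ true
      someFlag (c0 d) p = p
      someFlag (c1 d c) (p , _) = p
      someFlag (c2 d c c′) (p , _) = p
    ... | j , fl = subst (λ j → flagAt (toℕ j) (dataOf c) ≡ true) (tiles-sound c F j fl) fl

at-holds : ∀ {c p i j} → c ⊨ p at i , j → MarkHolds (propertyConditions p) (just (zeros i)) (just (zeros j)) c
at-holds {c} {p} {i} {j} (holdsAt h) = to (mark-satisfies (propertyConditions p) (just (zeros i)) (just (zeros j)) c) h

reads-at : ∀ {c} v i → Reads c i v → ∀ k → k < length v →
  c ⊨ shift at i + k , suc (i + k) × ∃ λ b → row v k ≡ just b × c ⊨ letterIs b at i + k , suc (i + k)
reads-at {c} (b ∷ v) i (s , l , rs) zero p rewrite ℕ.+-identityʳ i = s , b , refl , l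
reads-at {c} (b ∷ v) i (s , l , rs) (suc k) (s≤s p) rewrite ℕ.+-suc i k = reads-at v (suc i) rs k p

reads-end : ∀ {c} v i → Reads c i v → c ⊨ blank at i + length v , suc (i + length v)
reads-end [] i r rewrite ℕ.+-identityʳ i = r
reads-end (b ∷ v) i (_ , _ , rs) rewrite ℕ.+-suc i (length v) = reads-end v (suc i) rs

module _ (𝒯 : Tiles) (w : List Bool) where
  open Tiles 𝒯
  good-facts : ∀ {m c} → Good 𝒯 w m c → Facts 𝒯 w c
  good-facts {m} {c} G = record
    { numbers = wellFormed-arithmetic c (proj₁ wf)
    ; agree = walk-matched c (2 ^ m) matches
    ; hor = λ j j′ e → every-map (λ _ _ → tt) (λ _ _ _ → tt)
        (λ d l _ → exclusive (flag₁-at (toℕ j) d) (flag₂-at (toℕ j′) l)) c (proj₁ (at-holds (good-H j j′ e)))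
    ; ver = λ j j′ e → every-map (λ _ _ → tt) (λ _ _ _ → tt)
        (λ d _ b → exclusive (flag₁-at (toℕ j) d) (flag₂-at (toℕ j′) b)) c (proj₁ (at-holds (good-V j j′ e)))
    ; edge = λ j e → every-map (λ d p q → not-true p (trans (flag₁-at (toℕ j) d) q)) (λ _ _ _ → tt) (λ _ _ _ _ → tt)
        c (proj₁ (at-holds (good-0 j e)))
    ; bottom = λ s j e → every-map (λ _ _ → tt)
        (λ d l p q r → exclusive (flag₁-at (toℕ j) d) refl p q
          (==-complete (just-injective (trans (rootLabel-at l) r)))) (λ _ _ _ _ → tt)
        c (proj₁ (at-holds (good-1 s j e)))
    ; tiled = every-map (λ d → flagged-at κ d) (λ d _ → flagged-at κ d) (λ d _ _ → flagged-at κ d) c (proj₁ (at-holds bnd))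
    ; start = λ i p → let _ , b , e , h = reads-at w 0 reads i p in
        every-map (λ d q → trans (sym (letter₁-at i d)) (trans (==-sound q) (cong just (sym e)))) (λ _ _ _ → tt) (λ _ _ _ _ → tt)
          c (proj₁ (at-holds h))
    ; shifts = λ i p → every-map (λ _ _ → tt) (λ d l q → trans (sym (letter₁-at i d)) (==-sound q))
        (λ d l _ q → trans (sym (letter₁-at i d)) (==-sound q)) c (proj₁ (at-holds (proj₁ (reads-at w 0 reads i p))))
    ; end = every-map (λ d q → trans (sym (letter₁-at n d)) (==-sound q)) (λ d _ q → trans (sym (letter₁-at n d)) (==-sound q))
        (λ d _ _ q → trans (sym (letter₁-at n d)) (==-sound q)) c (proj₁ (at-holds (reads-end w 0 reads))) }
    where
    open Good G
    n = length w

  good-sound : ∀ {m c tl} → Determined 𝒯 w tl → Good 𝒯 w m c → ∃ λ a → ∃ λ t → okR (tl a t) ≡ true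
  good-sound {m} {c} {tl} det G = a , t , okay (okR (tl a t)) refl
    where
    a = posA 𝒯 w c
    t = posT 𝒯 w c
    okay : ∀ x → okR (tl a t) ≡ x → okR (tl a t) ≡ true
    okay true  e = e
    -- Otherwise `clashR` would forbid at the root the flag that `some-tile` provides.
    okay false e = ⊥-elim (not-true (proj₂ (at-holds (Good.good-R G (tl a t) e)))
      (trans (flag₁-at (toℕ (tl a t)) (dataOf c)) (some-tile 𝒯 w det c (good-facts G))))

-- Perfect binary trees of bits

data Perfect : ℕ → Set where
  leaf : Bool → Perfect 0
  node : ∀ {d} → Perfect d → Perfect d → Perfect (suc d)

zeroᵖ : ∀ d → Perfect d
zeroᵖ zero    = leaf false
zeroᵖ (suc d) = node (zeroᵖ d) (zeroᵖ d)

increment : ∀ {d} → Perfect d → Perfect d × Bool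
increment (leaf false) = leaf true , false
increment (leaf true)  = leaf false , true
increment (node l r) with increment l
... | l′ , false = node l′ r , false
... | l′ , true  with increment r
...   | r′ , c = node l′ r′ , c

number : ∀ d → ℕ → Perfect d
number d zero    = zeroᵖ d
number d (suc a) = proj₁ (increment (number d a))

capᵖ : ℕ → ℕ
capᵖ zero    = 2
capᵖ (suc d) = capᵖ d * capᵖ d

valᵖ : ∀ {d} → Perfect d → ℕ
valᵖ (leaf b) = bit b
valᵖ {suc d} (node l r) = valᵖ l + capᵖ d * valᵖ r

valᵖ-zero : ∀ d → valᵖ (zeroᵖ d) ≡ 0
valᵖ-zero zero    = refl
valᵖ-zero (suc d) rewrite valᵖ-zero d = ℕ.*-zeroʳ (capᵖ d)

valᵖ-increment : ∀ {d} (p : Perfect d) {p′} →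
  (increment p ≡ (p′ , false) → valᵖ p′ ≡ suc (valᵖ p)) × (increment p ≡ (p′ , true) → valᵖ p′ ≡ 0 × suc (valᵖ p) ≡ capᵖ d)
valᵖ-increment (leaf false) = (λ { refl → refl }) , λ ()
valᵖ-increment (leaf true)  = (λ ()) , λ { refl → refl , refl }
valᵖ-increment {suc d} (node l r) with increment l in el
... | l′ , false =
  (λ { refl → cong (_+ capᵖ d * valᵖ r) (proj₁ (valᵖ-increment l) el) }) , λ ()
... | l′ , true with increment r in er | proj₂ (valᵖ-increment l) el
... | r′ , false | e₁ , e₂ =
  (λ { refl → trans (cong₂ (λ x y → x + capᵖ d * y) e₁ (proj₁ (valᵖ-increment r) er))
     (trans (ℕ.*-suc (capᵖ d) (valᵖ r)) (cong (_+ capᵖ d * valᵖ r) (sym e₂))) }) , λ ()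
... | r′ , true | e₁ , e₂ = (λ ()) , λ { refl → carry (proj₂ (valᵖ-increment r) er) }
  where
  carry : valᵖ r′ ≡ 0 × suc (valᵖ r) ≡ capᵖ d → valᵖ l′ + capᵖ d * valᵖ r′ ≡ 0 × suc (valᵖ l + capᵖ d * valᵖ r) ≡ capᵖ d * capᵖ d
  carry (e₃ , e₄) = trans (cong₂ (λ x y → x + capᵖ d * y) e₁ e₃) (ℕ.*-zeroʳ (capᵖ d)) ,
    trans (cong (_+ capᵖ d * valᵖ r) e₂) (trans (sym (ℕ.*-suc (capᵖ d) (valᵖ r))) (cong (capᵖ d *_) e₄))

-- Mutual: an overflow at `a` would make `a` the largest number, contrary to the bound, and without
-- overflow `increment` adds one.
number-val : ∀ d a → a < capᵖ d → valᵖ (number d a) ≡ a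
no-overflow : ∀ d a → suc a < capᵖ d → proj₂ (increment (number d a)) ≡ false

no-overflow d a p with increment (number d a) in e
... | _ , false = refl
... | _ , true  = ⊥-elim (ℕ.<⇒≢ p (trans (cong suc (sym (number-val d a (ℕ.<-trans (ℕ.n<1+n a) p))))
                                      (proj₂ (proj₂ (valᵖ-increment (number d a)) e))))
number-val d zero    p = valᵖ-zero d
number-val d (suc a) p = trans (proj₁ (valᵖ-increment (number d a)) (cong (proj₁ (increment (number d a)) ,_) (no-overflow d a p)))
  (cong suc (number-val d a (ℕ.<-trans (ℕ.n<1+n a) p)))

diffᵖ : ∀ {d} → Perfect d → Perfect d → Diff
diffᵖ (leaf x)   (leaf y)     = bitDiff x y
diffᵖ (node l r) (node l′ r′) = diffᵖ l l′ ⊕ diffᵖ r r′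

diffᵖ-same : ∀ {d} (p : Perfect d) → diffᵖ p p ≡ same
diffᵖ-same (leaf false) = refl
diffᵖ-same (leaf true)  = refl
diffᵖ-same (node l r) rewrite diffᵖ-same l | diffᵖ-same r = refl

-- An overflow shows as an unresolved borrow, so the regular test of well-formedness passes exactly
-- when there was none.
diffᵖ-increment : ∀ {d} (p : Perfect d) →
  diffᵖ (proj₁ (increment p)) p ≡ (if proj₂ (increment p) then borrow else done)
diffᵖ-increment (leaf false) = refl
diffᵖ-increment (leaf true)  = refl
diffᵖ-increment (node l r) with increment l | diffᵖ-increment l
... | l′ , false | e rewrite e | diffᵖ-same r = refl
... | l′ , true  | e with increment r | diffᵖ-increment r
... | r′ , false | e′ rewrite e | e′ = refl
... | r′ , true  | e′ rewrite e | e′ = refl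

allZeroᵖ : ∀ {d} → Perfect d → Bool
allZeroᵖ (leaf x)   = not x
allZeroᵖ (node l r) = allZeroᵖ l ∧ allZeroᵖ r

allZeroᵖ-zero : ∀ d → allZeroᵖ (zeroᵖ d) ≡ true
allZeroᵖ-zero zero    = refl
allZeroᵖ-zero (suc d) rewrite allZeroᵖ-zero d = refl

bitAt : ∀ {d} → List Bool → Perfect d → Bool
bitAt _           (leaf x)   = x
bitAt []          (node _ _) = false
bitAt (false ∷ α) (node l _) = bitAt α l
bitAt (true ∷ α)  (node _ r) = bitAt α r

-- Data trees with prescribed numbers and a prescribed leftmost branch

Spine : Set
Spine = ℕ → Bool × Maybe Bool

plain : Spine
plain _ = false , nothing

dataTree : ∀ {d} → Perfect d → Perfect d → Perfect d → Perfect d → Spine → D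
dataTree (leaf a) (leaf a′) (leaf t) (leaf t′) σ = tip (mkDat a a′ t t′ (proj₁ (σ 0)) (proj₂ (σ 0)))
dataTree (node a₀ a₁) (node b₀ b₁) (node t₀ t₁) (node u₀ u₁) σ =
  -- Digits are read at the leaves; those of inner nodes are dummies, while flag and letter follow
  -- the spine.
  nd (mkDat false false false false (proj₁ (σ 0)) (proj₂ (σ 0)))
     (dataTree a₀ b₀ t₀ u₀ (σ ∘ suc)) (dataTree a₁ b₁ t₁ u₁ plain)

dataTree-differences : ∀ {d} (a a′ t t′ : Perfect d) σ → let x = dataTree a a′ t t′ σ in
  difference a-now a-before x ≡ diffᵖ a a′ × difference t-now t-before x ≡ diffᵖ t t′
  × allZero a-now x ≡ allZeroᵖ a × allZero t-now x ≡ allZeroᵖ t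
dataTree-differences (leaf _) (leaf _) (leaf _) (leaf _) σ = refl , refl , refl , refl
dataTree-differences (node a₀ a₁) (node b₀ b₁) (node t₀ t₁) (node u₀ u₁) σ
  with dataTree-differences a₀ b₀ t₀ u₀ (σ ∘ suc) | dataTree-differences a₁ b₁ t₁ u₁ plain
... | p₁ , p₂ , p₃ , p₄ | q₁ , q₂ , q₃ , q₄ = cong₂ _⊕_ p₁ q₁ , cong₂ _⊕_ p₂ q₂ , cong₂ _∧_ p₃ q₃ , cong₂ _∧_ p₄ q₄

dataTree-spine : ∀ {d} (a a′ t t′ : Perfect d) σ i → i ≤ d →
  flagAt i (dataTree a a′ t t′ σ) ≡ proj₁ (σ i) × letterAt i (dataTree a a′ t t′ σ) ≡ just (proj₂ (σ i))
dataTree-spine (leaf _) (leaf _) (leaf _) (leaf _) σ zero p = refl , refl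
dataTree-spine (node _ _) (node _ _) (node _ _) (node _ _) σ zero p = refl , refl
dataTree-spine (node a₀ _) (node b₀ _) (node t₀ _) (node u₀ _) σ (suc i) (s≤s p) =
  dataTree-spine a₀ b₀ t₀ u₀ (σ ∘ suc) i p

dataTree-inner : ∀ {d} (a a′ t t′ : Perfect d) σ α → length α < d →
  isInner (info (just α) (dataTree a a′ t t′ σ)) ≡ true
dataTree-inner (node _ _) (node _ _) (node _ _) (node _ _) σ [] p = refl
dataTree-inner (node a₀ _) (node b₀ _) (node t₀ _) (node u₀ _) σ (false ∷ α) (s≤s p)
  with info (just α) (dataTree a₀ b₀ t₀ u₀ (σ ∘ suc)) | dataTree-inner a₀ b₀ t₀ u₀ (σ ∘ suc) α p
... | just _ | e = e
dataTree-inner (node _ a₁) (node _ b₁) (node _ t₁) (node _ u₁) σ (true ∷ α) (s≤s p)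
  with info (just α) (dataTree a₁ b₁ t₁ u₁ plain) | dataTree-inner a₁ b₁ t₁ u₁ plain α p
... | just _ | e = e

dataTree-leaf : ∀ {d} (a a′ t t′ : Perfect d) σ α → length α ≡ d →
  Σ Dat λ x → Σ Bool λ f → info (just α) (dataTree a a′ t t′ σ) ≡ just (x , true , f)
  × a-now x ≡ bitAt α a × a-before x ≡ bitAt α a′ × t-now x ≡ bitAt α t × t-before x ≡ bitAt α t′
dataTree-leaf (leaf _) (leaf _) (leaf _) (leaf _) σ [] p = _ , _ , refl , refl , refl , refl , refl
dataTree-leaf (node a₀ _) (node b₀ _) (node t₀ _) (node u₀ _) σ (false ∷ α) p
  with dataTree-leaf a₀ b₀ t₀ u₀ (σ ∘ suc) α (ℕ.suc-injective p)
... | x , f , e , rest rewrite e = x , _ , refl , rest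
dataTree-leaf (node _ a₁) (node _ b₁) (node _ t₁) (node _ u₁) σ (true ∷ α) p
  with dataTree-leaf a₁ b₁ t₁ u₁ plain α (ℕ.suc-injective p)
... | x , f , e , rest rewrite e = x , _ , refl , rest

dataTree-flagged : ∀ {d} (a a′ t t′ : Perfect d) σ n j {q} → j ≤ n → n ≤ d → proj₁ (σ j) ≡ true →
  flagged (info (just (zeros n)) (dataTree a a′ t t′ σ) , q) ≡ true
dataTree-flagged (leaf _) (leaf _) (leaf _) (leaf _) σ zero zero _ _ e = e
dataTree-flagged (node _ _) (node _ _) (node _ _) (node _ _) σ zero zero _ _ e = e
dataTree-flagged (node a₀ _) (node b₀ _) (node t₀ _) (node u₀ _) σ (suc n) zero {q} p (s≤s p′) e
  with info (just (zeros n)) (dataTree a₀ b₀ t₀ u₀ (σ ∘ suc)) | info-exists a₀ b₀ t₀ u₀ (σ ∘ suc) n p′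
  where
  info-exists : ∀ {d} (a a′ t t′ : Perfect d) σ n → n ≤ d → isJust (info (just (zeros n)) (dataTree a a′ t t′ σ)) ≡ true
  info-exists (leaf _) (leaf _) (leaf _) (leaf _) σ zero p = refl
  info-exists (node _ _) (node _ _) (node _ _) (node _ _) σ zero p = refl
  info-exists (node a₀ _) (node b₀ _) (node t₀ _) (node u₀ _) σ (suc n) (s≤s p)
    with info (just (zeros n)) (dataTree a₀ b₀ t₀ u₀ (σ ∘ suc)) | info-exists a₀ b₀ t₀ u₀ (σ ∘ suc) n p
  ... | just _ | e = e
... | just (_ , _ , f) | _ rewrite e = refl
dataTree-flagged (node a₀ _) (node b₀ _) (node t₀ _) (node u₀ _) σ (suc n) (suc j) {q} (s≤s p) (s≤s p′) e
  with info (just (zeros n)) (dataTree a₀ b₀ t₀ u₀ (σ ∘ suc)) | dataTree-flagged a₀ b₀ t₀ u₀ (σ ∘ suc) n j {q} p p′ e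
... | just (_ , _ , true) | _ = ∨-true (proj₁ (σ 0))
  where
  ∨-true : ∀ x → x ∨ true ≡ true
  ∨-true false = refl
  ∨-true true  = refl

-- Existence of proof trees

private
  notBoth : ∀ {x y} → (x ≡ true → y ≡ true → ⊥) → not (x ∧ y) ≡ true
  notBoth {true}  {true}  n = ⊥-elim (n refl refl)
  notBoth {true}  {false} n = refl
  notBoth {false} {_}     n = refl

  notOne : ∀ {x} → (x ≡ true → ⊥) → not x ≡ true
  notOne {true}  n = ⊥-elim (n refl)
  notOne {false} n = refl

marks-none : ∀ d → marksOf (summary wellFormed nothing nothing d) ≡ just false
marks-none (tip x) = refl
marks-none (nd x l r) rewrite marks-none l | marks-none r = refl

marks-root : ∀ d → marksOf (summary wellFormed (just []) (just []) d) ≡ just true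
marks-root (tip x) = refl
marks-root (nd x l r) rewrite marks-none l | marks-none r = refl

summary-root-numbers : ∀ d → summary wellFormed (just []) (just []) d ≡
  ((difference a-now a-before d , difference t-now t-before d) , (allZero a-now d , allZero t-now d) , just true)
summary-root-numbers d with summary-numbers (just []) (just []) d
... | μ , e = trans e (cong (λ μ → _ , _ , μ) (trans (sym (cong marksOf e)) (marks-root d)))

capᵖ-power : ∀ d → capᵖ d ≡ 2 ^ (2 ^ d)
capᵖ-power zero    = refl
capᵖ-power (suc d) rewrite capᵖ-power d | ℕ.+-identityʳ (2 ^ d) = sym (ℕ.^-distribˡ-+-* 2 (2 ^ d) (2 ^ d))

module _ (𝒯 : Tiles) (w : List Bool) (m : ℕ) (tl : ℕ → ℕ → Fin (suc (Tiles.κ 𝒯))) where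
  open Tiles 𝒯

  record Consistent : Set where
    field
      con0 : ∀ t → ok0 (tl 0 t) ≡ true
      con1 : ∀ a → ok1 (row w a) (tl (suc a) 0) ≡ true
      conH : ∀ a t → okH (tl (suc a) (suc t)) (tl a (suc t)) ≡ true
      conV : ∀ a t → okV (tl (suc a) (suc t)) (tl (suc a) t) ≡ true

  private
    d = 2 ^ m
    C = capᵖ d

  claimSpine : ℕ → ℕ → Spine
  claimSpine a t i = (i ≡ᵇ toℕ (tl a t)) , row w (a + i)

  claimData : ℕ → ℕ → D
  -- For a vanishing coordinate the predecessor is a dummy 0; there, well-formedness tests for zero
  -- or leaves the coordinate free.
  claimData a t = dataTree (number d a) (number d (pred a)) (number d t) (number d (pred t)) (claimSpine a t)

  claim : ℕ → ℕ → Cl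
  claim zero    t       = c0 (claimData 0 t)
  claim (suc a) zero    = c1 (claimData (suc a) 0) (claim a 0)
  claim (suc a) (suc t) = c2 (claimData (suc a) (suc t)) (claim a (suc t)) (claim (suc a) t)

  dataOf-claim : ∀ a t → dataOf (claim a t) ≡ claimData a t
  dataOf-claim zero    t       = refl
  dataOf-claim (suc a) zero    = refl
  dataOf-claim (suc a) (suc t) = refl

  -- Coordinates only decrease towards the leaves, so the bounds at the root hold throughout; they
  -- exclude overflow of the digits.
  every-claim : ∀ {P₀ : D → Set} {P₁ : D → D → Set} {P₂ : D → D → D → Set} →
    (∀ t → P₀ (claimData 0 t)) →
    (∀ a → suc a < C → P₁ (claimData (suc a) 0) (claimData a 0)) →
    (∀ a t → suc a < C → suc t < C → P₂ (claimData (suc a) (suc t)) (claimData a (suc t)) (claimData (suc a) t)) →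
    ∀ a t → a < C → t < C → Every P₀ P₁ P₂ (claim a t)
  every-claim f g h zero t p q = f t
  every-claim {P₁ = P₁} f g h (suc a) zero p q =
    subst (P₁ (claimData (suc a) 0)) (sym (dataOf-claim a 0)) (g a p) , every-claim f g h a 0 (ℕ.<-trans (ℕ.n<1+n a) p) q
  every-claim {P₂ = P₂} f g h (suc a) (suc t) p q =
    subst (λ x → P₂ (claimData (suc a) (suc t)) x (dataOf (claim (suc a) t))) (sym (dataOf-claim a (suc t)))
      (subst (P₂ (claimData (suc a) (suc t)) (claimData a (suc t))) (sym (dataOf-claim (suc a) t)) (h a t p q)) ,
    every-claim f g h a (suc t) (ℕ.<-trans (ℕ.n<1+n a) p) q , every-claim f g h (suc a) t p (ℕ.<-trans (ℕ.n<1+n t) q)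

  every-data : ∀ {P : D → Set} → (∀ a t → P (claimData a t)) → ∀ a t → a < C → t < C → EveryData P (claim a t)
  every-data f = every-claim (λ t → f 0 t) (λ a _ → f (suc a) 0) (λ a t _ _ → f (suc a) (suc t))

  module _ (κ≤d : κ ≤ d) (w<d : length w < d) where

    flag-tile : ∀ a t (j : Fin (suc κ)) → flagAt (toℕ j) (claimData a t) ≡ true → j ≡ tl a t
    flag-tile a t j e = Fin.toℕ-injective (≡ᵇ-sound (toℕ j) (toℕ (tl a t))
      (trans (sym (proj₁ (dataTree-spine _ _ _ _ (claimSpine a t) (toℕ j) (ℕ.≤-trans (Fin.toℕ≤pred[n] j) κ≤d)))) e))

    claim-letter : ∀ a t i → i ≤ d → letterAt i (claimData a t) ≡ just (row w (a + i))
    claim-letter a t i p = proj₂ (dataTree-spine _ _ _ _ (claimSpine a t) i p)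

    module _ (con : Consistent) (a t : ℕ) (a<C : a < C) (t<C : t < C) (accepting : okR (tl a t) ≡ true) where
      open Consistent con

      private
        c = claim a t

        done-number : ∀ n → suc n < C → isDone (diffᵖ (number d (suc n)) (number d n)) ≡ true
        done-number n p rewrite diffᵖ-increment (number d n) | no-overflow d n p = refl

        by-marks : ∀ p i j → MarkHolds (propertyConditions p) (just (zeros i)) (just (zeros j)) c → c ⊨ p at i , j
        by-marks p i j h = holdsAt (from (mark-satisfies (propertyConditions p) (just (zeros i)) (just (zeros j)) c) h)

        clash : {b : Bool} → b ≡ true → b ≡ false → ⊥
        clash refl ()

      claim-wellFormed : Holds wellFormed (just []) (just []) c
      claim-wellFormed = every-claim on-edge on-bottom inside a t a<C t<C , refl
        where
        on-edge : ∀ t → Local.θ0 wellFormed (summary wellFormed (just []) (just []) (claimData 0 t)) ≡ true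
        on-edge t rewrite summary-root-numbers (claimData 0 t)
          with dataTree-differences (number d 0) (number d 0) (number d t) (number d (pred t)) (claimSpine 0 t)
        ... | _ , _ , e , _ rewrite e = allZeroᵖ-zero d
        on-bottom : ∀ a → suc a < C → Local.θ1 wellFormed (summary wellFormed (just []) (just []) (claimData (suc a) 0))
          (summary wellFormed (just []) (just []) (claimData a 0)) ≡ true
        on-bottom a p rewrite summary-root-numbers (claimData (suc a) 0)
          with dataTree-differences (number d (suc a)) (number d a) (number d 0) (number d 0) (claimSpine (suc a) 0)
        ... | e , _ , _ , e′ rewrite e | e′ = ∧-join (done-number a p) (allZeroᵖ-zero d)
        inside : ∀ a t → suc a < C → suc t < C →
          Local.θ2 wellFormed (summary wellFormed (just []) (just []) (claimData (suc a) (suc t)))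
            (summary wellFormed (just []) (just []) (claimData a (suc t)))
            (summary wellFormed (just []) (just []) (claimData (suc a) t)) ≡ true
        inside a t p q rewrite summary-root-numbers (claimData (suc a) (suc t))
          with dataTree-differences (number d (suc a)) (number d a) (number d (suc t)) (number d t) (claimSpine (suc a) (suc t))
        ... | e , e′ , _ rewrite e | e′ = ∧-join (done-number a p) (done-number t q)

      claim-deep : Deep d c
      claim-deep i p = every-data (λ a t → dataTree-inner _ _ _ _ (claimSpine a t) (zeros i)
        (subst (_< d) (sym (List.length-replicate i)) p)) a t a<C t<C

      claim-H : ∀ j j′ → okH j j′ ≡ false → c ⊨ clashH at (toℕ j) , (toℕ j′)
      claim-H j j′ e = by-marks clashH (toℕ j) (toℕ j′) (every-claim (λ _ → refl) (λ _ _ → refl)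
        (λ a t _ _ → notBoth λ x y → clash (subst (λ j → okH j _ ≡ true)
            (sym (flag-tile (suc a) (suc t) j (trans (sym (flag₁-at (toℕ j) (claimData (suc a) (suc t)))) x)))
            (subst (λ j → okH _ j ≡ true)
              (sym (flag-tile a (suc t) j′ (trans (sym (flag₂-at (toℕ j′) (claimData a (suc t)))) y))) (conH a t))) e)
        a t a<C t<C , refl)

      claim-V : ∀ j j′ → okV j j′ ≡ false → c ⊨ clashV at (toℕ j) , (toℕ j′)
      claim-V j j′ e = by-marks clashV (toℕ j) (toℕ j′) (every-claim (λ _ → refl) (λ _ _ → refl)
        (λ a t _ _ → notBoth λ x y → clash (subst (λ j → okV j _ ≡ true)
            (sym (flag-tile (suc a) (suc t) j (trans (sym (flag₁-at (toℕ j) (claimData (suc a) (suc t)))) x)))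
            (subst (λ j → okV _ j ≡ true)
              (sym (flag-tile (suc a) t j′ (trans (sym (flag₂-at (toℕ j′) (claimData (suc a) t))) y))) (conV a t))) e)
        a t a<C t<C , refl)

      claim-0 : ∀ j → ok0 j ≡ false → c ⊨ clash0 at (toℕ j) , 0
      claim-0 j e = by-marks clash0 (toℕ j) 0 (every-claim
        (λ t → notOne λ x → clash (subst (λ j → ok0 j ≡ true)
          (sym (flag-tile 0 t j (trans (sym (flag₁-at (toℕ j) (claimData 0 t))) x))) (con0 t)) e)
        (λ _ _ → refl) (λ _ _ _ _ → refl) a t a<C t<C , refl)

      claim-1 : ∀ s j → ok1 s j ≡ false → c ⊨ (clash1 s) at (toℕ j) , 0
      claim-1 s j e = by-marks (clash1 s) (toℕ j) 0 (every-claim (λ _ → refl)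
        (λ a _ → notBoth λ x y → clash (subst (λ s → ok1 s j ≡ true)
          (just-injective (trans (sym (claim-letter a 0 0 z≤n)) (trans (sym (rootLabel-at (claimData a 0))) (cong just (==-sound y)))))
          (subst (λ j → ok1 (row w (a + 0)) j ≡ true)
            (sym (flag-tile (suc a) 0 j (trans (sym (flag₁-at (toℕ j) (claimData (suc a) 0))) x)))
            (subst (λ i → ok1 (row w i) (tl (suc a) 0) ≡ true) (sym (ℕ.+-identityʳ a)) (con1 a)))) e)
        (λ _ _ _ _ → refl) a t a<C t<C , refl)

      claim-R : ∀ j → okR j ≡ false → c ⊨ clashR at (toℕ j) , 0
      claim-R j e = by-marks clashR (toℕ j) 0 (every-claim (λ _ → refl) (λ _ _ → refl) (λ _ _ _ _ → refl) a t a<C t<C ,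
        notOne λ x → clash (subst (λ j → okR j ≡ true)
          (sym (flag-tile a t j (trans (cong (flagAt (toℕ j)) (sym (dataOf-claim a t))) (trans (sym (flag₁-at (toℕ j) (dataOf c))) x))))
          accepting) e)

      claim-bounded : c ⊨ bounded at κ , 0
      claim-bounded = by-marks bounded κ 0
        (every-claim (λ t → ok 0 t) (λ a _ → ok (suc a) 0) (λ a t _ _ → ok (suc a) (suc t)) a t a<C t<C , refl)
        where
        ok : ∀ a t → flagged (markSum (just (zeros κ)) (just []) (claimData a t)) ≡ true
        ok a t = dataTree-flagged _ _ _ _ (claimSpine a t) κ (toℕ (tl a t)) (Fin.toℕ≤pred[n] (tl a t)) κ≤d (≡ᵇ-true (toℕ (tl a t)))

      private
        letter₁-claim : ∀ i a t → i ≤ d → letter₁ (markSum (just (zeros i)) (just (zeros (suc i))) (claimData a t)) ≡ just (row w (a + i))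
        letter₁-claim i a t p = trans (letter₁-at i (claimData a t)) (claim-letter a t i p)

        shift-claim : ∀ i → suc i ≤ d → c ⊨ shift at i , (suc i)
        shift-claim i p = by-marks shift i (suc i)
          (every-claim (λ _ → refl) (λ a _ → ok a 0 0) (λ a t _ _ → ok a (suc t) (suc t)) a t a<C t<C , refl)
          where
          ok : ∀ a t t′ → (letter₁ (markSum (just (zeros i)) (just (zeros (suc i))) (claimData (suc a) t)) ==
            letter₂ (markSum (just (zeros i)) (just (zeros (suc i))) (claimData a t′))) ≡ true
          ok a t t′ = ==-complete (trans (letter₁-claim i (suc a) t (ℕ.≤-trans (ℕ.n≤1+n i) p))
            (trans (cong (just ∘ row w) (sym (ℕ.+-suc a i))) (sym (claim-letter a t′ (suc i) p))))

        reads-claim : ∀ v i → (∀ k → row w (i + k) ≡ row v k) → i + length v < d → length w ≤ i + length v → Reads c i v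
        reads-claim [] i e p q = by-marks blank i (suc i)
          (every-claim (λ t → ok 0 t) (λ a _ → ok (suc a) 0) (λ a t _ _ → ok (suc a) (suc t)) a t a<C t<C , refl)
          where
          ok : ∀ a t → (letter₁ (markSum (just (zeros i)) (just (zeros (suc i))) (claimData a t)) == just nothing) ≡ true
          ok a t = ==-complete (trans (letter₁-claim i a t (ℕ.<⇒≤ (ℕ.≤-<-trans (ℕ.m≤m+n i 0) p)))
            (cong just (row-beyond w (a + i) (ℕ.≤-trans q (ℕ.≤-trans (ℕ.≤-reflexive (ℕ.+-identityʳ i)) (ℕ.m≤n+m i a))))))
        reads-claim (b ∷ v) i e p q = shift-claim i i<d ,
          by-marks (letterIs b) i (suc i) (every-claim (λ t → ==-complete (trans (letter₁-claim i 0 t (ℕ.<⇒≤ i<d))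
            (cong just (trans (cong (row w) (sym (ℕ.+-identityʳ i))) (e 0))))) (λ _ _ → refl) (λ _ _ _ _ → refl) a t a<C t<C , refl) ,
          reads-claim v (suc i) (λ k → trans (cong (row w) (sym (ℕ.+-suc i k))) (e (suc k)))
            (subst (_< d) (ℕ.+-suc i (length v)) p) (subst (length w ≤_) (ℕ.+-suc i (length v)) q)
          where
          i<d : i < d
          i<d = ℕ.≤-<-trans (ℕ.m≤m+n i _) p

        claim-inner : ∀ α → length α < d → satisfies (property inner) (embT (just α) (just []) c) ≡ true
        claim-inner α p = from (mark-satisfies (propertyConditions inner) (just α) (just []) c)
          (every-data (λ a t → dataTree-inner _ _ _ _ (claimSpine a t) α p) a t a<C t<C , refl)

        claim-match : ∀ α → length α ≡ d → satisfies (property match) (embT (just α) (just []) c) ≡ true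
        claim-match α p = from (mark-satisfies (propertyConditions match) (just α) (just []) c)
          (every-claim (λ t → on-edge t) (λ a _ → left-ok a 0) (λ a t _ _ → ∧-join (left-ok a (suc t)) (lower-ok a t)) a t a<C t<C , refl)
          where
          σ = markSum (just α) (just [])
          on-edge : ∀ t → isJust (leafLabel (σ (claimData 0 t))) ≡ true
          on-edge t with dataTree-leaf (number d 0) (number d 0) (number d t) (number d (pred t)) (claimSpine 0 t) α p
          ... | _ , _ , e , _ rewrite e = refl
          left-ok : ∀ a t → sameBits leftBits (leafLabel (σ (claimData (suc a) t))) (leafLabel (σ (claimData a t))) ≡ true
          left-ok a t
            with dataTree-leaf (number d (suc a)) (number d a) (number d t) (number d (pred t)) (claimSpine (suc a) t) α p
               | dataTree-leaf (number d a) (number d (pred a)) (number d t) (number d (pred t)) (claimSpine a t) α p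
          ... | _ , _ , e , _ , x , y , _ | _ , _ , e′ , x′ , _ , y′ , _ rewrite e | e′ =
            ==-complete (cong₂ _,_ (trans x (sym x′)) (trans y (sym y′)))
          lower-ok : ∀ a t → sameBits lowerBits (leafLabel (σ (claimData (suc a) (suc t)))) (leafLabel (σ (claimData (suc a) t))) ≡ true
          lower-ok a t
            with dataTree-leaf (number d (suc a)) (number d a) (number d (suc t)) (number d t) (claimSpine (suc a) (suc t)) α p
               | dataTree-leaf (number d (suc a)) (number d a) (number d t) (number d (pred t)) (claimSpine (suc a) t) α p
          ... | _ , _ , e , x , _ , _ , y | _ , _ , e′ , x′ , _ , y′ , _ rewrite e | e′ =
            ==-complete (cong₂ _,_ (trans x (sym x′)) (trans y (sym y′)))

        snoc-length : ∀ (α : List Bool) b n → length α + suc n ≡ d → length (α ++ [ b ]) + n ≡ d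
        snoc-length α b n p = trans (cong (_+ n) (List.length-++ α)) (trans (ℕ.+-assoc (length α) 1 n) p)

        -- Above depth `d` every node is inner, so the walk cannot rest and descends at each step.
        -- After `d` steps all marks are at leaves.
        claim-matches : ∀ n α → length α + n ≡ d → ∀ t → Iter n (embT (just α) (just []) c) t →
          satisfies (property match) t ≡ true
        claim-matches zero α p t refl = claim-match α (trans (sym (ℕ.+-identityʳ _)) p)
        claim-matches (suc n) α p t (u , inj₁ r , it) rewrite moved false false (just α) (just []) c u r =
          claim-matches n (α ++ [ false ]) (snoc-length α false n p) t it
        claim-matches (suc n) α p t (u , inj₂ (inj₁ r) , it) rewrite moved false true (just α) (just []) c u r =
          claim-matches n (α ++ [ true ]) (snoc-length α true n p) t it
        claim-matches (suc n) α p t (u , inj₂ (inj₂ r) , it) =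
          ⊥-elim (not-true (proj₂ (to (test-related (property inner) not (embT (just α) (just []) c) u) r))
            (claim-inner α (subst (length α <_) p (ℕ.m<m+n (length α) (s≤s z≤n)))))

      claim-good : Good 𝒯 w m c
      claim-good = record
        { wf = claim-wellFormed ; good-H = claim-H ; good-V = claim-V ; good-0 = claim-0 ; good-R = claim-R ; good-1 = claim-1
        ; bnd = claim-bounded ; reads = reads-claim w 0 (λ _ → refl) w<d ℕ.≤-refl ; matches = claim-matches d [] refl }

-- Turing machine computations as tilings

instance
  finite-Ctrl : ∀ {n} → Finite (Ctrl n)
  finite-Ctrl {n} = retract {B = Bool ⊎ Fin n} (λ { (halt b) → inj₁ b ; (run q) → inj₂ q })
    (λ { (inj₁ b) → halt b ; (inj₂ q) → run q }) (λ { (halt _) → refl ; (run _) → refl }) finite-⊎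

runFor-+ : ∀ M m n c → runFor M (m + n) c ≡ runFor M n (runFor M m c)
runFor-+ M zero    n c = refl
runFor-+ M (suc m) n c = runFor-+ M m n (step M c)

runFor-step : ∀ M n c → runFor M n (step M c) ≡ step M (runFor M n c)
runFor-step M zero    c = refl
runFor-step M (suc n) c = runFor-step M n (step M c)

module _ (M : TM) where
  private
    nq = TM.nQ M
    Sym = Fin (3 + TM.nS M)

  -- `wall` fills the space to the left of the shifted tape; `raw` is an input letter in row 0,
  -- before the head is placed.
  data Content : Set where
    wall : Content
    raw  : Maybe Bool → Content
    cell : Sym → Maybe (Ctrl nq) → Content

  letterSym : Maybe Bool → Sym
  letterSym nothing  = fz
  letterSym (just b) = bitSym b

  -- A left move in cell 0 leaves the head there; cell 0 is recognised by the wall on its left.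
  stayHead : Defs.Move → Content → Ctrl nq → Maybe (Ctrl nq)
  stayHead stay  _    c = just c
  stayHead left  wall c = just c
  stayHead left  _    c = nothing
  stayHead right _    c = nothing

  goesRight goesLeft : Ctrl nq × Sym × Defs.Move → Maybe (Ctrl nq)
  goesRight (c , _ , right) = just c
  goesRight _               = nothing
  goesLeft (c , _ , left) = just c
  goesLeft _              = nothing

  fromLeft fromRight : Content → Maybe (Ctrl nq)
  fromLeft (cell x (just (run q))) = goesRight (TM.δ M q x)
  fromLeft _                       = nothing
  fromRight (cell x (just (run q))) = goesLeft (TM.δ M q x)
  fromRight _                       = nothing

  written : Content → Ctrl nq × Sym × Defs.Move → Content
  written p (c , y , mv) = cell y (stayHead mv p c)

  next : Content → Content → Content → Content
  next p    wall                     r = wall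
  -- Next to the wall is cell 0, where the machine starts.
  next wall (raw s)                  r = cell (letterSym s) (just (TM.start M))
  next _    (raw s)                  r = cell (letterSym s) nothing
  next p    (cell x (just (halt b))) r = cell x (just (halt b))
  next p    (cell x (just (run q)))  r = written p (TM.δ M q x)
  next p    (cell x nothing)         r = cell x (fromLeft p <∣> fromRight r)

  cellAt : Config M → ℕ → Content
  cellAt c i = cell (tape c i) (if i ≡ᵇ head c then just (ctrl c) else nothing)

  leftOf : Config M → ℕ → Content
  leftOf c zero    = wall
  leftOf c (suc i) = cellAt c i

  private
    halted : ∀ t h {b} i → fromLeft (leftOf (config (halt b) t h) i) ≡ nothing
    halted t h zero = refl
    halted t h (suc i) with i ≡ᵇ h
    ... | true  = refl
    ... | false = refl

    halted′ : ∀ t h {b} i → fromRight (cellAt (config (halt b) t h) i) ≡ nothing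
    halted′ t h i with i ≡ᵇ h
    ... | true  = refl
    ... | false = refl

    away : ∀ q t h i → i ≢ suc h → fromLeft (leftOf (config (run q) t h) i) ≡ nothing
    away q t h zero    ne = refl
    away q t h (suc i) ne rewrite ≡ᵇ-false {i} {h} (ne ∘ cong suc) = refl

    away′ : ∀ q t h i → i ≢ h → fromRight (cellAt (config (run q) t h) i) ≡ nothing
    away′ q t h i ne rewrite ≡ᵇ-false ne = refl

    pred≤ : ∀ h → moveHead left h ≤ h
    pred≤ zero    = z≤n
    pred≤ (suc h) = ℕ.n≤1+n h

  -- A head arrives in cell `i` only from `i` or a neighbouring cell, so the cases are the head at
  -- `i`, at `i - 1`, at `i + 1` and elsewhere; left moves at cell 0 need separate care.
  next-step : ∀ c i → next (leftOf c i) (cellAt c i) (cellAt c (suc i)) ≡ cellAt (step M c) i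
  next-step (config (halt b) t h) i with i ≡ᵇ h in e
  ... | true  = refl
  ... | false rewrite halted t h {b} i | halted′ t h {b} (suc i) = refl
  next-step (config (run q) t h) i with i ℕ.≟ h
  next-step (config (run q) t h) .h | yes refl rewrite ≡ᵇ-true h with TM.δ M q (t h)
  ... | c , y , stay  rewrite ≡ᵇ-true h = refl
  ... | c , y , right rewrite ≡ᵇ-false {h} {suc h} (ℕ.<⇒≢ ℕ.≤-refl) = refl
  next-step (config (run q) t zero) .zero | yes refl | c , y , left = refl
  next-step (config (run q) t (suc h)) .(suc h) | yes refl | c , y , left
    rewrite ≡ᵇ-false {suc h} {h} (ℕ.>⇒≢ ℕ.≤-refl) = refl
  next-step (config (run q) t h) i | no ne with i ℕ.≟ suc h
  next-step (config (run q) t h) .(suc h) | no ne | yes refl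
    rewrite ≡ᵇ-false ne | ≡ᵇ-true h | away′ q t h (suc (suc h)) (ℕ.>⇒≢ (ℕ.m<n⇒m<1+n ℕ.≤-refl)) with TM.δ M q (t h)
  ... | c , y , stay  rewrite ≡ᵇ-false ne = refl
  ... | c , y , right rewrite ≡ᵇ-true h = refl
  ... | c , y , left  rewrite ≡ᵇ-false {suc h} {moveHead left h} (ℕ.>⇒≢ (s≤s (pred≤ h))) = refl
  next-step (config (run q) t h) i | no ne | no ne′
    rewrite ≡ᵇ-false ne | away q t h i ne′ with suc i ℕ.≟ h
  next-step (config (run q) t .(suc i)) i | no ne | no ne′ | yes refl
    rewrite ≡ᵇ-true i with TM.δ M q (t (suc i))
  ... | c , y , stay  rewrite ≡ᵇ-false ne = refl
  ... | c , y , right rewrite ≡ᵇ-false ne′ = refl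
  ... | c , y , left  rewrite ≡ᵇ-true i = refl
  next-step (config (run q) t h) i | no ne | no ne′ | no ne″
    rewrite away′ q t h (suc i) ne″ with TM.δ M q (t h)
  ... | c , y , stay  rewrite ≡ᵇ-false ne = refl
  ... | c , y , right rewrite ≡ᵇ-false ne′ = refl
  next-step (config (run q) t zero) i | no ne | no ne′ | no ne″ | c , y , left rewrite ≡ᵇ-false ne = refl
  next-step (config (run q) t (suc h)) i | no ne | no ne′ | no ne″ | c , y , left
    rewrite ≡ᵇ-false {i} {h} (ne″ ∘ cong suc) = refl

  -- At position `(a , t)`, `tri` holds the contents at `a - 2`, `a - 1` and `a` in row `t - 1`. The
  -- first two are also the last two of the left tile, and the third is the output of the tile
  -- below.
  data Inner : Set where
    ini : Maybe Bool → Inner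
    tri : Content → Content → Content → Inner

  -- The absent value is the tile of the left edge.
  Tile : Set
  Tile = Maybe Inner

  opaque
    Content-finite : Finite Content
    Content-finite = retract {B = Maybe (Maybe Bool ⊎ (Sym × Maybe (Ctrl nq)))}
      (λ { wall → nothing ; (raw s) → just (inj₁ s) ; (cell x c) → just (inj₂ (x , c)) })
      (λ { nothing → wall ; (just (inj₁ s)) → raw s ; (just (inj₂ (x , c))) → cell x c })
      (λ { wall → refl ; (raw s) → refl ; (cell x c) → refl }) finite-Maybe

    Inner-finite : Finite Inner
    Inner-finite = retract {B = Maybe Bool ⊎ (Content × Content × Content)}
      (λ { (ini s) → inj₁ s ; (tri p q r) → inj₂ (p , q , r) })
      (λ { (inj₁ s) → ini s ; (inj₂ (p , q , r)) → tri p q r })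
      (λ { (ini s) → refl ; (tri p q r) → refl })
      (finite-⊎ ⦃ finite-Maybe ⦄ ⦃ finite-× ⦃ Content-finite ⦄ ⦃ finite-× ⦃ Content-finite ⦄ ⦃ Content-finite ⦄ ⦄ ⦄)

  private instance
    finite-Content : Finite Content
    finite-Content = Content-finite

    finite-Inner : Finite Inner
    finite-Inner = Inner-finite

  κᴹ : ℕ
  κᴹ = size {Inner}

  encTile : Tile → Fin (suc κᴹ)
  encTile = enc

  decTile : Fin (suc κᴹ) → Tile
  decTile = dec

  decTile-enc : ∀ x → decTile (encTile x) ≡ x
  decTile-enc = dec-enc

  out second third : Tile → Content
  out nothing             = wall
  out (just (ini s))      = raw s
  out (just (tri p q r))  = next p q r
  second (just (tri p q r)) = q
  second _                  = wall
  third (just (tri p q r)) = r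
  third _                  = wall

  fitsH fitsV : Tile → Tile → Bool
  fitsH (just (tri p q r)) l = (p == second l) ∧ (q == third l)
  fitsH _                  l = false
  fitsV (just (tri p q r)) b = r == out b
  fitsV _                  b = false

  acceptsTile : Tile → Bool
  acceptsTile (just (tri p q (cell x (just (halt true))))) = true
  acceptsTile _                                            = false

  tilesOf : Tiles
  tilesOf = record
    { κ = κᴹ
    -- Surplus codes are rejected; otherwise the tile number would not be determined by the tile.
    ; okH = λ j j′ → (j == encTile (decTile j)) ∧ fitsH (decTile j) (decTile j′)
    ; okV = λ j j′ → (j == encTile (decTile j)) ∧ fitsV (decTile j) (decTile j′)
    ; ok0 = λ j → j == encTile nothing
    ; okR = λ j → acceptsTile (decTile j)
    ; ok1 = λ s j → j == encTile (just (ini s)) }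

  -- Correctness of the tiles

  module _ (w : List Bool) where

    tile : ℕ → ℕ → Tile
    tile zero    t       = nothing
    tile (suc a) zero    = just (ini (row w a))
    tile (suc a) (suc t) = just (tri (second (tile a (suc t))) (third (tile a (suc t))) (out (tile (suc a) t)))

    tl : ℕ → ℕ → Fin (suc κᴹ)
    tl a t = encTile (tile a t)

    tl-determined : Determined tilesOf w tl
    tl-determined = record
      { at-edge = λ j t e → ==-sound e ; at-bottom = λ j a e → ==-sound e ; inside = inside }
      where
      fits : ∀ x a t → fitsH x (tile a (suc t)) ≡ true → fitsV x (tile (suc a) t) ≡ true → x ≡ tile (suc a) (suc t)
      fits (just (tri p q r)) a t h v with ∧-split {p == second (tile a (suc t))} h
      ... | e , e′ with ==-sound e | ==-sound e′ | ==-sound v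
      ... | refl | refl | refl = refl
      inside : ∀ j a t → Tiles.okH tilesOf j (tl a (suc t)) ≡ true → Tiles.okV tilesOf j (tl (suc a) t) ≡ true →
        j ≡ tl (suc a) (suc t)
      inside j a t h v with ∧-split {j == encTile (decTile j)} h | ∧-split {j == encTile (decTile j)} v
      ... | e , h′ | _ , v′ = trans (==-sound e) (cong encTile (fits (decTile j) a t
        (subst (λ x → fitsH (decTile j) x ≡ true) (decTile-enc (tile a (suc t))) h′)
        (subst (λ x → fitsV (decTile j) x ≡ true) (decTile-enc (tile (suc a) t)) v′)))

    tl-consistent : ∀ m → Consistent tilesOf w m tl
    tl-consistent m = record
      { con0 = λ t → ==-refl (encTile nothing)
      ; con1 = λ a → ==-refl (encTile (just (ini (row w a))))
      ; conH = λ a t → ∧-join (canonical (tile (suc a) (suc t)))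
          (trans (cong₂ fitsH (decTile-enc (tile (suc a) (suc t))) (decTile-enc (tile a (suc t))))
            (∧-join (==-refl (second (tile a (suc t)))) (==-refl (third (tile a (suc t))))))
      ; conV = λ a t → ∧-join (canonical (tile (suc a) (suc t)))
          (trans (cong₂ fitsV (decTile-enc (tile (suc a) (suc t))) (decTile-enc (tile (suc a) t)))
            (==-refl (out (tile (suc a) t)))) }
      where
      canonical : ∀ x → (encTile x == encTile (decTile (encTile x))) ≡ true
      canonical x = ==-complete (cong encTile (sym (decTile-enc x)))

    private
      conf : ℕ → Config M
      conf n = runFor M n (initConfig M w)

      conf-suc : ∀ n → conf (suc n) ≡ step M (conf n)
      conf-suc n = runFor-step M n (initConfig M w)

    -- Row t + 1 is the configuration after t steps, shifted by t + 2 to the right.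
    content : ℕ → ℕ → Content
    content a t = out (tile a t)

    content-left : ℕ → ℕ → Content
    content-left zero    t = wall
    content-left (suc a) t = content a t

    third-content : ∀ a t → third (tile a (suc t)) ≡ content a t
    third-content zero    t = refl
    third-content (suc a) t = refl

    second-content : ∀ a t → second (tile a (suc t)) ≡ content-left a t
    second-content zero    t = refl
    second-content (suc a) t = third-content a t

    content-suc : ∀ a t → content (suc a) (suc t) ≡ next (content-left a t) (content a t) (content (suc a) t)
    content-suc a t rewrite second-content a t | third-content a t = refl

    -- The middle of the window produces the output, so the wall, like everything else, moves one
    -- position to the right in each row.
    content-wall : ∀ t a → a ≤ t → content a t ≡ wall
    content-wall t       zero    p       = refl
    content-wall (suc t) (suc a) (s≤s p) = trans (content-suc a t) (cong (λ x → next (content-left a t) x (content (suc a) t)) (content-wall t a p))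

    letterSym-row : ∀ v i → letterSym (row v i) ≡ inputTape v i
    letterSym-row []      i       = refl
    letterSym-row (b ∷ v) zero    = refl
    letterSym-row (b ∷ v) (suc i) = letterSym-row v i

    content-cell : ∀ t i → content (suc (suc t + i)) (suc t) ≡ cellAt (conf t) i
    content-cell zero zero = cong (λ x → cell x (just (TM.start M))) (letterSym-row w 0)
    content-cell zero (suc i) = cong (λ x → cell x nothing) (letterSym-row w (suc i))
    content-cell (suc t) i = trans (content-suc (suc (suc t + i)) (suc t))
      (trans (lemma (content-left′ i) (content-cell t i) content-right)
        (trans (next-step (conf t) i) (cong (λ c → cellAt c i) (sym (conf-suc t)))))
      where
      lemma : ∀ {p p′ q q′ r r′} → p ≡ p′ → q ≡ q′ → r ≡ r′ → next p q r ≡ next p′ q′ r′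
      lemma refl refl refl = refl
      content-left′ : ∀ i → content (suc t + i) (suc t) ≡ leftOf (conf t) i
      content-left′ zero    = content-wall (suc t) (suc t + 0) (ℕ.≤-reflexive (ℕ.+-identityʳ (suc t)))
      content-left′ (suc k) = trans (cong (λ a → content a (suc t)) (ℕ.+-suc (suc t) k)) (content-cell t k)
      content-right : content (suc (suc (suc t + i))) (suc t) ≡ cellAt (conf t) (suc i)
      content-right = trans (cong (λ a → content (suc a) (suc t)) (sym (ℕ.+-suc (suc t) i))) (content-cell t (suc i))

    -- Rows 0 and 1 never accept, and the wall carries no head, so what lies under an accepting tile
    -- is a cell of an actual configuration.
    accepted-tile : ∀ a t → Tiles.okR tilesOf (tl a t) ≡ true → ∃ λ n → ctrl (conf n) ≡ halt true
    accepted-tile a t e = go a t (trans (cong acceptsTile (sym (decTile-enc (tile a t)))) e)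
      where
      found : ∀ c i x → cellAt c i ≡ cell x (just (halt true)) → ctrl c ≡ halt true
      found c i x e with i ≡ᵇ head c
      found c i x refl | true = refl
      accepts-cell : ∀ p q r → acceptsTile (just (tri p q r)) ≡ true → ∃ λ x → r ≡ cell x (just (halt true))
      accepts-cell p q (cell x (just (halt true))) e = x , refl
      go : ∀ a t → acceptsTile (tile a t) ≡ true → ∃ λ n → ctrl (conf n) ≡ halt true
      go (suc a) (suc zero) e with accepts-cell (second (tile a 1)) (third (tile a 1)) (content (suc a) 0) e
      ... | _ , ()
      go (suc a) (suc (suc t)) e with accepts-cell _ _ (content (suc a) (suc t)) e | ℕ.≤-total (suc a) (suc t)
      ... | x , e′ | inj₁ p = contradiction (trans (sym e′) (content-wall (suc t) (suc a) p)) λ ()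
      ... | x , e′ | inj₂ p = t , (found (conf t) (a ∸ suc t) x (trans (sym (content-cell t (a ∸ suc t)))
          (trans (cong (λ b → content (suc b) (suc t)) (ℕ.m+[n∸m]≡n sa)) e′)))
        where
        sa : suc t ≤ a
        sa with ℕ.m≤n⇒m<n∨m≡n p
        ... | inj₁ lt = ℕ.≤-pred lt
        ... | inj₂ refl = contradiction (trans (sym e′) (content-wall (suc t) (suc a) ℕ.≤-refl)) λ ()

    head-bound : ∀ n → head (conf n) ≤ n
    head-bound zero = z≤n
    head-bound (suc n) rewrite conf-suc n = ℕ.≤-trans (head-step (conf n)) (s≤s (head-bound n))
      where
      head-move : ∀ mv h → moveHead mv h ≤ suc h
      head-move left  zero    = z≤n
      head-move left  (suc h) = ℕ.≤-trans (ℕ.n≤1+n h) (ℕ.n≤1+n (suc h))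
      head-move right h       = ℕ.≤-refl
      head-move stay  h       = ℕ.n≤1+n h
      head-step : ∀ c → head (step M c) ≤ suc (head c)
      head-step (config (halt b) t h) = ℕ.n≤1+n h
      head-step (config (run q) t h) with TM.δ M q (t h)
      ... | c , y , mv = head-move mv h

    -- The accepting cell appears in row `n + 1`, and `okR` inspects the third component of a tile,
    -- which is the content below it; hence the tile in row `n + 2`.
    tile-accepted : ∀ n → ctrl (conf n) ≡ halt true → Tiles.okR tilesOf (tl (suc (suc n + head (conf n))) (suc (suc n))) ≡ true
    tile-accepted n e = trans (cong acceptsTile (decTile-enc (tile (suc (suc n + head (conf n))) (suc (suc n)))))
      (lemma _ _ _ (trans (content-cell n (head (conf n))) cell≡))
      where
      cell≡ : cellAt (conf n) (head (conf n)) ≡ cell (tape (conf n) (head (conf n))) (just (halt true))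
      cell≡ rewrite ≡ᵇ-true (head (conf n)) | e = refl
      lemma : ∀ p q r {x} → r ≡ cell x (just (halt true)) → acceptsTile (just (tri p q r)) ≡ true
      lemma p q r refl = refl

-- Unique readability of the encoding

tok-cancel : ∀ j k s s′ → tok j ++ s ≡ tok k ++ s′ → j ≡ k × s ≡ s′
tok-cancel zero    zero    s s′ refl = refl , refl
tok-cancel (suc j) (suc k) s s′ e with tok-cancel j k s s′ (List.∷-injectiveʳ e)
... | refl , e′ = refl , e′

encVars-cancel : ∀ {n} (xs ys : Vec ℕ n) s s′ → encVars xs ++ s ≡ encVars ys ++ s′ → xs ≡ ys × s ≡ s′
encVars-cancel []ᵛ []ᵛ s s′ e = refl , e
encVars-cancel (x ∷ᵛ xs) (y ∷ᵛ ys) s s′ e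
  with tok-cancel x y (encVars xs ++ s) (encVars ys ++ s′)
         (trans (sym (List.++-assoc (tok x) (encVars xs) s)) (trans e (List.++-assoc (tok y) (encVars ys) s′)))
... | refl , e′ with encVars-cancel xs ys s s′ e′
... | refl , e″ = refl , e″

module _ {r : ℕ} {ar : Fin r → ℕ} where

  tag : Formula ar → ℕ
  tag (Eq _ _)  = 0
  tag (Not _)   = 1
  tag (And _ _) = 2
  tag (Or _ _)  = 3
  tag (Ex _ _)  = 4
  tag (Fa _ _)  = 5
  tag (Rel i _) = 6 + toℕ i

  body : Formula ar → List Bool
  body (Eq x y)   = tok x ++ tok y
  body (Not φ)    = encode φ
  body (And φ ψ)  = encode φ ++ encode ψ
  body (Or φ ψ)   = encode φ ++ encode ψ
  body (Ex x φ)   = tok x ++ encode φ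
  body (Fa x φ)   = tok x ++ encode φ
  body (Rel i xs) = encVars xs

  encode-body : ∀ φ → encode φ ≡ tok (tag φ) ++ body φ
  encode-body (Eq _ _)  = refl
  encode-body (Not _)   = refl
  encode-body (And _ _) = refl
  encode-body (Or _ _)  = refl
  encode-body (Ex _ _)  = refl
  encode-body (Fa _ _)  = refl
  encode-body (Rel _ _) = refl

  private
    reassoc : ∀ (xs ys xs′ ys′ : List Bool) {s s′} → (xs ++ ys) ++ s ≡ (xs′ ++ ys′) ++ s′ → xs ++ (ys ++ s) ≡ xs′ ++ (ys′ ++ s′)
    reassoc xs ys xs′ ys′ {s} {s′} e = trans (sym (List.++-assoc xs ys s)) (trans e (List.++-assoc xs′ ys′ s′))

  -- Arbitrary suffixes are what the induction through binary connectives requires, where the code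
  -- of one formula is followed by that of another.
  encode-cancel : ∀ φ ψ s s′ → encode φ ++ s ≡ encode ψ ++ s′ → φ ≡ ψ × s ≡ s′
  body-cancel : ∀ φ ψ s s′ → tag φ ≡ tag ψ → body φ ++ s ≡ body ψ ++ s′ → φ ≡ ψ × s ≡ s′

  encode-cancel φ ψ s s′ e =
    let t , e′ = tok-cancel (tag φ) (tag ψ) (body φ ++ s) (body ψ ++ s′) (reassoc (tok (tag φ)) (body φ) (tok (tag ψ)) (body ψ)
          (trans (cong (_++ s) (sym (encode-body φ))) (trans e (cong (_++ s′) (encode-body ψ)))))
    in body-cancel φ ψ s s′ t e′

  body-cancel (Eq x y) (Eq x′ y′) s s′ refl e with tok-cancel x x′ _ _ (reassoc (tok x) (tok y) (tok x′) (tok y′) e)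
  ... | refl , e′ with tok-cancel y y′ s s′ e′
  ... | refl , e″ = refl , e″
  body-cancel (Not φ) (Not ψ) s s′ refl e with encode-cancel φ ψ s s′ e
  ... | refl , e′ = refl , e′
  body-cancel (And φ φ′) (And ψ ψ′) s s′ refl e with encode-cancel φ ψ _ _ (reassoc (encode φ) (encode φ′) (encode ψ) (encode ψ′) e)
  ... | refl , e′ with encode-cancel φ′ ψ′ s s′ e′
  ... | refl , e″ = refl , e″
  body-cancel (Or φ φ′) (Or ψ ψ′) s s′ refl e with encode-cancel φ ψ _ _ (reassoc (encode φ) (encode φ′) (encode ψ) (encode ψ′) e)
  ... | refl , e′ with encode-cancel φ′ ψ′ s s′ e′
  ... | refl , e″ = refl , e″
  body-cancel (Ex x φ) (Ex y ψ) s s′ refl e with tok-cancel x y _ _ (reassoc (tok x) (encode φ) (tok y) (encode ψ) e)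
  ... | refl , e′ with encode-cancel φ ψ s s′ e′
  ... | refl , e″ = refl , e″
  body-cancel (Fa x φ) (Fa y ψ) s s′ refl e with tok-cancel x y _ _ (reassoc (tok x) (encode φ) (tok y) (encode ψ) e)
  ... | refl , e′ with encode-cancel φ ψ s s′ e′
  ... | refl , e″ = refl , e″
  body-cancel (Rel i xs) (Rel j ys) s s′ t e with Fin.toℕ-injective {i = i} {j} (ℕ.+-cancelˡ-≡ 6 (toℕ i) (toℕ j) t)
  ... | refl with encVars-cancel xs ys s s′ e
  ... | refl , e′ = refl , e′

  -- Membership in `FOTh` provides some formula with the given code; this identifies it with the
  -- constructed sentence.
  encode-injective : ∀ φ ψ → encode φ ≡ encode ψ → φ ≡ ψ
  encode-injective φ ψ e = proj₁ (encode-cancel φ ψ [] [] (cong (_++ []) e))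

-- The shape of the encoding

-- Reproduces the right-nested form to which `encode` unfolds, whereas the writer needs the text of
-- each round as one block.
appendAll : List (List Bool) → List Bool → List Bool
appendAll ss s = List.foldr _++_ s ss

appendAll-concat : ∀ ss s → appendAll ss s ≡ List.concat ss ++ s
appendAll-concat []       s = refl
appendAll-concat (x ∷ ss) s = trans (cong (x ++_) (appendAll-concat ss s)) (sym (List.++-assoc x (List.concat ss) s))

repeat : ℕ → List Bool → List Bool
repeat zero    s = []
repeat (suc n) s = s ++ repeat n s

repeat-+ : ∀ m n s → repeat (m + n) s ≡ repeat m s ++ repeat n s
repeat-+ zero    n s = refl
repeat-+ (suc m) n s = trans (cong (s ++_) (repeat-+ m n s)) (sym (List.++-assoc s (repeat m s) (repeat n s)))

letterPieces : Bool → List (List Bool)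
letterPieces b = tok 2 ∷ encode (is shift 1) ∷ tok 2 ∷ encode (is (letterIs b) 1) ∷ tok 4 ∷ tok 0 ∷ tok 2
  ∷ encode (rl (moves false false) 1 0) ∷ tok 4 ∷ tok 1 ∷ tok 2 ∷ encode (rl (moves true false) 0 1) ∷ []

letterCode : Bool → List Bool
letterCode b = List.concat (letterPieces b)

encode-reading : ∀ w → encode (reading w) ≡ List.concatMap letterCode w ++ encode (is blank 1)
encode-reading []      = refl
encode-reading (b ∷ w) = begin
  appendAll (letterPieces b) (encode (reading w))                    ≡⟨ appendAll-concat (letterPieces b) _ ⟩
  letterCode b ++ encode (reading w)                                 ≡⟨ cong (letterCode b ++_) (encode-reading w) ⟩
  letterCode b ++ (List.concatMap letterCode w ++ encode (is blank 1)) ≡⟨ List.++-assoc (letterCode b) (List.concatMap letterCode w) _ ⟨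
  List.concatMap letterCode (b ∷ w) ++ encode (is blank 1)             ∎
  where open ≡-Reasoning

walkPieces : List (List Bool)
walkPieces = tok 4 ∷ tok 2 ∷ tok 5 ∷ tok 3 ∷ tok 5 ∷ tok 4 ∷ tok 3
  ∷ encode (Not {ar = arity} (Or (And (Eq 3 0) (Eq 4 2)) (And (Eq 3 2) (Eq 4 1))))
  ∷ tok 4 ∷ tok 0 ∷ tok 2 ∷ encode (Eq {ar = arity} 0 3) ∷ tok 4 ∷ tok 1 ∷ tok 2 ∷ encode (Eq {ar = arity} 1 4) ∷ []

walkCode : List Bool
walkCode = List.concat walkPieces

encode-walk : ∀ k → encode (walk k) ≡ repeat k walkCode ++ encode (walk 0)
encode-walk zero    = refl
encode-walk (suc k) = begin
  appendAll walkPieces (encode (walk k))              ≡⟨ appendAll-concat walkPieces _ ⟩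
  walkCode ++ encode (walk k)                         ≡⟨ cong (walkCode ++_) (encode-walk k) ⟩
  walkCode ++ (repeat k walkCode ++ encode (walk 0))  ≡⟨ List.++-assoc walkCode (repeat k walkCode) _ ⟨
  repeat (suc k) walkCode ++ encode (walk 0)          ∎
  where open ≡-Reasoning

-- The sentence is closed

private
  Scoped₀ : Sentence → Set
  Scoped₀ φ = ∀ Δ → 0 ∈ Δ → Scoped Δ φ

  scoped-rl : ∀ {Δ} σ x y → x ∈ Δ → y ∈ Δ → Scoped Δ (rl σ x y)
  scoped-rl σ x y p q = p VAll.∷ q VAll.∷ VAll.[]

  scoped-goto : ∀ τ k {φ} → Scoped₀ φ → Scoped₀ (goto τ k φ)
  scoped-goto τ zero    s = s
  scoped-goto τ (suc k) s Δ p = scoped-rl (moves τ false) 0 1 (thereˡ p) (hereˡ refl) ,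
    (hereˡ refl , thereˡ (hereˡ refl)) , scoped-goto τ k s _ (hereˡ refl)

  scoped-conjunction : ∀ n f → (∀ i → Scoped₀ (f i)) → Scoped₀ (conjunction n f)
  scoped-conjunction zero    f s Δ p = p , p
  scoped-conjunction (suc n) f s Δ p = s fz Δ p , scoped-conjunction n (f ∘ fs) (s ∘ fs) Δ p

  scoped-unless : ∀ b π → Scoped₀ (unless b (is π 0))
  scoped-unless true  π Δ p = p , p
  scoped-unless false π Δ p = scoped-rl (has π) 0 0 p p

  scoped-walk : ∀ k Δ → 0 ∈ Δ → 1 ∈ Δ → Scoped Δ (walk k)
  scoped-walk zero Δ p q = scoped-rl (moves false false) 0 1 p q , scoped-rl (moves false true) 0 1 p q , scoped-rl stays 0 1 p q
  scoped-walk (suc k) Δ p q =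
    (((v₁ , thereˡ (thereˡ (thereˡ p))) , (v₀ , v₂)) , ((v₁ , v₂) , (v₀ , thereˡ (thereˡ (thereˡ q))))) ,
    (hereˡ refl , thereˡ v₁) , (hereˡ refl , thereˡ (thereˡ v₀)) , scoped-walk k _ (thereˡ (hereˡ refl)) (hereˡ refl)
    where
    v₀ : 4 ∈ 4 ∷ 3 ∷ 2 ∷ Δ
    v₀ = hereˡ refl
    v₁ : 3 ∈ 4 ∷ 3 ∷ 2 ∷ Δ
    v₁ = thereˡ (hereˡ refl)
    v₂ : 2 ∈ 4 ∷ 3 ∷ 2 ∷ Δ
    v₂ = thereˡ (thereˡ (hereˡ refl))

  scoped-reading : ∀ w Δ → 1 ∈ Δ → Scoped Δ (reading w)
  scoped-reading []      Δ p = scoped-rl (has blank) 1 1 p p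
  scoped-reading (b ∷ w) Δ p = scoped-rl (has shift) 1 1 p p , scoped-rl (has (letterIs b)) 1 1 p p ,
    scoped-rl (moves false false) 1 0 (thereˡ p) (hereˡ refl) ,
    scoped-rl (moves true false) 0 1 (thereˡ (hereˡ refl)) (hereˡ refl) , scoped-reading w _ (hereˡ refl)

module _ (𝒯 : Tiles) where
  open Tiles 𝒯

  private
    scoped-tiling : Scoped₀ (tiling 𝒯)
    scoped-tiling Δ p =
      scoped-conjunction (suc κ) (single 𝒯) (λ j → scoped-goto false (toℕ j) λ Δ p →
        scoped-unless (ok0 j) clash0 Δ p , scoped-unless (okR j) clashR Δ p , scoped-unless (ok1 nothing j) (clash1 nothing) Δ p ,
        scoped-unless (ok1 (just false) j) (clash1 (just false)) Δ p , scoped-unless (ok1 (just true) j) (clash1 (just true)) Δ p) Δ p ,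
      scoped-conjunction (suc κ) (λ j → conjunction (suc κ) (pair 𝒯 j)) (λ j → scoped-conjunction (suc κ) (pair 𝒯 j) λ j′ →
        scoped-goto false (toℕ j) (scoped-goto true (toℕ j′) λ Δ p →
          scoped-unless (okH j j′) clashH Δ p , scoped-unless (okV j j′) clashV Δ p)) Δ p ,
      scoped-goto false κ (λ Δ p → scoped-rl (has bounded) 0 0 p p) Δ p

  sentence-closed : ∀ w m → Closed (sentence 𝒯 w m)
  sentence-closed w m = scoped-rl formed 0 0 v v , scoped-tiling _ v ,
    (scoped-rl (moves true false) 0 1 (thereˡ v) (hereˡ refl) , scoped-reading w _ (hereˡ refl)) ,
    scoped-walk m _ (thereˡ v) (hereˡ refl) , scoped-rl (has match) 1 1 (hereˡ refl) (hereˡ refl)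
    where
    v : 0 ∈ 0 ∷ []
    v = hereˡ refl

  startPieces : List (List Bool)
  startPieces = tok 4 ∷ tok 0 ∷ tok 2 ∷ encode (rl formed 0 0) ∷ tok 2 ∷ encode (tiling 𝒯) ∷ tok 2
    ∷ tok 4 ∷ tok 1 ∷ tok 2 ∷ encode (rl (moves true false) 0 1) ∷ []

  middlePieces : List (List Bool)
  middlePieces = encode (is blank 1) ∷ tok 1 ∷ tok 4 ∷ tok 1 ∷ tok 2 ∷ []

  module _ (e : ℕ) where

    -- A fixed number `e` of walk levels is absorbed into the constant text `code₂`, so that the
    -- remaining number can be a pure power, as nested loops produce it.
    code₁ code₂ code₃ : List Bool
    code₁ = List.concat startPieces
    code₂ = List.concat middlePieces ++ repeat e walkCode
    code₃ = encode (walk 0) ++ encode (Not (is match 1))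

    encode-sentence : ∀ w n → encode (sentence 𝒯 w (e + n)) ≡
      code₁ ++ (List.concatMap letterCode w ++ (code₂ ++ (repeat n walkCode ++ code₃)))
    encode-sentence w n = begin
      encode (sentence 𝒯 w (e + n))
        ≡⟨ regroup ⟩
      appendAll startPieces (encode (reading w) ++ s)
        ≡⟨ appendAll-concat startPieces _ ⟩
      code₁ ++ (encode (reading w) ++ s)
        ≡⟨ cong (λ x → code₁ ++ (x ++ s)) (encode-reading w) ⟩
      code₁ ++ ((List.concatMap letterCode w ++ encode (is blank 1)) ++ s)
        ≡⟨ cong (code₁ ++_) (List.++-assoc (List.concatMap letterCode w) (encode (is blank 1)) s) ⟩
      code₁ ++ (List.concatMap letterCode w ++ appendAll middlePieces (encode (walk (e + n)) ++ encode (Not (is match 1))))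
        ≡⟨ cong (λ x → code₁ ++ (List.concatMap letterCode w ++ x))
             (trans (appendAll-concat middlePieces _) (trans (cong (List.concat middlePieces ++_) tail≡)
               (sym (List.++-assoc (List.concat middlePieces) (repeat e walkCode) _)))) ⟩
      code₁ ++ (List.concatMap letterCode w ++ (code₂ ++ (repeat n walkCode ++ code₃))) ∎
      where
      open ≡-Reasoning
      s = appendAll (List.drop 1 middlePieces) (encode (walk (e + n)) ++ encode (Not (is match 1)))
      regroup : encode (sentence 𝒯 w (e + n)) ≡ appendAll startPieces (encode (reading w) ++ s)
      regroup = cong (appendAll (List.take 7 startPieces))
        (trans (List.++-assoc (tok 4 ++ tok 1 ++ tok 2 ++ encode (rl (moves true false) 0 1)) (encode (reading w)) s) refl)
      tail≡ : encode (walk (e + n)) ++ encode (Not (is match 1)) ≡ repeat e walkCode ++ (repeat n walkCode ++ code₃)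
      tail≡ = begin
        encode (walk (e + n)) ++ _
          ≡⟨ cong (_++ encode (Not (is match 1))) (encode-walk (e + n)) ⟩
        (repeat (e + n) walkCode ++ encode (walk 0)) ++ _
          ≡⟨ List.++-assoc (repeat (e + n) walkCode) (encode (walk 0)) _ ⟩
        repeat (e + n) walkCode ++ code₃
          ≡⟨ cong (_++ code₃) (repeat-+ e n walkCode) ⟩
        (repeat e walkCode ++ repeat n walkCode) ++ code₃
          ≡⟨ List.++-assoc (repeat e walkCode) (repeat n walkCode) code₃ ⟩
        repeat e walkCode ++ (repeat n walkCode ++ code₃) ∎

-- A machine writing the encodings

instance
  finite-Vec : {A : Set} {n : ℕ} ⦃ _ : Finite A ⦄ → Finite (Vec A n)
  finite-Vec {n = zero}  = retract {B = ⊤} (λ _ → tt) (λ _ → []ᵛ) (λ { []ᵛ → refl }) finite-⊤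
  finite-Vec {A} {suc n} ⦃ F ⦄ = retract {B = A × Vec A n} (λ { (x ∷ᵛ xs) → x , xs }) (λ (x , xs) → x ∷ᵛ xs)
    (λ { (x ∷ᵛ xs) → refl }) (finite-× ⦃ F ⦄ ⦃ finite-Vec {n = n} ⦄)

clamp : ∀ L → ℕ → Fin (suc L)
clamp zero    i       = fz
clamp (suc L) zero    = fz
clamp (suc L) (suc i) = fs (clamp L i)

toℕ-clamp : ∀ L i → i ≤ L → toℕ (clamp L i) ≡ i
toℕ-clamp zero    zero    p       = refl
toℕ-clamp (suc L) zero    p       = refl
toℕ-clamp (suc L) (suc i) (s≤s p) = cong suc (toℕ-clamp L i p)

-- The index of the `j`-th loop counter, or `nothing` once all `k` loops are exhausted.
level : ∀ k → ℕ → Maybe (Fin k)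
level zero    j       = nothing
level (suc k) zero    = just fz
level (suc k) (suc j) = mapᵐ fs (level k j)

level-< : ∀ k j → j < k → Σ (Fin k) λ i → level k j ≡ just i × toℕ i ≡ j
level-< (suc k) zero    p       = fz , refl , refl
level-< (suc k) (suc j) (s≤s p) with level-< k j p
... | i , e , e′ rewrite e = fs i , refl , cong suc e′

level-end : ∀ k → level k k ≡ nothing
level-end zero    = refl
level-end (suc k) rewrite level-end k = refl

data Code : Set where
  opening middle walkText closing : Code
  letterText : Bool → Code

data Phase : Set where
  toFeed toTick toScan toFinal : Phase

-- The output is written on a second track; the first track holds the letters not yet treated,
-- and bit vectors driving nested loops in place of the letters already treated.
module Writer (k : ℕ) (text : Code → List Bool) (L : ℕ) (text≤L : ∀ c → length (text c) ≤ L) where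

  data Track : Set where
    ltr : Bool → Track
    em : Track
    rg : Vec Bool k → Track

  -- first track, is this cell 0, output
  Cell : Set
  Cell = Track × Bool × Maybe Bool

  -- The loops form an odometer. `tick` writes one `walkText`; `scan` seeks the first unset bit of
  -- its level, sets it and ticks again, or, if all are set, has the level cleared and goes on to
  -- the next one.
  data Work : Set where
    init feed tick : Work
    goApp : Code → Work
    goTo  : Phase → Work
    app   : Code → Fin (suc L) → Work
    scan  : Maybe (Fin k) → Work
    clear : Fin k → Work

  State : Set
  State = Maybe Work

  opaque
    Cell-finite : Finite Cell
    Cell-finite = finite-× ⦃ track ⦄
      where
      track : Finite Track
      track = retract {B = Bool ⊎ Maybe (Vec Bool k)}
        (λ { (ltr b) → inj₁ b ; em → inj₂ nothing ; (rg v) → inj₂ (just v) })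
        (λ { (inj₁ b) → ltr b ; (inj₂ nothing) → em ; (inj₂ (just v)) → rg v })
        (λ { (ltr b) → refl ; em → refl ; (rg v) → refl }) finite-⊎

    State-finite : Finite State
    State-finite = finite-Maybe ⦃ work ⦄
      where
      code : Finite Code
      code = retract {B = Bool ⊎ (Bool × Bool)}
        (λ { (letterText b) → inj₁ b ; opening → inj₂ (false , false) ; middle → inj₂ (false , true)
           ; walkText → inj₂ (true , false) ; closing → inj₂ (true , true) })
        (λ { (inj₁ b) → letterText b ; (inj₂ (false , false)) → opening ; (inj₂ (false , true)) → middle
           ; (inj₂ (true , false)) → walkText ; (inj₂ (true , true)) → closing })
        (λ { (letterText b) → refl ; opening → refl ; middle → refl ; walkText → refl ; closing → refl }) finite-⊎
      phase : Finite Phase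
      phase = retract {B = Bool × Bool}
        (λ { toFeed → false , false ; toTick → false , true ; toScan → true , false ; toFinal → true , true })
        (λ { (false , false) → toFeed ; (false , true) → toTick ; (true , false) → toScan ; (true , true) → toFinal })
        (λ { toFeed → refl ; toTick → refl ; toScan → refl ; toFinal → refl }) finite-×
      B : Set
      B = Fin 3 ⊎ Code ⊎ Phase ⊎ (Code × Fin (suc L)) ⊎ Maybe (Fin k) ⊎ Fin k
      to′ : Work → B
      to′ init      = inj₁ fz
      to′ feed   = inj₁ (fs fz)
      to′ tick      = inj₁ (fs (fs fz))
      to′ (goApp c) = inj₂ (inj₁ c)
      to′ (goTo p)  = inj₂ (inj₂ (inj₁ p))
      to′ (app c i) = inj₂ (inj₂ (inj₂ (inj₁ (c , i))))
      to′ (scan i)  = inj₂ (inj₂ (inj₂ (inj₂ (inj₁ i))))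
      to′ (clear i) = inj₂ (inj₂ (inj₂ (inj₂ (inj₂ i))))
      from′ : B → Work
      from′ (inj₁ fz)           = init
      from′ (inj₁ (fs fz))      = feed
      from′ (inj₁ (fs (fs fz))) = tick
      from′ (inj₂ (inj₁ c))     = goApp c
      from′ (inj₂ (inj₂ (inj₁ p))) = goTo p
      from′ (inj₂ (inj₂ (inj₂ (inj₁ (c , i))))) = app c i
      from′ (inj₂ (inj₂ (inj₂ (inj₂ (inj₁ i))))) = scan i
      from′ (inj₂ (inj₂ (inj₂ (inj₂ (inj₂ i))))) = clear i
      inv : ∀ x → from′ (to′ x) ≡ x
      inv init      = refl
      inv feed   = refl
      inv tick      = refl
      inv (goApp c) = refl
      inv (goTo p)  = refl
      inv (app c i) = refl
      inv (scan i)  = refl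
      inv (clear i) = refl
      work : Finite Work
      work = retract to′ from′ inv (finite-⊎ ⦃ finite-Fin ⦄ ⦃ finite-⊎ ⦃ code ⦄ ⦃ finite-⊎ ⦃ phase ⦄
        ⦃ finite-⊎ ⦃ finite-× ⦃ code ⦄ ⦄ ⦄ ⦄ ⦄)

  private
    module 𝒞 = Finite Cell-finite
    module 𝒮 = Finite State-finite

  nSym : ℕ
  nSym = 𝒞.size

  -- The symbols of the input tape are read as cells without output, so the tape need not be
  -- translated beforehand.
  view : Fin (3 + nSym) → Cell
  view fz             = em , false , nothing
  view (fs fz)        = ltr false , false , nothing
  view (fs (fs fz))   = ltr true , false , nothing
  view (fs (fs (fs i))) = 𝒞.dec i

  write : Cell → Fin (3 + nSym)
  write c = fs (fs (fs (𝒞.enc c)))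

  view-write : ∀ c → view (write c) ≡ c
  view-write c = 𝒞.dec-enc c

  blankVec : Vec Bool k
  blankVec = replicateᵛ k false

  enter : Phase → State
  enter toFeed = just feed
  enter toTick    = just tick
  enter toScan    = just (scan (level k 0))
  enter toFinal   = nothing

  after : Code → Phase
  after opening       = toFeed
  after (letterText _) = toFeed
  after middle     = toTick
  after walkText       = toScan
  after closing      = toFinal

  Action : Set
  Action = State × Cell × Defs.Move

  -- While the cell already holds output, the head passes on with the same index; a bit is written
  -- only at the end of the output.
  appendStep : Code → Fin (suc L) → Maybe Bool → Cell → Action
  appendStep c i nothing  x                 = just (goTo (after c)) , x , stay
  appendStep c i (just b) x@(_ , _ , just _) = just (app c i) , x , right
  appendStep c i (just b) (t , h , nothing) = just (app c (clamp L (suc (toℕ i)))) , (t , h , just b) , right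

  scanStep : Fin k → Bool → Vec Bool k → Bool → Maybe Bool → Action
  scanStep i true  v h o = just (scan (just i)) , (rg v , h , o) , right
  scanStep i false v h o = just (goTo toTick) , (rg (v [ i ]≔ true) , h , o) , stay

  act : Work → Cell → Action
  -- Cell 0 is marked, so that later sweeps to the left know where to stop.
  act init      (t , h , o)     = just (app opening (clamp L 0)) , (t , true , o) , stay
  act (goApp c) x@(_ , true , _)  = just (app c (clamp L 0)) , x , stay
  act (goApp c) x@(_ , false , _) = just (goApp c) , x , left
  act (goTo p)  x@(_ , true , _)  = enter p , x , stay
  act (goTo p)  x@(_ , false , _) = just (goTo p) , x , left
  act (app c i) x                 = appendStep c i (row (text c) (toℕ i)) x
  act feed   x@(rg _ , _ , _)  = just feed , x , right
  act feed   (ltr b , h , o)    = just (goApp (letterText b)) , (rg blankVec , h , o) , stay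
  -- The first empty cell becomes a register as well. This gives `1 + length w` registers and hence
  -- `2 + length w` rounds per loop.
  act feed   (em , h , o)      = just (goApp middle) , (rg blankVec , h , o) , stay
  act tick      x                 = just (app walkText (clamp L 0)) , x , stay
  act (scan nothing)  x           = just (app closing (clamp L 0)) , x , stay
  act (scan (just i)) (rg v , h , o)   = scanStep i (lookupᵛ v i) v h o
  act (scan (just i)) x@(em , _ , _)   = just (clear i) , x , left
  act (scan (just i)) x@(ltr _ , _ , _) = just (clear i) , x , left
  act (clear i) (rg v , true , o)  = just (scan (level k (suc (toℕ i)))) , (rg (v [ i ]≔ false) , true , o) , stay
  act (clear i) (rg v , false , o) = just (clear i) , (rg (v [ i ]≔ false) , false , o) , left
  act (clear i) x                  = just (clear i) , x , stay

  -- Decodes the output in place from cell 0 on; the final blank delimits it for `readOut`.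
  finish : Cell → Ctrl (𝒮.size) × Fin (3 + nSym) × Defs.Move
  finish (_ , _ , just b)  = run (𝒮.enc nothing) , bitSym b , right
  finish (_ , _ , nothing) = halt true , fz , stay

  transition : State → Cell → Ctrl (𝒮.size) × Fin (3 + nSym) × Defs.Move
  transition (just s) x = let (s′ , x′ , mv) = act s x in run (𝒮.enc s′) , write x′ , mv
  transition nothing  x = finish x

  machine : TM
  machine = record { nQ = 𝒮.size ; nS = nSym ; start = run (𝒮.enc (just init)) ; δ = λ q a → transition (𝒮.dec q) (view a) }

  -- Runs, described up to the meaning of the tape cells

  record Rep (s : State) (h : ℕ) (I : ℕ → Track) (O : List Bool) (c : Config machine) : Set where
    constructor rep
    field
      rep-ctrl : ctrl c ≡ run (𝒮.enc s)
      rep-head : head c ≡ h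
      rep-tape : ∀ p → view (tape c p) ≡ (I p , (p ≡ᵇ 0) , row O p)

  record Run (t : ℕ) (A B : Config machine → Set) : Set where
    constructor steps
    field reaches : ∀ c → A c → Σ ℕ λ n → n ≤ t × B (runFor machine n c)
  open Run

  _⨾_ : ∀ {t t′ A B C} → Run t A B → Run t′ B C → Run (t + t′) A C
  _⨾_ {C = C} f f′ .reaches c a with reaches f c a
  ... | n , p , b with reaches f′ _ b
  ... | n′ , p′ , b′ = n + n′ , ℕ.+-mono-≤ p p′ , subst C (sym (runFor-+ machine n n′ c)) b′

  infixr 5 _⨾_

  within : ∀ {t t′ A B} → t ≤ t′ → Run t A B → Run t′ A B
  within q f .reaches c a with reaches f c a
  ... | n , p , b = n , ℕ.≤-trans p q , b

  idle : ∀ {A} → Run 0 A A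
  idle .reaches c a = 0 , z≤n , a

  step-eq : ∀ {q t h c a mv} → TM.δ machine q (t h) ≡ (c , a , mv) →
    step machine (config (run q) t h) ≡ config c (λ i → if i ≡ᵇ h then a else t i) (moveHead mv h)
  step-eq e rewrite e = refl

  -- Reduces one machine step to a computation of `act` and a comparison of the tracks away from the
  -- head.
  writing : ∀ {s h I O s′ x mv} I′ O′ → act s (I h , (h ≡ᵇ 0) , row O h) ≡ (s′ , x , mv) →
    x ≡ (I′ h , (h ≡ᵇ 0) , row O′ h) → (∀ p → p ≢ h → I′ p ≡ I p × row O′ p ≡ row O p) →
    Run 1 (Rep (just s) h I O) (Rep s′ (moveHead mv h) I′ O′)
  writing {s} {h} {I} {O} {s′} {x} {mv} I′ O′ e ex keep .reaches (config ._ t ._) (rep refl refl tp) =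
    1 , ℕ.≤-refl , subst (Rep s′ (moveHead mv h) I′ O′) (sym (step-eq {t = t} δ≡)) (rep refl refl tp′)
    where
    δ≡ : TM.δ machine (𝒮.enc (just s)) (t h) ≡ (run (𝒮.enc s′) , write x , mv)
    δ≡ = trans (cong₂ transition (𝒮.dec-enc (just s)) (tp h)) (cong (λ (s′ , x′ , mv) → run (𝒮.enc s′) , write x′ , mv) e)
    tp′ : ∀ p → view (if p ≡ᵇ h then write x else t p) ≡ (I′ p , (p ≡ᵇ 0) , row O′ p)
    tp′ p with p ℕ.≟ h
    ... | yes refl rewrite ≡ᵇ-true p = trans (view-write x) ex
    ... | no ne rewrite ≡ᵇ-false ne | proj₁ (keep p ne) | proj₂ (keep p ne) = tp p

  moving : ∀ {s h I O s′ mv} → act s (I h , (h ≡ᵇ 0) , row O h) ≡ (s′ , (I h , (h ≡ᵇ 0) , row O h) , mv) →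
    Run 1 (Rep (just s) h I O) (Rep s′ (moveHead mv h) I O)
  moving {I = I} {O} e = writing I O e refl λ _ _ → refl , refl

  go-app : ∀ c h I O → Run (suc h) (Rep (just (goApp c)) h I O) (Rep (just (app c (clamp L 0))) 0 I O)
  go-app c zero    I O = moving refl
  go-app c (suc h) I O = moving refl ⨾ go-app c h I O

  go-to : ∀ p h I O → Run (suc h) (Rep (just (goTo p)) h I O) (Rep (enter p) 0 I O)
  go-to p zero    I O = moving refl
  go-to p (suc h) I O = moving refl ⨾ go-to p h I O

  row-end : ∀ O → row O (length O) ≡ nothing
  row-end O = row-beyond O (length O) ℕ.≤-refl

  row-defined : ∀ O p → p < length O → Σ Bool λ b → row O p ≡ just b
  row-defined (b ∷ O) zero    q       = b , refl
  row-defined (b ∷ O) (suc p) (s≤s q) = row-defined O p q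

  row-snoc : ∀ O b p → p ≢ length O → row (O ++ [ b ]) p ≡ row O p
  row-snoc []      b zero    ne = ⊥-elim (ne refl)
  row-snoc []      b (suc p) ne = refl
  row-snoc (x ∷ O) b zero    ne = refl
  row-snoc (x ∷ O) b (suc p) ne = row-snoc O b p (ne ∘ cong suc)

  row-snoc-end : ∀ O b → row (O ++ [ b ]) (length O) ≡ just b
  row-snoc-end []      b = refl
  row-snoc-end (x ∷ O) b = row-snoc-end O b

  app-forward : ∀ c i {b} → row (text c) (toℕ i) ≡ just b → ∀ d h I O → h + d ≡ length O →
    Run d (Rep (just (app c i)) h I O) (Rep (just (app c i)) (length O) I O)
  app-forward c i e zero h I O p = subst (λ n → Run 0 (Rep (just (app c i)) h I O) (Rep (just (app c i)) n I O))
    (trans (sym (ℕ.+-identityʳ h)) p) idle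
  app-forward c i e (suc d) h I O p = moving lemma ⨾ app-forward c i e d (suc h) I O (trans (sym (ℕ.+-suc h d)) p)
    where
    lemma : act (app c i) (I h , (h ≡ᵇ 0) , row O h) ≡ (just (app c i) , (I h , (h ≡ᵇ 0) , row O h) , right)
    lemma rewrite e | proj₂ (row-defined O h (subst (h <_) p (ℕ.m<m+n h (s≤s z≤n)))) = refl

  -- The head is at the end of the output, and writing a bit with a move to the right restores this
  -- situation; `s` is the rest of the text from index `i` on.
  app-write : ∀ c s i I O → i + length s ≡ length (text c) → (∀ p → row (text c) (i + p) ≡ row s p) →
    Run (suc (length s)) (Rep (just (app c (clamp L i))) (length O) I O)
                         (Rep (just (goTo (after c))) (length (O ++ s)) I (O ++ s))
  app-write c [] i I O p e rewrite List.++-identityʳ O = moving lemma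
    where
    lemma : act (app c (clamp L i)) (I (length O) , (length O ≡ᵇ 0) , row O (length O)) ≡
      (just (goTo (after c)) , (I (length O) , (length O ≡ᵇ 0) , row O (length O)) , stay)
    lemma rewrite toℕ-clamp L i (subst (_≤ L) (trans (sym p) (ℕ.+-identityʳ i)) (text≤L c))
                | trans (cong (row (text c)) (sym (ℕ.+-identityʳ i))) (e 0) = refl
  app-write c (b ∷ s) i I O p e =
    writing I (O ++ [ b ]) lemma (cong (λ o → I (length O) , (length O ≡ᵇ 0) , o) (sym (row-snoc-end O b)))
      (λ p ne → refl , row-snoc O b p ne)
    ⨾ subst (λ n → Run (suc (length s)) (Rep (just (app c (clamp L (suc i)))) n I (O ++ [ b ]))
                         (Rep (just (goTo (after c))) (length (O ++ b ∷ s)) I (O ++ b ∷ s)))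
        (trans (List.length-++ O) (ℕ.+-comm (length O) 1))
        (subst (λ O′ → Run (suc (length s)) (Rep (just (app c (clamp L (suc i)))) (length (O ++ [ b ])) I (O ++ [ b ]))
                         (Rep (just (goTo (after c))) (length O′) I O′))
          (List.++-assoc O [ b ] s)
          (app-write c s (suc i) I (O ++ [ b ]) (trans (sym (ℕ.+-suc i (length s))) p)
            (λ p → trans (cong (row (text c)) (sym (ℕ.+-suc i p))) (e (suc p)))))
    where
    i≤L : i ≤ L
    i≤L = ℕ.≤-trans (ℕ.m≤m+n i (suc (length s))) (subst (_≤ L) (sym p) (text≤L c))
    lemma : act (app c (clamp L i)) (I (length O) , (length O ≡ᵇ 0) , row O (length O)) ≡
      (just (app c (clamp L (suc i))) , (I (length O) , (length O ≡ᵇ 0) , just b) , right)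
    lemma rewrite trans (cong (row (text c)) (trans (toℕ-clamp L i i≤L) (sym (ℕ.+-identityʳ i)))) (e 0) | row-end O
      = cong (λ n → just (app c (clamp L (suc n))) , (I (length O) , (length O ≡ᵇ 0) , just b) , right) (toℕ-clamp L i i≤L)

  -- Contents of the first track

  upd : {A : Set} → (ℕ → A) → ℕ → A → ℕ → A
  upd f h a p = if p ≡ᵇ h then a else f p

  upd-at : {A : Set} (f : ℕ → A) (h : ℕ) (a : A) → upd f h a h ≡ a
  upd-at f h a rewrite ≡ᵇ-true h = refl

  upd-other : {A : Set} (f : ℕ → A) (h : ℕ) (a : A) → ∀ p → p ≢ h → upd f h a p ≡ f p
  upd-other f h a p ne rewrite ≡ᵇ-false ne = refl

  feedTrack : ℕ → List Bool → ℕ → Track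
  feedTrack zero    []      p       = em
  feedTrack zero    (b ∷ v) zero    = ltr b
  feedTrack zero    (b ∷ v) (suc p) = feedTrack zero v p
  feedTrack (suc j) v       zero    = rg blankVec
  feedTrack (suc j) v       (suc p) = feedTrack j v p

  feedTrack-done : ∀ j v p → p < j → feedTrack j v p ≡ rg blankVec
  feedTrack-done (suc j) v zero    q       = refl
  feedTrack-done (suc j) v (suc p) (s≤s q) = feedTrack-done j v p q

  feedTrack-next : ∀ j b v → feedTrack j (b ∷ v) j ≡ ltr b
  feedTrack-next zero    b v = refl
  feedTrack-next (suc j) b v = feedTrack-next j b v

  feedTrack-end : ∀ j → feedTrack j [] j ≡ em
  feedTrack-end zero    = refl
  feedTrack-end (suc j) = feedTrack-end j

  feedTrack-suc : ∀ j b v p → p ≢ j → feedTrack (suc j) v p ≡ feedTrack j (b ∷ v) p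
  feedTrack-suc zero    b v zero    ne = ⊥-elim (ne refl)
  feedTrack-suc zero    b v (suc p) ne = refl
  feedTrack-suc (suc j) b v zero    ne = refl
  feedTrack-suc (suc j) b v (suc p) ne = feedTrack-suc j b v p (ne ∘ cong suc)

  feedTrack-last : ∀ j p → p ≢ j → feedTrack (suc j) [] p ≡ feedTrack j [] p
  feedTrack-last zero    zero    ne = ⊥-elim (ne refl)
  feedTrack-last zero    (suc p) ne = refl
  feedTrack-last (suc j) zero    ne = refl
  feedTrack-last (suc j) (suc p) ne = feedTrack-last j p (ne ∘ cong suc)

  feed-forward : ∀ j v O d h → h + d ≡ j →
    Run d (Rep (just feed) h (feedTrack j v) O) (Rep (just feed) j (feedTrack j v) O)
  feed-forward j v O zero    h p = subst (λ n → Run 0 (Rep (just feed) h (feedTrack j v) O) (Rep (just feed) n (feedTrack j v) O))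
    (trans (sym (ℕ.+-identityʳ h)) p) idle
  feed-forward j v O (suc d) h p = moving lemma ⨾ feed-forward j v O d (suc h) (trans (sym (ℕ.+-suc h d)) p)
    where
    lemma : act feed (feedTrack j v h , (h ≡ᵇ 0) , row O h) ≡ (just feed , (feedTrack j v h , (h ≡ᵇ 0) , row O h) , right)
    lemma rewrite feedTrack-done j v h (subst (h <_) p (ℕ.m<m+n h (s≤s z≤n))) = refl

  regTrack : ℕ → (ℕ → Vec Bool k) → ℕ → Track
  regTrack zero    V p       = em
  regTrack (suc ℓ) V zero    = rg (V 0)
  regTrack (suc ℓ) V (suc p) = regTrack ℓ (V ∘ suc) p

  regTrack-in : ∀ ℓ V p → p < ℓ → regTrack ℓ V p ≡ rg (V p)
  regTrack-in (suc ℓ) V zero    q       = refl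
  regTrack-in (suc ℓ) V (suc p) (s≤s q) = regTrack-in ℓ (V ∘ suc) p q

  regTrack-out : ∀ ℓ V p → ℓ ≤ p → regTrack ℓ V p ≡ em
  regTrack-out zero    V p       q       = refl
  regTrack-out (suc ℓ) V (suc p) (s≤s q) = regTrack-out ℓ (V ∘ suc) p q

  regTrack-blank : ∀ ℓ p → feedTrack ℓ [] p ≡ regTrack ℓ (λ _ → blankVec) p
  regTrack-blank zero    p       = refl
  regTrack-blank (suc ℓ) zero    = refl
  regTrack-blank (suc ℓ) (suc p) = regTrack-blank ℓ p

  regTrack-upd : ∀ ℓ V h v p → p ≢ h → regTrack ℓ (upd V h v) p ≡ regTrack ℓ V p
  regTrack-upd ℓ V h v p ne with ℕ.<-≤-connex p ℓ
  ... | inj₁ q = trans (regTrack-in ℓ _ p q) (trans (cong rg (upd-other V h v p ne)) (sym (regTrack-in ℓ V p q)))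
  ... | inj₂ q = trans (regTrack-out ℓ _ p q) (sym (regTrack-out ℓ V p q))

  regTrack-upd-at : ∀ ℓ V h v → h < ℓ → regTrack ℓ (upd V h v) h ≡ rg v
  regTrack-upd-at ℓ V h v q = trans (regTrack-in ℓ _ h q) (cong rg (upd-at V h v))

  retrack : ∀ {s h I I′ O} → (∀ p → I p ≡ I′ p) → Run 0 (Rep s h I O) (Rep s h I′ O)
  retrack {O = O} e .reaches c (rep rc rh tp) =
    0 , z≤n , rep rc rh λ p → trans (tp p) (cong (λ t → t , (p ≡ᵇ 0) , row O p) (e p))

  scan-forward : ∀ ℓ i V O t → t ≤ ℓ → (∀ p → p < t → lookupᵛ (V p) i ≡ true) → ∀ d h → h + d ≡ t →
    Run d (Rep (just (scan (just i))) h (regTrack ℓ V) O) (Rep (just (scan (just i))) t (regTrack ℓ V) O)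
  scan-forward ℓ i V O t t≤ℓ set zero h p =
    subst (λ n → Run 0 (Rep (just (scan (just i))) h (regTrack ℓ V) O) (Rep (just (scan (just i))) n (regTrack ℓ V) O))
      (trans (sym (ℕ.+-identityʳ h)) p) idle
  scan-forward ℓ i V O t t≤ℓ set (suc d) h p = moving lemma ⨾ scan-forward ℓ i V O t t≤ℓ set d (suc h) (trans (sym (ℕ.+-suc h d)) p)
    where
    h<t : h < t
    h<t = subst (h <_) p (ℕ.m<m+n h (s≤s z≤n))
    lemma : act (scan (just i)) (regTrack ℓ V h , (h ≡ᵇ 0) , row O h) ≡
      (just (scan (just i)) , (regTrack ℓ V h , (h ≡ᵇ 0) , row O h) , right)
    lemma rewrite regTrack-in ℓ V h (ℕ.<-≤-trans h<t t≤ℓ) | set h h<t = refl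

  scan-set : ∀ ℓ i V O h → h < ℓ → lookupᵛ (V h) i ≡ false →
    Run 1 (Rep (just (scan (just i))) h (regTrack ℓ V) O)
          (Rep (just (goTo toTick)) h (regTrack ℓ (upd V h (V h [ i ]≔ true))) O)
  scan-set ℓ i V O h q e = writing _ O lemma (cong (λ t → t , (h ≡ᵇ 0) , row O h) (sym (regTrack-upd-at ℓ V h _ q)))
    λ p ne → regTrack-upd ℓ V h _ p ne , refl
    where
    lemma : act (scan (just i)) (regTrack ℓ V h , (h ≡ᵇ 0) , row O h) ≡
      (just (goTo toTick) , (rg (V h [ i ]≔ true) , (h ≡ᵇ 0) , row O h) , stay)
    lemma rewrite regTrack-in ℓ V h q | e = refl

  cleared : Fin k → ℕ → (ℕ → Vec Bool k) → ℕ → Vec Bool k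
  cleared i zero    V = upd V 0 (V 0 [ i ]≔ false)
  cleared i (suc h) V = cleared i h (upd V (suc h) (V (suc h) [ i ]≔ false))

  cleared-above : ∀ i h V p → h < p → cleared i h V p ≡ V p
  cleared-above i zero    V p q = upd-other V 0 _ p (ℕ.>⇒≢ q)
  cleared-above i (suc h) V p q = trans (cleared-above i h _ p (ℕ.<-trans (ℕ.n<1+n h) q)) (upd-other V (suc h) _ p (ℕ.>⇒≢ q))

  cleared-at : ∀ i h V p → p ≤ h → cleared i h V p ≡ V p [ i ]≔ false
  cleared-at i zero    V zero q = refl
  cleared-at i (suc h) V p q with ℕ.m≤n⇒m<n∨m≡n q
  ... | inj₁ (s≤s p≤h) = trans (cleared-at i h _ p p≤h)
    (cong (_[ i ]≔ false) (upd-other V (suc h) (V (suc h) [ i ]≔ false) p (ℕ.<⇒≢ (s≤s p≤h))))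
  ... | inj₂ refl = trans (cleared-above i h _ (suc h) ℕ.≤-refl) (upd-at V (suc h) _)

  -- Clearing sweeps leftwards, and thereby also returns the head to cell 0.
  clears : ∀ ℓ i O h V → h < ℓ →
    Run (suc h) (Rep (just (clear i)) h (regTrack ℓ V) O)
                (Rep (just (scan (level k (suc (toℕ i))))) 0 (regTrack ℓ (cleared i h V)) O)
  clears ℓ i O zero V q = writing _ O lemma (cong (λ t → t , true , row O 0) (sym (regTrack-upd-at ℓ V 0 _ q)))
    λ p ne → regTrack-upd ℓ V 0 _ p ne , refl
    where
    lemma : act (clear i) (regTrack ℓ V 0 , true , row O 0) ≡
      (just (scan (level k (suc (toℕ i)))) , (rg (V 0 [ i ]≔ false) , true , row O 0) , stay)
    lemma rewrite regTrack-in ℓ V 0 q = refl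
  clears ℓ i O (suc h) V q =
    writing (regTrack ℓ V′) O lemma (cong (λ t → t , false , row O (suc h)) (sym (regTrack-upd-at ℓ V (suc h) _ q)))
      (λ p ne → regTrack-upd ℓ V (suc h) _ p ne , refl)
    ⨾ clears ℓ i O h V′ (ℕ.<-trans (ℕ.n<1+n h) q)
    where
    V′ = upd V (suc h) (V (suc h) [ i ]≔ false)
    lemma : act (clear i) (regTrack ℓ V (suc h) , false , row O (suc h)) ≡
      (just (clear i) , (rg (V (suc h) [ i ]≔ false) , false , row O (suc h)) , left)
    lemma rewrite regTrack-in ℓ V (suc h) q = refl

  -- All positions of the head and all lengths of the output stay below X; every sweep over the
  -- tape is accounted for by X steps.
  module Timed (B : ℕ) where

    X : ℕ
    X = suc B

    1≤X : 1 ≤ X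
    1≤X = s≤s z≤n

    -- One `X` each for walking to the end of the output, writing, and returning.
    appendCost : ℕ
    appendCost = X + (X + X)

    appends : ∀ c I O → length (O ++ text c) ≤ B →
      Run appendCost (Rep (just (app c (clamp L 0))) 0 I O) (Rep (enter (after c)) 0 I (O ++ text c))
    appends c I O p = go (text c) refl
      where
      go : ∀ s → text c ≡ s → Run appendCost (Rep (just (app c (clamp L 0))) 0 I O) (Rep (enter (after c)) 0 I (O ++ text c))
      -- An empty text is finished at once, with the head still at cell 0.
      go [] e = within (ℕ.+-mono-≤ 1≤X (ℕ.≤-trans 1≤X (ℕ.m≤m+n X X)))
        (subst (λ O′ → Run 2 (Rep (just (app c (clamp L 0))) 0 I O) (Rep (enter (after c)) 0 I O′))
          (sym (trans (cong (O ++_) e) (List.++-identityʳ O))) (moving lemma ⨾ go-to (after c) 0 I O))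
        where
        lemma : act (app c (clamp L 0)) (I 0 , true , row O 0) ≡ (just (goTo (after c)) , (I 0 , true , row O 0) , stay)
        lemma rewrite e = refl
      go (b ∷ s) e =
        within (ℕ.≤-trans (ℕ.≤-trans (ℕ.m≤m+n (length O) _) (ℕ.≤-trans (ℕ.≤-reflexive (sym (List.length-++ O))) p)) (ℕ.n≤1+n B))
          (app-forward c (clamp L 0) {b} (trans (cong (row (text c)) (toℕ-clamp L 0 z≤n)) (cong (λ t → row t 0) e)) (length O) 0 I O refl)
        ⨾ within (s≤s (ℕ.≤-trans (ℕ.m≤n+m (length (text c)) (length O)) (ℕ.≤-trans (ℕ.≤-reflexive (sym (List.length-++ O))) p)))
            (app-write c (text c) 0 I O refl (λ _ → refl))
        ⨾ within (s≤s p) (go-to (after c) (length (O ++ text c)) I (O ++ text c))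

    returns : ∀ c h I O → h ≤ B → length (O ++ text c) ≤ B →
      Run (X + appendCost) (Rep (just (goApp c)) h I O) (Rep (enter (after c)) 0 I (O ++ text c))
    returns c h I O q p = within (s≤s q) (go-app c h I O) ⨾ appends c I O p

    feedCost : List Bool → ℕ
    feedCost []      = X + (X + (X + appendCost))
    feedCost (b ∷ v) = (X + (X + (X + appendCost))) + feedCost v

    private
      prefix≤ : ∀ (s s′ O : List Bool) → length (O ++ (s ++ s′)) ≤ B → length (O ++ s) ≤ B
      prefix≤ s s′ O p = ℕ.≤-trans (ℕ.≤-trans (ℕ.m≤m+n (length (O ++ s)) (length s′))
        (ℕ.≤-reflexive (sym (trans (cong length (sym (List.++-assoc O s s′))) (List.length-++ (O ++ s)))))) p

    feeds : ∀ v j O → j + length v ≤ B → length (O ++ (List.concatMap (text ∘ letterText) v ++ text middle)) ≤ B →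
      Run (feedCost v) (Rep (just feed) 0 (feedTrack j v) O)
        (Rep (just tick) 0 (feedTrack (suc (j + length v)) []) (O ++ (List.concatMap (text ∘ letterText) v ++ text middle)))
    feeds [] j O q p = within j≤X (feed-forward j [] O j 0 refl)
      ⨾ within 1≤X (writing (feedTrack (suc j) []) O lemma (cong (λ t → t , (j ≡ᵇ 0) , row O j) (sym (feedTrack-done (suc j) [] j ℕ.≤-refl)))
          (λ p ne → feedTrack-last j p ne , refl))
      ⨾ subst (λ n → Run (X + appendCost) (Rep (just (goApp middle)) j (feedTrack (suc j) []) O)
                       (Rep (just tick) 0 (feedTrack (suc n) []) (O ++ text middle)))
          (sym (ℕ.+-identityʳ j)) (returns middle j (feedTrack (suc j) []) O (ℕ.≤-trans (ℕ.m≤m+n j 0) q) p)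
      where
      j≤X : j ≤ X
      j≤X = ℕ.≤-trans (ℕ.≤-trans (ℕ.m≤m+n j 0) q) (ℕ.n≤1+n B)
      lemma : act feed (feedTrack j [] j , (j ≡ᵇ 0) , row O j) ≡ (just (goApp middle) , (rg blankVec , (j ≡ᵇ 0) , row O j) , stay)
      lemma rewrite feedTrack-end j = refl
    feeds (b ∷ v) j O q p =
      (within j≤X (feed-forward j (b ∷ v) O j 0 refl)
      ⨾ within 1≤X (writing (feedTrack (suc j) v) O lemma (cong (λ t → t , (j ≡ᵇ 0) , row O j) (sym (feedTrack-done (suc j) v j ℕ.≤-refl)))
          (λ p ne → feedTrack-suc j b v p ne , refl))
      ⨾ returns (letterText b) j (feedTrack (suc j) v) O j≤B (prefix≤ _ _ O (subst (λ s → length (O ++ s) ≤ B) assoc p)))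
      ⨾ subst₂′ (sym (ℕ.+-suc j (length v))) (trans (List.++-assoc O (text (letterText b)) _) (cong (O ++_) (sym assoc)))
          (feeds v (suc j) (O ++ text (letterText b)) (subst (_≤ B) (ℕ.+-suc j (length v)) q)
            (subst (λ s → length s ≤ B) (sym (trans (List.++-assoc O (text (letterText b)) _) (cong (O ++_) (sym assoc)))) p))
      where
      j≤B : j ≤ B
      j≤B = ℕ.≤-trans (ℕ.m≤m+n j _) q
      j≤X : j ≤ X
      j≤X = ℕ.≤-trans j≤B (ℕ.n≤1+n B)
      assoc : List.concatMap (text ∘ letterText) (b ∷ v) ++ text middle ≡
              text (letterText b) ++ (List.concatMap (text ∘ letterText) v ++ text middle)
      assoc = List.++-assoc (text (letterText b)) (List.concatMap (text ∘ letterText) v) (text middle)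
      lemma : act feed (feedTrack j (b ∷ v) j , (j ≡ᵇ 0) , row O j) ≡
        (just (goApp (letterText b)) , (rg blankVec , (j ≡ᵇ 0) , row O j) , stay)
      lemma rewrite feedTrack-next j b v = refl
      subst₂′ : ∀ {t A s n n′ O′ O″} → n ≡ n′ → O′ ≡ O″ → Run t A (Rep s 0 (feedTrack (suc n) []) O′) →
        Run t A (Rep s 0 (feedTrack (suc n′) []) O″)
      subst₂′ refl refl r = r

    -- The bits of level i are the counter of the loop of level i, in unary.
    module Loops (ℓ′ : ℕ) (ℓ≤B : suc ℓ′ ≤ B) where
      private
        ℓ = suc ℓ′
        Regs = ℕ → Vec Bool k

      -- Together with `SameFrom` the loop invariant: inner counters are zero before and after each
      -- cycle, and outer counters keep their values.
      ClearBelow : ℕ → Regs → Set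
      ClearBelow j V = ∀ p → p < ℓ → ∀ i → toℕ i < j → lookupᵛ (V p) i ≡ false

      SameFrom : ℕ → Regs → Regs → Set
      SameFrom j V V′ = ∀ p → p < ℓ → ∀ i → j ≤ toℕ i → lookupᵛ (V′ p) i ≡ lookupᵛ (V p) i

      Level : ℕ → Regs → List Bool → Config machine → Set
      Level j V O = Rep (just (scan (level k j))) 0 (regTrack ℓ V) O

      Tick : Regs → List Bool → Config machine → Set
      Tick V O = Rep (just tick) 0 (regTrack ℓ V) O

      sweepCost : ℕ
      sweepCost = X + (X + X)

      levelCost : ℕ → ℕ
      loopCost : ℕ → ℕ → ℕ
      levelCost zero    = X + appendCost
      levelCost (suc j) = levelCost j + loopCost j ℓ
      loopCost j zero    = sweepCost
      loopCost j (suc r) = sweepCost + (levelCost j + loopCost j r)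

      private
        P = text walkText
        N : ℕ → ℕ
        N j = suc ℓ ^ j

        repeat-bound : ∀ m n O → length (O ++ repeat (m + n) P) ≤ B → length (O ++ repeat m P) ≤ B
        repeat-bound m n O p = prefix≤ (repeat m P) (repeat n P) O (subst (λ s → length (O ++ s) ≤ B) (repeat-+ m n P) p)

        repeat-assoc : ∀ m n O → (O ++ repeat m P) ++ repeat n P ≡ O ++ repeat (m + n) P
        repeat-assoc m n O = trans (List.++-assoc O (repeat m P) (repeat n P)) (cong (O ++_) (sym (repeat-+ m n P)))

        other : ∀ (v : Vec Bool k) i i′ b → toℕ i′ ≢ toℕ i → lookupᵛ (v [ i ]≔ b) i′ ≡ lookupᵛ v i′
        other v i i′ b ne = Vec.lookup∘update′ (ne ∘ cong toℕ) v b

      end-loop : ∀ j i V O → level k j ≡ just i → toℕ i ≡ j → ClearBelow j V → (∀ p → p < ℓ → lookupᵛ (V p) i ≡ true) →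
        Σ Regs λ V′ → ClearBelow (suc j) V′ × SameFrom (suc j) V V′ × Run sweepCost (Level j V O) (Level (suc j) V′ O)
      end-loop j i V O e refl cl set = cleared i ℓ′ V , clear′ , same′ ,
        subst (λ l → Run sweepCost (Rep (just (scan l)) 0 (regTrack ℓ V) O) (Level (suc j) (cleared i ℓ′ V) O)) (sym e)
          (within (ℕ.≤-trans ℓ≤B (ℕ.n≤1+n B)) (scan-forward ℓ i V O ℓ ℕ.≤-refl set ℓ 0 refl)
          ⨾ within 1≤X (moving lemma)
          ⨾ within (ℕ.≤-trans ℓ≤B (ℕ.n≤1+n B)) (clears ℓ i O ℓ′ V ℕ.≤-refl))
        where
        lemma : act (scan (just i)) (regTrack ℓ V ℓ , false , row O ℓ) ≡ (just (clear i) , (regTrack ℓ V ℓ , false , row O ℓ) , left)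
        lemma rewrite regTrack-out ℓ V ℓ ℕ.≤-refl = refl
        clear′ : ClearBelow (suc j) (cleared i ℓ′ V)
        clear′ p (s≤s q) i′ (s≤s lt) rewrite cleared-at i ℓ′ V p q with i Fin.≟ i′
        ... | yes refl = Vec.lookup∘update i (V p) false
        ... | no ne = trans (Vec.lookup∘update′ (ne ∘ sym) (V p) false)
          (cl p (s≤s q) i′ (ℕ.≤∧≢⇒< lt (λ x → ne (Fin.toℕ-injective (sym x)))))
        same′ : SameFrom (suc j) V (cleared i ℓ′ V)
        same′ p (s≤s q) i′ ge rewrite cleared-at i ℓ′ V p q = other (V p) i i′ false (ℕ.>⇒≢ ge)

      -- Between a tick and the scan of level `j`, the loops below `j` go through one full cycle.
      LevelRuns : ℕ → Set
      LevelRuns j = ∀ V O → ClearBelow j V → length (O ++ repeat (N j) P) ≤ B →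
        Σ Regs λ V′ → ClearBelow j V′ × SameFrom j V V′ × Run (levelCost j) (Tick V O) (Level j V′ (O ++ repeat (N j) P))

      -- `s` bits of the counter are set and `r` are left; each remaining round sets one more and
      -- lets the inner loops cycle once.
      run-loop : ∀ j i r s V O → LevelRuns j → level k j ≡ just i → toℕ i ≡ j → s + r ≡ ℓ → ClearBelow j V →
        (∀ p → p < s → lookupᵛ (V p) i ≡ true) → (∀ p → s ≤ p → p < ℓ → lookupᵛ (V p) i ≡ false) →
        length (O ++ repeat (r * N j) P) ≤ B →
        Σ Regs λ V′ → ClearBelow (suc j) V′ × SameFrom (suc j) V V′
          × Run (loopCost j r) (Level j V O) (Level (suc j) V′ (O ++ repeat (r * N j) P))
      run-loop j i zero s V O runs e e′ sr cl set unset p with end-loop j i V O e e′ cl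
        (λ p q → set p (subst (p <_) (trans (sym sr) (ℕ.+-identityʳ s)) q))
      ... | V′ , cl′ , same′ , run′ = V′ , cl′ , same′ ,
        subst (λ O′ → Run sweepCost (Level j V O) (Level (suc j) V′ O′)) (sym (List.++-identityʳ O)) run′
      run-loop j i (suc r) s V O runs e refl sr cl set unset p
        with runs V₁ O cl₁ (repeat-bound (N j) (r * N j) O p)
        where
        V₁ : Regs
        V₁ = upd V s (V s [ i ]≔ true)
        cl₁ : ClearBelow j V₁
        cl₁ p q i′ lt with p ℕ.≟ s
        ... | yes refl rewrite upd-at V p (V p [ i ]≔ true) = trans (other (V p) i i′ true (ℕ.<⇒≢ lt)) (cl p q i′ lt)
        ... | no ne rewrite upd-other V s (V s [ i ]≔ true) p ne = cl p q i′ lt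
      ... | V₂ , cl₂ , same₂ , run₂ with run-loop j i r (suc s) V₂ (O ++ repeat (N j) P) runs e refl
              (trans (sym (ℕ.+-suc s r)) sr) cl₂ set₂ unset₂ (subst (λ x → length x ≤ B) (sym (repeat-assoc (N j) (r * N j) O)) p)
        where
        s<ℓ : s < ℓ
        s<ℓ = subst (s <_) sr (ℕ.m<m+n s (s≤s z≤n))
        set₂ : ∀ p → p < suc s → lookupᵛ (V₂ p) i ≡ true
        set₂ p (s≤s q) = trans (same₂ p (ℕ.≤-<-trans q s<ℓ) i ℕ.≤-refl) (here₂ (p ℕ.≟ s))
          where
          here₂ : Dec (p ≡ s) → lookupᵛ (upd V s (V s [ i ]≔ true) p) i ≡ true
          here₂ (yes refl) rewrite upd-at V p (V p [ i ]≔ true) = Vec.lookup∘update i (V p) true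
          here₂ (no ne) rewrite upd-other V s (V s [ i ]≔ true) p ne = set p (ℕ.≤∧≢⇒< q ne)
        unset₂ : ∀ p → suc s ≤ p → p < ℓ → lookupᵛ (V₂ p) i ≡ false
        unset₂ p s<p q = trans (same₂ p q i ℕ.≤-refl)
          (trans (cong (λ v → lookupᵛ v i) (upd-other V s (V s [ i ]≔ true) p (ℕ.>⇒≢ s<p))) (unset p (ℕ.<⇒≤ s<p) q))
      ... | V₃ , cl₃ , same₃ , run₃ = V₃ , cl₃ , same₁₃ ,
        subst (λ O′ → Run (loopCost j (suc r)) (Level j V O) (Level (suc j) V₃ O′)) (repeat-assoc (N j) (r * N j) O)
          (subst (λ l → Run sweepCost (Rep (just (scan l)) 0 (regTrack ℓ V) O) (Tick V₁ O)) (sym e) setAndTick ⨾ run₂ ⨾ run₃)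
        where
        V₁ : Regs
        V₁ = upd V s (V s [ i ]≔ true)
        s<ℓ : s < ℓ
        s<ℓ = subst (s <_) sr (ℕ.m<m+n s (s≤s z≤n))
        s≤B : s ≤ B
        s≤B = ℕ.≤-trans (ℕ.<⇒≤ s<ℓ) ℓ≤B
        setAndTick : Run sweepCost (Rep (just (scan (just i))) 0 (regTrack ℓ V) O) (Tick V₁ O)
        setAndTick = within (ℕ.≤-trans s≤B (ℕ.n≤1+n B)) (scan-forward ℓ i V O s (ℕ.<⇒≤ s<ℓ) set s 0 refl)
          ⨾ within 1≤X (scan-set ℓ i V O s s<ℓ (unset s ℕ.≤-refl s<ℓ))
          ⨾ within (s≤s s≤B) (go-to toTick s (regTrack ℓ V₁) O)
        same₁₃ : SameFrom (suc j) V V₃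
        same₁₃ p q i′ ge = trans (same₃ p q i′ ge) (trans (same₂ p q i′ (ℕ.<⇒≤ ge)) (old (p ℕ.≟ s)))
          where
          old : Dec (p ≡ s) → lookupᵛ (V₁ p) i′ ≡ lookupᵛ (V p) i′
          old (yes refl) rewrite upd-at V p (V p [ i ]≔ true) = other (V p) i i′ true (ℕ.>⇒≢ ge)
          old (no ne) rewrite upd-other V s (V s [ i ]≔ true) p ne = refl

      run-level : ∀ j → j ≤ k → LevelRuns j
      run-level zero _ V O cl p = V , cl , (λ _ _ _ _ → refl) ,
        within 1≤X (moving refl) ⨾ subst (λ s → Run appendCost (Rep (just (app walkText (clamp L 0))) 0 (regTrack ℓ V) O) (Level 0 V (O ++ s)))
          (sym (List.++-identityʳ P)) (appends walkText (regTrack ℓ V) O (subst (λ s → length (O ++ s) ≤ B) (List.++-identityʳ P) p))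
      run-level (suc j) j<k V O cl p with level-< k j j<k
      -- The inner loops cycle once before any bit is set and once after each of the `ℓ` bits,
      -- whence the factor `suc ℓ`.
      ... | i , e , e′ with run-level j (ℕ.<⇒≤ j<k) V O (λ p q i′ lt → cl p q i′ (ℕ.m<n⇒m<1+n lt)) (repeat-bound (N j) (ℓ * N j) O p)
      ... | V₁ , cl₁ , same₁ , run₁ with run-loop j i ℓ 0 V₁ (O ++ repeat (N j) P) (run-level j (ℕ.<⇒≤ j<k)) e e′ refl cl₁ (λ _ ())
              (λ p _ q → trans (same₁ p q i (ℕ.≤-reflexive (sym e′))) (cl p q i (s≤s (ℕ.≤-reflexive e′))))
              (subst (λ s → length s ≤ B) (sym (repeat-assoc (N j) (ℓ * N j) O)) p)
      ... | V₂ , cl₂ , same₂ , run₂ = V₂ , cl₂ ,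
        (λ p q i′ ge → trans (same₂ p q i′ ge) (same₁ p q i′ (ℕ.<⇒≤ ge))) ,
        subst (λ s → Run (levelCost (suc j)) (Tick V O) (Level (suc j) V₂ s)) (repeat-assoc (N j) (ℓ * N j) O) (run₁ ⨾ run₂)

  -- The output and its decoding

  output : List Bool → List Bool
  output w = text opening ++ (List.concatMap (text ∘ letterText) w ++
    (text middle ++ (repeat ((2 + length w) ^ k) (text walkText) ++ text closing)))

  view-input : ∀ w p → view (inputTape w p) ≡ (feedTrack 0 w p , false , nothing)
  view-input []          p       = refl
  view-input (false ∷ w) zero    = refl
  view-input (true ∷ w)  zero    = refl
  view-input (b ∷ w)     (suc p) = view-input w p

  initial : ∀ w → Rep (just (app opening (clamp L 0))) 0 (feedTrack 0 w) [] (step machine (initConfig machine w))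
  initial w = subst (Rep (just (app opening (clamp L 0))) 0 (feedTrack 0 w) []) (sym (step-eq {t = inputTape w} {h = 0} δ≡))
    (rep refl refl λ { zero → view-write _ ; (suc p) → view-input w (suc p) })
    where
    δ≡ : TM.δ machine (𝒮.enc (just init)) (inputTape w 0) ≡
      (run (𝒮.enc (just (app opening (clamp L 0)))) , write (feedTrack 0 w 0 , true , nothing) , stay)
    δ≡ = cong₂ transition (𝒮.dec-enc (just init)) (view-input w 0)

  record Copying (h : ℕ) (O : List Bool) (c : Config machine) : Set where
    constructor copying
    field
      copy-ctrl : ctrl c ≡ run (𝒮.enc nothing)
      copy-head : head c ≡ h
      copied    : ∀ p b → p < h → row O p ≡ just b → tape c p ≡ bitSym b
      uncopied  : ∀ p → h ≤ p → proj₂ (proj₂ (view (tape c p))) ≡ row O p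

  finish-copy : ∀ x b → proj₂ (proj₂ x) ≡ just b → finish x ≡ (run (𝒮.enc nothing) , bitSym b , right)
  finish-copy (_ , _ , just b) .b refl = refl

  finish-halt : ∀ x → proj₂ (proj₂ x) ≡ nothing → finish x ≡ (halt true , fz , stay)
  finish-halt (_ , _ , nothing) refl = refl

  Copied : List Bool → Config machine → Set
  Copied O c = ctrl c ≡ halt true × (∀ p b → row O p ≡ just b → tape c p ≡ bitSym b) × tape c (length O) ≡ fz

  copy : ∀ d h O c → h + d ≡ length O → Copying h O c → Copied O (runFor machine (suc d) c)
  copy zero h O (config ._ t ._) p (copying refl refl cp uc) rewrite ℕ.+-identityʳ h | p =
    subst (Copied O) (sym (step-eq {t = t} {h = length O} δ≡))
      (refl , (λ p b e → trans (elsewhere p (ℕ.<⇒≢ (row-< O p e))) (cp p b (row-< O p e) e)) , here-fz)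
    where
    δ≡ : TM.δ machine (𝒮.enc nothing) (t (length O)) ≡ (halt true , fz , stay)
    δ≡ = trans (cong (λ s → transition s (view (t (length O)))) (𝒮.dec-enc nothing))
           (finish-halt _ (trans (uc (length O) ℕ.≤-refl) (row-end O)))
    elsewhere : ∀ p → p ≢ length O → (if p ≡ᵇ length O then fz else t p) ≡ t p
    elsewhere p ne rewrite ≡ᵇ-false ne = refl
    here-fz : (if length O ≡ᵇ length O then fz else t (length O)) ≡ fz
    here-fz rewrite ≡ᵇ-true (length O) = refl
    row-< : ∀ O p {b} → row O p ≡ just b → p < length O
    row-< (x ∷ O) zero    e = s≤s z≤n
    row-< (x ∷ O) (suc p) e = s≤s (row-< O p e)
  copy (suc d) h O (config ._ t ._) p (copying refl refl cp uc) =
    copy d (suc h) O _ (trans (sym (ℕ.+-suc h d)) p) (subst (Copying (suc h) O) (sym (step-eq {t = t} {h = h} δ≡))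
      (copying refl refl cp′ uc′))
    where
    h<O : h < length O
    h<O = subst (h <_) p (ℕ.m<m+n h (s≤s z≤n))
    bₕ = proj₁ (row-defined O h h<O)
    δ≡ : TM.δ machine (𝒮.enc nothing) (t h) ≡ (run (𝒮.enc nothing) , bitSym bₕ , right)
    δ≡ = trans (cong (λ s → transition s (view (t h))) (𝒮.dec-enc nothing))
           (finish-copy _ _ (trans (uc h ℕ.≤-refl) (proj₂ (row-defined O h h<O))))
    cp′ : ∀ p b → p < suc h → row O p ≡ just b → (if p ≡ᵇ h then bitSym bₕ else t p) ≡ bitSym b
    cp′ p b (s≤s q) e with p ℕ.≟ h
    ... | yes refl rewrite ≡ᵇ-true p = cong bitSym (just-injective (trans (sym (proj₂ (row-defined O p h<O))) e))
    ... | no ne rewrite ≡ᵇ-false ne = cp p b (ℕ.≤∧≢⇒< q ne) e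
    uc′ : ∀ p → suc h ≤ p → proj₂ (proj₂ (view (if p ≡ᵇ h then bitSym bₕ else t p))) ≡ row O p
    uc′ p q rewrite ≡ᵇ-false {p} {h} (ℕ.>⇒≢ q) = uc p (ℕ.<⇒≤ q)

  readOut-copied : ∀ O (t : ℕ → Fin (3 + nSym)) fuel s → (∀ p b → row O p ≡ just b → t (p + s) ≡ bitSym b) →
    t (length O + s) ≡ fz → length O < fuel → readOut fuel t s ≡ O
  readOut-copied [] t (suc fuel) s h e p rewrite e = refl
  readOut-copied (false ∷ O) t (suc fuel) s h e (s≤s p) rewrite h 0 false refl =
    cong (false ∷_) (readOut-copied O t fuel (suc s) (λ p b eq → trans (cong t (ℕ.+-suc p s)) (h (suc p) b eq))
      (trans (cong t (ℕ.+-suc (length O) s)) e) p)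
  readOut-copied (true ∷ O) t (suc fuel) s h e (s≤s p) rewrite h 0 true refl =
    cong (true ∷_) (readOut-copied O t fuel (suc s) (λ p b eq → trans (cong t (ℕ.+-suc p s)) (h (suc p) b eq))
      (trans (cong t (ℕ.+-suc (length O) s)) e) p)

  copied-output : ∀ O c fuel → Copied O c → length O < fuel → readOut fuel (tape c) 0 ≡ O
  copied-output O c fuel (_ , bits , end) = readOut-copied O (tape c) fuel 0
    (λ p b e → trans (cong (tape c) (ℕ.+-identityʳ p)) (bits p b e)) (trans (cong (tape c) (ℕ.+-identityʳ (length O))) end)

  -- The whole computation

  module Computation (B : ℕ) (w : List Bool) (w<B : length w < B) (out≤B : length (output w) ≤ B) where
    open Timed B
    open Loops (length w) w<B

    cost : ℕ
    cost = appendCost + (feedCost w + (0 + (levelCost k + (X + appendCost))))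

    private
      n = length w
      O₁ = text opening
      O₂ = O₁ ++ (List.concatMap (text ∘ letterText) w ++ text middle)
      O₃ = O₂ ++ repeat ((2 + n) ^ k) (text walkText)
      O₄ = O₃ ++ text closing

      O₄≡ : O₄ ≡ output w
      O₄≡ = begin
        ((O₁ ++ (C ++ M)) ++ W) ++ E   ≡⟨ List.++-assoc (O₁ ++ (C ++ M)) W E ⟩
        (O₁ ++ (C ++ M)) ++ (W ++ E)   ≡⟨ List.++-assoc O₁ (C ++ M) (W ++ E) ⟩
        O₁ ++ ((C ++ M) ++ (W ++ E))   ≡⟨ cong (O₁ ++_) (List.++-assoc C M (W ++ E)) ⟩
        O₁ ++ (C ++ (M ++ (W ++ E)))   ∎
        where
        open ≡-Reasoning
        C = List.concatMap (text ∘ letterText) w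
        M = text middle
        W = repeat ((2 + n) ^ k) (text walkText)
        E = text closing

      prefix : ∀ (s s′ : List Bool) → length (s ++ s′) ≤ B → length s ≤ B
      prefix s s′ p = ℕ.≤-trans (ℕ.≤-trans (ℕ.m≤m+n (length s) (length s′)) (ℕ.≤-reflexive (sym (List.length-++ s)))) p

      b₄ : length O₄ ≤ B
      b₄ = subst (λ O → length O ≤ B) (sym O₄≡) out≤B
      b₃ : length O₃ ≤ B
      b₃ = prefix O₃ (text closing) b₄
      b₂ : length O₂ ≤ B
      b₂ = prefix O₂ (repeat ((2 + n) ^ k) (text walkText)) b₃

      levels = run-level k ℕ.≤-refl (λ _ → blankVec) O₂ (λ _ _ i _ → Vec.lookup-replicate i false) b₃
      V = proj₁ levels

      close : Run (X + appendCost) (Rep (just (scan nothing)) 0 (regTrack (suc n) V) O₃) (Rep nothing 0 (regTrack (suc n) V) O₄)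
      close = within 1≤X (moving refl) ⨾ appends closing (regTrack (suc n) V) O₃ b₄

    run-all : Run cost (Rep (just (app opening (clamp L 0))) 0 (feedTrack 0 w) []) (Rep nothing 0 (regTrack (suc n) V) (output w))
    run-all = appends opening (feedTrack 0 w) [] (prefix O₁ _ out≤B)
      ⨾ feeds w 0 O₁ (ℕ.<⇒≤ w<B) b₂
      ⨾ retrack (regTrack-blank (suc n))
      ⨾ proj₂ (proj₂ (proj₂ levels))
      ⨾ subst₂ (λ l O → Run (X + appendCost) (Rep (just (scan l)) 0 (regTrack (suc n) V) O₃) (Rep nothing 0 (regTrack (suc n) V) O))
          (sym (level-end k)) O₄≡ close

    computes : Σ ℕ λ m → m ≤ suc (cost + suc (length (output w))) × Σ Bool λ b →
      ctrl (runFor machine m (initConfig machine w)) ≡ halt b ×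
      readOut (suc (n + m)) (tape (runFor machine m (initConfig machine w))) 0 ≡ output w
    computes with Run.reaches run-all (step machine (initConfig machine w)) (initial w)
    ... | m , m≤ , rep rc rh tp = suc (m + suc l) , s≤s (ℕ.+-monoˡ-≤ (suc l) m≤) , true ,
      trans (cong ctrl runs≡) (proj₁ copied) ,
      trans (cong (λ c → readOut (suc (n + suc (m + suc l))) (tape c) 0) runs≡)
        (copied-output (output w) c′ (suc (n + suc (m + suc l))) copied
          (s≤s (ℕ.≤-trans (ℕ.≤-trans (ℕ.n≤1+n l) (ℕ.≤-trans (ℕ.m≤n+m (suc l) m) (ℕ.n≤1+n (m + suc l)))) (ℕ.m≤n+m (suc (m + suc l)) n))))
      where
      l = length (output w)
      c₁ = runFor machine m (step machine (initConfig machine w))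
      c′ = runFor machine (suc l) c₁
      copied : Copied (output w) c′
      copied = copy l 0 (output w) c₁ refl (copying rc rh (λ _ _ ()) (λ p _ → cong (proj₂ ∘ proj₂) (tp p)))
      runs≡ : runFor machine (suc (m + suc l)) (initConfig machine w) ≡ c′
      runs≡ = runFor-+ machine m (suc l) (step machine (initConfig machine w))

-- Polynomial bounds

-- The base `2 + n` is at least 2, so constant factors and sums are absorbed by a larger exponent.
Poly : (ℕ → ℕ) → Set
Poly f = Σ ℕ λ e → ∀ n → f n ≤ (2 + n) ^ e

n<2^n : ∀ n → n < 2 ^ n
n<2^n zero    = s≤s z≤n
n<2^n (suc n) = ℕ.≤-trans (ℕ.+-mono-≤ (ℕ.m^n>0 2 n) (n<2^n n)) (ℕ.≤-reflexive lemma)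
  where
  lemma : 2 ^ n + 2 ^ n ≡ 2 ^ suc n
  lemma = cong (2 ^ n +_) (sym (ℕ.+-identityʳ (2 ^ n)))

poly-const : ∀ c → Poly (λ _ → c)
poly-const c = c , λ n → ℕ.≤-trans (ℕ.<⇒≤ (n<2^n c)) (ℕ.^-monoˡ-≤ c (ℕ.m≤m+n 2 n))

poly-id : Poly id
poly-id = 1 , λ n → ℕ.≤-trans (ℕ.m≤n+m n 2) (ℕ.≤-reflexive (sym (ℕ.*-identityʳ (2 + n))))

poly-+ : ∀ {f h} → Poly f → Poly h → Poly (λ n → f n + h n)
poly-+ (a , p) (b , q) = suc (a + b) , λ n → ℕ.≤-trans
  (ℕ.+-mono-≤ (ℕ.≤-trans (p n) (ℕ.^-monoʳ-≤ (2 + n) (ℕ.m≤m+n a b)))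
    (ℕ.≤-trans (ℕ.≤-trans (q n) (ℕ.^-monoʳ-≤ (2 + n) (ℕ.m≤n+m b a))) (ℕ.≤-reflexive (sym (ℕ.+-identityʳ ((2 + n) ^ (a + b)))))))
  (ℕ.*-monoˡ-≤ ((2 + n) ^ (a + b)) (ℕ.m≤m+n 2 n))

poly-* : ∀ {f h} → Poly f → Poly h → Poly (λ n → f n * h n)
poly-* (a , p) (b , q) = a + b , λ n → ℕ.≤-trans (ℕ.*-mono-≤ (p n) (q n)) (ℕ.≤-reflexive (sym (ℕ.^-distribˡ-+-* (2 + n) a b)))

poly-power : ∀ e → Poly (λ n → (2 + n) ^ e)
poly-power e = e , λ n → ℕ.≤-refl

poly-≡ : ∀ {f h} → (∀ n → f n ≡ h n) → Poly h → Poly f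
poly-≡ e (a , p) = a , λ n → subst (_≤ (2 + n) ^ a) (sym (e n)) (p n)

module PolynomialWriter (k : ℕ) (text : Code → List Bool) (L : ℕ) (text≤L : ∀ c → length (text c) ≤ L) where
  open Writer k text L text≤L

  -- Covers the length of the output as well as the `suc n` cells used as registers.
  bound : ℕ → ℕ
  bound n = (length (text opening) + (n * L + (length (text middle) + ((2 + n) ^ k * length (text walkText) + length (text closing))))) + suc n

  suc≤bound : ∀ n → suc n ≤ bound n
  suc≤bound n = ℕ.m≤n+m (suc n) _

  length-repeat : ∀ m s → length (repeat m s) ≡ m * length s
  length-repeat zero    s = refl
  length-repeat (suc m) s = trans (List.length-++ s) (cong (length s +_) (length-repeat m s))

  length-letters : ∀ w → length (List.concatMap (text ∘ letterText) w) ≤ length w * L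
  length-letters []      = z≤n
  length-letters (b ∷ w) = ℕ.≤-trans (ℕ.≤-reflexive (List.length-++ (text (letterText b)))) (ℕ.+-mono-≤ (text≤L (letterText b)) (length-letters w))

  output≤bound : ∀ w → length (output w) ≤ bound (length w)
  output≤bound w = ℕ.≤-trans (ℕ.≤-trans (ℕ.≤-reflexive (List.length-++ (text opening)))
    (ℕ.+-monoʳ-≤ (length (text opening)) (ℕ.≤-trans (ℕ.≤-reflexive (List.length-++ (List.concatMap (text ∘ letterText) w)))
      (ℕ.+-mono-≤ (length-letters w) (ℕ.≤-reflexive (trans (List.length-++ (text middle)) (cong (length (text middle) +_)
        (trans (List.length-++ (repeat ((2 + length w) ^ k) (text walkText))) (cong (_+ length (text closing))
          (length-repeat ((2 + length w) ^ k) (text walkText)))))))))))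
    (ℕ.m≤m+n _ (suc (length w)))

  poly-bound : Poly bound
  poly-bound = poly-+ (poly-+ (poly-const (length (text opening))) (poly-+ (poly-* poly-id (poly-const L)) (poly-+ (poly-const (length (text middle)))
    (poly-+ (poly-* (poly-power k) (poly-const (length (text walkText)))) (poly-const (length (text closing))))))) (poly-+ (poly-const 1) poly-id)

  poly-X : Poly (λ n → Timed.X (bound n))
  poly-X = poly-+ (poly-const 1) poly-bound

  poly-append : Poly (λ n → Timed.appendCost (bound n))
  poly-append = poly-+ poly-X (poly-+ poly-X poly-X)

  letterCost : ℕ → ℕ
  letterCost n = X + (X + (X + appendCost))
    where open Timed (bound n)

  feedCost-closed : ∀ n w → Timed.feedCost (bound n) w ≡ suc (length w) * letterCost n
  feedCost-closed n []      = sym (ℕ.+-identityʳ _)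
  feedCost-closed n (b ∷ w) = cong (letterCost n +_) (feedCost-closed n w)

  levelCost′ : ℕ → ℕ → ℕ
  levelCost′ j n = Timed.Loops.levelCost (bound n) n (suc≤bound n) j

  -- `appendCost` stands in for `sweepCost`: both are three times `X`.
  loopCost-closed : ∀ j n r → Timed.Loops.loopCost (bound n) n (suc≤bound n) j r ≡
    r * (Timed.appendCost (bound n) + levelCost′ j n) + Timed.appendCost (bound n)
  loopCost-closed j n zero    = refl
  loopCost-closed j n (suc r) = trans (cong (λ x → Timed.appendCost (bound n) + (levelCost′ j n + x)) (loopCost-closed j n r))
    (trans (sym (ℕ.+-assoc (Timed.appendCost (bound n)) (levelCost′ j n) _)) (sym (ℕ.+-assoc (Timed.appendCost (bound n) + levelCost′ j n) _ _)))

  -- Each loop multiplies the cost by a polynomial, so the exponent grows with `j`; the number of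
  -- loops is fixed by the machine that is reduced.
  poly-level : ∀ j → Poly (levelCost′ j)
  poly-level zero    = poly-+ poly-X poly-append
  poly-level (suc j) = poly-+ (poly-level j) (poly-≡ (λ n → loopCost-closed j n (suc n))
    (poly-+ (poly-* (poly-+ (poly-const 1) poly-id) (poly-+ poly-append (poly-level j))) poly-append))

  time : ℕ → ℕ
  time n = 1 + ((Timed.appendCost (bound n) + (suc n * letterCost n + (0 + (levelCost′ k n + (Timed.X (bound n) + Timed.appendCost (bound n))))))
    + (1 + bound n))

  poly-time : Poly time
  poly-time = poly-+ (poly-const 1) (poly-+ (poly-+ poly-append (poly-+ (poly-* (poly-+ (poly-const 1) poly-id)
      (poly-+ poly-X (poly-+ poly-X (poly-+ poly-X poly-append)))) (poly-+ (poly-const 0) (poly-+ (poly-level k) (poly-+ poly-X poly-append)))))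
    (poly-+ (poly-const 1) poly-bound))

  output-polynomial : PolyTimeComputable output
  output-polynomial = machine , proj₁ poly-time , λ w →
    let m , m≤ , rest = Computation.computes (bound (length w)) w (suc≤bound (length w)) (output≤bound w)
    in m , ℕ.≤-trans m≤ (ℕ.≤-trans (time≤ w) (proj₂ poly-time (length w))) , rest
    where
    time≤ : ∀ w → suc (Computation.cost (bound (length w)) w (suc≤bound (length w)) (output≤bound w) + suc (length (output w))) ≤ time (length w)
    time≤ w = s≤s (ℕ.+-mono-≤ (ℕ.+-monoʳ-≤ (Timed.appendCost (bound (length w)))
      (ℕ.+-monoˡ-≤ (0 + (levelCost′ k (length w) + (Timed.X (bound (length w)) + Timed.appendCost (bound (length w)))))
        (ℕ.≤-reflexive (feedCost-closed (length w) w))))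
      (s≤s (output≤bound w)))

-- The reduction

halt-injective : ∀ {n} {b b′ : Bool} → halt {n} b ≡ halt b′ → b ≡ b′
halt-injective refl = refl

halt-stays : ∀ M n c {b} → ctrl c ≡ halt b → ctrl (runFor M n c) ≡ halt b
halt-stays M zero    c e = e
halt-stays M (suc n) (config ._ t h) refl = halt-stays M n (config (halt _) t h) refl

-- The halting time found in the proof tree and the one given by the decider may differ, but halting
-- configurations are frozen.
halt-unique : ∀ M c m n {b b′} → ctrl (runFor M m c) ≡ halt b → ctrl (runFor M n c) ≡ halt b′ → b ≡ b′
halt-unique M c m n {b} {b′} p q with ℕ.≤-total m n
... | inj₁ m≤n = halt-injective (trans (sym (halt-stays M (n ∸ m) (runFor M m c) p))
    (trans (cong ctrl (trans (sym (runFor-+ M m (n ∸ m) c)) (cong (λ l → runFor M l c) (ℕ.m+[n∸m]≡n m≤n)))) q))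
... | inj₂ n≤m = halt-injective (trans (sym p) (trans (cong ctrl (sym (trans (sym (runFor-+ M n (m ∸ n) c)) (cong (λ l → runFor M l c) (ℕ.m+[n∸m]≡n n≤m)))))
    (halt-stays M (m ∸ n) (runFor M n c) q)))

2+2^ : ∀ a → 2 + 2 ^ a ≤ 2 ^ (2 + a)
2+2^ a = ℕ.≤-trans (ℕ.+-monoˡ-≤ x (ℕ.*-monoʳ-≤ 2 (ℕ.m^n>0 2 a))) (ℕ.≤-trans (ℕ.≤-reflexive (ℕ.+-comm (2 * x) x))
  (ℕ.≤-trans (ℕ.+-monoʳ-≤ x (ℕ.m≤n+m (2 * x) x)) (ℕ.≤-reflexive lemma)))
  where
  x = 2 ^ a
  lemma : x + (x + 2 * x) ≡ 2 * (2 * x)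
  lemma = trans (sym (ℕ.+-assoc x x (2 * x))) (cong₂ _+_ (cong (x +_) (sym (ℕ.+-identityʳ x))) (sym (ℕ.+-identityʳ (2 * x))))

-- The left side bounds the coordinates of the accepting tile after `n` steps. It stays below four
-- times the time bound, and `2+2^` pushes the resulting summand 2 up through both inner exponents.
triple-bound : ∀ e m n → 2 + e ≤ m → n ≤ 2 ^ (2 ^ (2 ^ e)) → 2 + (n + n) < 2 ^ (2 ^ (2 ^ m))
triple-bound e m n e≤m p = begin-strict
  2 + (n + n)             ≤⟨ ℕ.+-monoʳ-≤ 2 (ℕ.+-mono-≤ p p) ⟩
  2 + (U + U)             <⟨ ℕ.+-monoˡ-< (U + U) (ℕ.+-mono-< U>1 U>1) ⟩
  (U + U) + (U + U)       ≡⟨ cong₂ _+_ (cong (U +_) (sym (ℕ.+-identityʳ U))) (trans (cong (U +_) (sym (ℕ.+-identityʳ U))) (sym (ℕ.+-identityʳ (2 * U)))) ⟩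
  2 ^ (2 + 2 ^ (2 ^ e))   ≤⟨ ℕ.^-monoʳ-≤ 2 (ℕ.≤-trans (2+2^ (2 ^ e)) (ℕ.^-monoʳ-≤ 2 (ℕ.≤-trans (2+2^ e) (ℕ.^-monoʳ-≤ 2 e≤m)))) ⟩
  2 ^ (2 ^ (2 ^ m))       ∎
  where
  open ℕ.≤-Reasoning
  U = 2 ^ (2 ^ (2 ^ e))
  U>1 : 1 < U
  U>1 = ℕ.≤-trans (s≤s (ℕ.m^n>0 2 (2 ^ e))) (n<2^n (2 ^ (2 ^ e)))

total : {A B : Set} → (B → ℕ) → (A → B) → List A → ℕ
total f h []       = 0
total f h (x ∷ xs) = f (h x) + total f h xs

total-≥ : {A B : Set} (f : B → ℕ) (h : A → B) {x : A} {xs : List A} → x ∈ xs → f (h x) ≤ total f h xs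
total-≥ f h (hereˡ refl)              = ℕ.m≤m+n _ _
total-≥ f h {xs = y ∷ _} (thereˡ x∈xs) = ℕ.≤-trans (total-≥ f h x∈xs) (ℕ.m≤n+m _ (f (h y)))

module Reduction (M : TM) (e : ℕ) (𝓛 : List Bool → Set)
                 (decides : DecidesIn M (λ n → 2 ^ (2 ^ (2 ^ ((2 + n) ^ e)))) 𝓛) where
  private
    𝒯 = tilesOf M
    -- Makes the leftmost branches deep enough for all tile numbers and supplies the two extra
    -- levels that `triple-bound` asks for.
    pad = 3 + κᴹ M

  text : Code → List Bool
  text opening        = code₁ 𝒯 pad
  text (letterText b) = letterCode b
  text middle         = code₂ 𝒯 pad
  text walkText       = walkCode
  text closing        = code₃ 𝒯 pad

  allCodes : List Code
  allCodes = opening ∷ middle ∷ walkText ∷ closing ∷ letterText false ∷ letterText true ∷ []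

  ∈-allCodes : ∀ c → c ∈ allCodes
  ∈-allCodes opening            = hereˡ refl
  ∈-allCodes middle             = thereˡ (hereˡ refl)
  ∈-allCodes walkText           = thereˡ (thereˡ (hereˡ refl))
  ∈-allCodes closing            = thereˡ (thereˡ (thereˡ (hereˡ refl)))
  ∈-allCodes (letterText false) = thereˡ (thereˡ (thereˡ (thereˡ (hereˡ refl))))
  ∈-allCodes (letterText true)  = thereˡ (thereˡ (thereˡ (thereˡ (thereˡ (hereˡ refl)))))

  textBound : ℕ
  textBound = total length text allCodes

  text≤textBound : ∀ c → length (text c) ≤ textBound
  text≤textBound c = total-≥ length text (∈-allCodes c)

  -- The exponent is `suc e`, so that even for `e = 0` the number of levels exceeds the length of
  -- the input.
  open Writer (suc e) text textBound text≤textBound using (output)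

  levels : List Bool → ℕ
  levels w = pad + (2 + length w) ^ suc e

  reduced : List Bool → Sentence
  reduced w = sentence 𝒯 w (levels w)

  encode-reduced : ∀ w → encode (reduced w) ≡ output w
  encode-reduced w = encode-sentence 𝒯 pad w ((2 + length w) ^ suc e)

  private
    length<levels : ∀ w → 2 + length w ≤ levels w
    length<levels w = ℕ.≤-trans (ℕ.≤-trans (ℕ.≤-reflexive (sym (ℕ.*-identityʳ _))) (ℕ.*-monoʳ-≤ (2 + length w) (ℕ.m^n>0 (2 + length w) e)))
      (ℕ.m≤n+m _ pad)

    exponent≤levels : ∀ w → 2 + (2 + length w) ^ e ≤ levels w
    exponent≤levels w = ℕ.+-mono-≤ {2} {pad} (s≤s (s≤s z≤n)) (ℕ.^-monoʳ-≤ (2 + length w) (ℕ.n≤1+n e))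

  accepts-sat : ∀ w → 𝓛 w → ∀ ρ → Sat 𝔄 ρ (reduced w)
  accepts-sat w x ρ with decides w
  ... | n , n≤ , b , halts , b⇔ with from b⇔ x
  ... | refl = sentence-complete 𝒯 w m ρ (claim 𝒯 w m (tl M w) a t) deep (κ≤ m pad≤) w<
        (claim-good 𝒯 w m (tl M w) (κ≤ m pad≤) w< (tl-consistent M w m) a t a< t< acc)
    where
    m = levels w
    hd = head (runFor M n (initConfig M w))
    a = suc (suc n + hd)
    t = suc (suc n)
    acc = tile-accepted M w n halts
    pad≤ : pad ≤ m
    pad≤ = ℕ.m≤m+n pad _
    κ≤ : ∀ m → pad ≤ m → κᴹ M ≤ 2 ^ m
    κ≤ m p = ℕ.≤-trans (ℕ.≤-trans (ℕ.m≤n+m (κᴹ M) 3) p) (ℕ.<⇒≤ (n<2^n m))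
    w< : length w < 2 ^ m
    w< = ℕ.≤-<-trans (ℕ.≤-trans (ℕ.m≤n+m (length w) 2) (length<levels w)) (n<2^n m)
    big : 2 + (n + n) < capᵖ (2 ^ m)
    big = subst (2 + (n + n) <_) (sym (capᵖ-power (2 ^ m))) (triple-bound ((2 + length w) ^ e) m n (exponent≤levels w) n≤)
    a< : a < capᵖ (2 ^ m)
    a< = ℕ.≤-<-trans (s≤s (s≤s (ℕ.+-monoʳ-≤ n (head-bound M w n)))) big
    t< : t < capᵖ (2 ^ m)
    t< = ℕ.≤-<-trans (s≤s (s≤s (ℕ.m≤m+n n n))) big
    deep = claim-deep 𝒯 w m (tl M w) (κ≤ m pad≤) w< (tl-consistent M w m) a t a< t< acc

  sat-accepts : ∀ w ρ → Sat 𝔄 ρ (reduced w) → 𝓛 w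
  sat-accepts w ρ s with sentence-sound 𝒯 w (levels w) ρ s
  ... | c , good with good-sound 𝒯 w (tl-determined M w) good
  ... | a , t , ok with accepted-tile M w a t ok | decides w
  ... | n′ , halts′ | n , n≤ , b , halts , b⇔ = to b⇔ (halt-unique M (initConfig M w) n n′ halts halts′)

  reduces : 𝓛 ≤p FOTh 𝔄
  reduces = output , PolynomialWriter.output-polynomial (suc e) text textBound text≤textBound , λ w → mk⇔
    (λ x → reduced w , sentence-closed 𝒯 w (levels w) , encode-reduced w , accepts-sat w x)
    (λ { (φ , _ , e′ , sat) → sat-accepts w (λ _ → lf rt)
      (subst (Sat 𝔄 (λ _ → lf rt)) (encode-injective φ (reduced w) (trans e′ (sym (encode-reduced w)))) (sat (λ _ → lf rt))) })

theorem5 : Σ ℕ λ r → Σ (Fin r → ℕ) λ ar → Σ (Structure r ar) λ A →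
    TreeAutomatic A × BoundedDegree A × 3EXPTIME-hard (FOTh A)
theorem5 = R , arity , 𝔄 , 𝔄-treeAutomatic , 𝔄-boundedDegree , λ 𝓛 (M , e , decides) → Reduction.reduces M e 𝓛 decides
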